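{- Let $G$ be a finite simple connected graph on $n$ vertices and let $w:E(G)\to\mathbb{R}_{>0}$ be a positive edge-weighting. For each edge $e\in E(G)$ define $C_w(e)$ to be the maximum of $w(C)=\sum_{f\in E(C)}w(f)$ over all cycles $C\subseteq G$ with $e\in E(C)$ if $e$ lies on some cycle, and $C_w(e)=2w(e)$ if $e$ is a bridge. Then $$\sum_{e\in E(G)}\frac{w(e)}{C_w(e)}\le \frac{n-1}{2}.$$
   Context: A bridge is an edge lying on no cycle. For a subgraph $H$, $w(H)=\sum_{e\in E(H)}w(e)$. -}

module Defs where

open import Data.Bool using (Bool; T)
open import Data.Bool.Properties using (T?; T-irrelevant)
open import Data.Empty using (⊥-elim)
open import Data.Fin as Fin using (Fin)
import Data.Fin.Properties as Fin
open import Data.List using (List; []; _∷_; map; foldr; filter; mapMaybe; zip; _∷ʳ_; length; lookup; allFin; upTo; concatMap; cartesianProduct; cartesianProductWith)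
open import Data.List.Membership.Propositional using (_∈_; find; lose)
open import Data.List.Membership.Propositional.Properties using (∈-filter⁺; ∈-allFin; ∈-cartesianProduct⁺; ∈-cartesianProductWith⁺; ∈-concatMap⁺; ∈-upTo⁺; ∈-lookup; ∈-map⁺)
open import Data.List.Relation.Unary.All as All using (All; []; _∷_; all?)
import Data.List.Relation.Unary.All.Properties as All
open import Data.List.Relation.Unary.Any as Any using (Any; here; there; any?)
import Data.List.Relation.Unary.Any.Properties as Any
open import Data.List.Relation.Unary.AllPairs using ([]; _∷_)
open import Data.List.Relation.Unary.Unique.Propositional using (Unique)
import Data.List.Relation.Unary.Unique.Propositional.Properties as Unique
open import Data.Maybe using (Maybe; just; nothing)
import Data.Maybe.Relation.Unary.Any as Maybe
open import Data.Nat as ℕ using (ℕ; zero; suc)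
import Data.Nat.Properties as ℕ
open import Data.Product using (∃; _×_; _,_; proj₁; proj₂)
open import Data.Rational using (ℚ; 0ℚ; 1ℚ; ½; _+_; _*_; _-_; -_; _⊔_; ∣_∣; 1/_; _<_; _≤_; positive; nonNegative; ≢-nonZero)
open import Data.Rational.Properties
open import Data.Rational.Solver using (module +-*-Solver)
open import Data.Sum using (_⊎_; inj₁; inj₂)
open import Relation.Binary.Construct.Closure.ReflexiveTransitive using (Star)
open import Relation.Binary.PropositionalEquality using (_≡_; _≢_; refl; sym; trans; cong; cong₂; subst; module ≡-Reasoning)
open import Relation.Nullary using (¬_; Dec; yes; no)
open import Relation.Nullary.Decidable using (_×-dec_; _⊎-dec_; map′)

private
  open +-*-Solver using (solve; _:=_; _:+_; _:*_; _:-_; :-_; con)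

  *-pos : ∀ {p q} → 0ℚ < p → 0ℚ < q → 0ℚ < p * q
  *-pos {p} {q} p>0 q>0 = positive⁻¹ (p * q) {{pos*pos⇒pos p {{positive p>0}} q {{positive q>0}}}}

  ½-pos : ∀ {p} → 0ℚ < p → 0ℚ < p * ½
  ½-pos p>0 = *-pos p>0 (positive⁻¹ ½)

  ½+½ : ∀ p → p * ½ + p * ½ ≡ p
  ½+½ = solve 1 (λ p → p :* con ½ :+ p :* con ½ := p) refl

  p≤∣p∣ : ∀ p → p ≤ ∣ p ∣
  p≤∣p∣ p with ≤-total 0ℚ p
  ... | inj₁ 0≤p = ≤-reflexive (sym (0≤p⇒∣p∣≡p 0≤p))
  ... | inj₂ p≤0 = ≤-trans p≤0 (0≤∣p∣ p)

  ∣∣-swap : ∀ p q → ∣ p - q ∣ ≡ ∣ q - p ∣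
  ∣∣-swap p q = trans (sym (∣-p∣≡∣p∣ (p - q)))
    (cong ∣_∣ (solve 2 (λ p q → :- (p :- q) := q :- p) refl p q))

  close⇒≤ : ∀ {p q ε} → ∣ p - q ∣ < ε → p < q + ε
  close⇒≤ {p} {q} {ε} h = subst (_< q + ε)
    (solve 2 (λ p q → q :+ (p :- q) := p) refl p q)
    (+-monoʳ-< q (≤-<-trans (p≤∣p∣ (p - q)) h))

  close : ∀ {p q ε} → p < q + ε → q < p + ε → ∣ p - q ∣ < ε
  close {p} {q} {ε} h k with ∣p∣≡p∨∣p∣≡-p (p - q)
  ... | inj₁ eq = subst (_< ε) (sym eq)
    (subst (p - q <_) (solve 2 (λ q ε → q :+ ε :- q := ε) refl q ε) (+-monoˡ-< (- q) h))
  ... | inj₂ eq = subst (_< ε) (sym (trans eq (solve 2 (λ p q → :- (p :- q) := q :- p) refl p q)))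
    (subst (q - p <_) (solve 2 (λ p ε → p :+ ε :- p := ε) refl p ε) (+-monoˡ-< (- p) k))

  ⊔-lub-< : ∀ {p q r} → p < r → q < r → p ⊔ q < r
  ⊔-lub-< {p} {q} h k with ⊔-sel p q
  ... | inj₁ eq = subst (_< _) (sym eq) h
  ... | inj₂ eq = subst (_< _) (sym eq) k

  ⊔-close : ∀ {p p′ q q′ ε} → ∣ p - p′ ∣ < ε → ∣ q - q′ ∣ < ε → ∣ (p ⊔ q) - (p′ ⊔ q′) ∣ < ε
  ⊔-close {p} {p′} {q} {q′} {ε} h k = close
    (half {p} {p′} {q} {q′} h k)
    (half {p′} {p} {q′} {q} (subst (_< ε) (∣∣-swap p p′) h) (subst (_< ε) (∣∣-swap q q′) k))
    where
    half : ∀ {p p′ q q′} → ∣ p - p′ ∣ < ε → ∣ q - q′ ∣ < ε → p ⊔ q < (p′ ⊔ q′) + ε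
    half {p} {p′} {q} {q′} h k = ⊔-lub-<
      (<-≤-trans (close⇒≤ {p} {p′} h) (+-monoˡ-≤ ε (p≤p⊔q p′ q′)))
      (<-≤-trans (close⇒≤ {q} {q′} k) (+-monoˡ-≤ ε (p≤q⊔p p′ q′)))

  +-close : ∀ {p q ε} → ∣ p ∣ < ε * ½ → ∣ q ∣ < ε * ½ → ∣ p + q ∣ < ε
  +-close {p} {q} {ε} h k = ≤-<-trans (∣p+q∣≤∣p∣+∣q∣ p q)
    (subst (∣ p ∣ + ∣ q ∣ <_) (½+½ ε) (+-mono-< h k))

-- Used for reciprocals of Cauchy sequences bounded away from 0ℚ, only finitely
-- many of whose terms can vanish; so the value at 0ℚ is immaterial.
inv : ℚ → ℚ
inv p with p ≟ 0ℚ
... | yes _   = 0ℚ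
... | no p≢0 = (1/ p) {{≢-nonZero p≢0}}

private
  *-inv : ∀ {p} → 0ℚ < p → p * inv p ≡ 1ℚ
  *-inv {p} p>0 with p ≟ 0ℚ
  ... | yes p≡0 = ⊥-elim (<-irrefl (sym p≡0) p>0)
  ... | no p≢0  = *-inverseʳ p {{≢-nonZero p≢0}}

  inv-pos : ∀ {p} → 0ℚ < p → 0ℚ < inv p
  inv-pos {p} p>0 with p ≟ 0ℚ
  ... | yes p≡0 = ⊥-elim (<-irrefl (sym p≡0) p>0)
  ... | no p≢0  = positive⁻¹ _ {{1/pos⇒pos p {{positive p>0}}}}

  *-close : ∀ {p q K ε} → 0ℚ < K → ∣ p ∣ ≤ K → ∣ q ∣ < inv K * ε → ∣ p * q ∣ < ε
  *-close {p} {q} {K} {ε} K>0 h k = begin-strict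
    ∣ p * q ∣         ≡⟨ ∣p*q∣≡∣p∣*∣q∣ p q ⟩
    ∣ p ∣ * ∣ q ∣     ≤⟨ *-monoʳ-≤-nonNeg ∣ q ∣ {{∣-∣-nonNeg q}} h ⟩
    K * ∣ q ∣         <⟨ *-monoʳ-<-pos K {{positive K>0}} k ⟩
    K * (inv K * ε)   ≡⟨ *-assoc K (inv K) ε ⟨
    K * inv K * ε     ≡⟨ cong (_* ε) (*-inv K>0) ⟩
    1ℚ * ε            ≡⟨ *-identityˡ ε ⟩
    ε                 ∎
    where open ≤-Reasoning

  inv-anti : ∀ {p q} → 0ℚ < p → p ≤ q → inv q ≤ inv p
  inv-anti {p} {q} p>0 p≤q = begin
    inv q                ≡⟨ *-identityʳ (inv q) ⟨
    inv q * 1ℚ           ≡⟨ cong (inv q *_) (*-inv p>0) ⟨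
    inv q * (p * inv p)  ≤⟨ *-monoˡ-≤-nonNeg (inv q) {{nonNegative (<⇒≤ (inv-pos q>0))}}
                            (*-monoʳ-≤-nonNeg (inv p) {{nonNegative (<⇒≤ (inv-pos p>0))}} p≤q) ⟩
    inv q * (q * inv p)  ≡⟨ solve 3 (λ x y z → x :* (y :* z) := y :* x :* z) refl (inv q) q (inv p) ⟩
    q * inv q * inv p    ≡⟨ cong (_* inv p) (*-inv q>0) ⟩
    1ℚ * inv p           ≡⟨ *-identityˡ (inv p) ⟩
    inv p                ∎
    where
    open ≤-Reasoning
    q>0 : 0ℚ < q
    q>0 = <-≤-trans p>0 p≤q

  inv-diff : ∀ {p q} → 0ℚ < p → 0ℚ < q → (inv p * inv q) * (q - p) ≡ inv p - inv q
  inv-diff {p} {q} p>0 q>0 = begin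
    (inv p * inv q) * (q - p)                  ≡⟨ solve 4 (λ p q x y → (x :* y) :* (q :- p) := q :* y :* x :- p :* x :* y) refl p q (inv p) (inv q) ⟩
    q * inv q * inv p - p * inv p * inv q      ≡⟨ cong₂ (λ s t → s * inv p - t * inv q) (*-inv q>0) (*-inv p>0) ⟩
    1ℚ * inv p - 1ℚ * inv q                    ≡⟨ cong₂ _-_ (*-identityˡ (inv p)) (*-identityˡ (inv q)) ⟩
    inv p - inv q                              ∎
    where open ≡-Reasoning

IsCauchy : (ℕ → ℚ) → Set
IsCauchy x = ∀ ε → 0ℚ < ε →
  ∃ λ N → ∀ m n → N ℕ.≤ m → N ℕ.≤ n → ∣ x m - x n ∣ < ε

-- Real numbers as Cauchy sequences of rationals; two sequences denote the same
-- number when each is ≤ℝ the other.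
record ℝ : Set where
  constructor mkℝ
  field
    seq    : ℕ → ℚ
    cauchy : IsCauchy seq

open ℝ public

infix  4 _≤ℝ_ _<ℝ_
infixl 6 _+ℝ_ _⊔ℝ_
infixl 7 _*ℝ_

_≤ℝ_ : ℝ → ℝ → Set
x ≤ℝ y = ∀ ε → 0ℚ < ε → ∃ λ N → ∀ n → N ℕ.≤ n → seq x n ≤ seq y n + ε

_<ℝ_ : ℝ → ℝ → Set
x <ℝ y = ∃ λ ε → 0ℚ < ε × ∃ λ N → ∀ n → N ℕ.≤ n → seq x n + ε ≤ seq y n

fromℚ : ℚ → ℝ
fromℚ p = mkℝ (λ _ → p) const-cauchy
  where
  abstract
    const-cauchy : IsCauchy (λ _ → p)
    const-cauchy ε ε>0 = 0 , λ _ _ _ _ → subst (λ d → ∣ d ∣ < ε) (sym (+-inverseʳ p)) ε>0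

0ℝ 2ℝ : ℝ
0ℝ = fromℚ 0ℚ
2ℝ = fromℚ (1ℚ + 1ℚ)

private
  ≤ˡ : ∀ {M N n} → M ℕ.⊔ N ℕ.≤ n → M ℕ.≤ n
  ≤ˡ {M} {N} = ℕ.m⊔n≤o⇒m≤o M N

  ≤ʳ : ∀ {M N n} → M ℕ.⊔ N ℕ.≤ n → N ℕ.≤ n
  ≤ʳ {M} {N} = ℕ.m⊔n≤o⇒n≤o M N

  bounded : ∀ x → ∃ λ K → 0ℚ < K × ∃ λ N → ∀ n → N ℕ.≤ n → ∣ seq x n ∣ ≤ K
  bounded x with cauchy x 1ℚ (positive⁻¹ 1ℚ)
  ... | N , h = ∣ seq x N ∣ + 1ℚ
              , +-mono-≤-< (0≤∣p∣ (seq x N)) (positive⁻¹ 1ℚ)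
              , N , λ n N≤n → begin
    ∣ seq x n ∣                            ≡⟨ cong ∣_∣ (solve 2 (λ a b → b := a :+ (b :- a)) refl (seq x N) (seq x n)) ⟩
    ∣ seq x N + (seq x n - seq x N) ∣      ≤⟨ ∣p+q∣≤∣p∣+∣q∣ (seq x N) (seq x n - seq x N) ⟩
    ∣ seq x N ∣ + ∣ seq x n - seq x N ∣    ≤⟨ +-monoʳ-≤ ∣ seq x N ∣ (<⇒≤ (h n N N≤n ℕ.≤-refl)) ⟩
    ∣ seq x N ∣ + 1ℚ                       ∎
    where open ≤-Reasoning

_+ℝ_ : ℝ → ℝ → ℝ
x +ℝ y = mkℝ (λ n → seq x n + seq y n) +-cauchy
  where
  abstract
    +-cauchy : IsCauchy (λ n → seq x n + seq y n)
    +-cauchy ε ε>0 =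
      let M , h = cauchy x (ε * ½) (½-pos ε>0)
          N , k = cauchy y (ε * ½) (½-pos ε>0)
      in M ℕ.⊔ N , λ m n m≥ n≥ → subst (λ d → ∣ d ∣ < ε)
           (solve 4 (λ a b c d → (a :- b) :+ (c :- d) := a :+ c :- (b :+ d)) refl (seq x m) (seq x n) (seq y m) (seq y n))
           (+-close {seq x m - seq x n} {seq y m - seq y n} (h m n (≤ˡ m≥) (≤ˡ n≥)) (k m n (≤ʳ {M} m≥) (≤ʳ {M} n≥)))

_⊔ℝ_ : ℝ → ℝ → ℝ
x ⊔ℝ y = mkℝ (λ n → seq x n ⊔ seq y n) ⊔-cauchy
  where
  abstract
    ⊔-cauchy : IsCauchy (λ n → seq x n ⊔ seq y n)
    ⊔-cauchy ε ε>0 =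
      let M , h = cauchy x ε ε>0
          N , k = cauchy y ε ε>0
      in M ℕ.⊔ N , λ m n m≥ n≥ →
           ⊔-close {seq x m} {seq x n} {seq y m} {seq y n}
             (h m n (≤ˡ m≥) (≤ˡ n≥)) (k m n (≤ʳ {M} m≥) (≤ʳ {M} n≥))

_*ℝ_ : ℝ → ℝ → ℝ
x *ℝ y = mkℝ (λ n → seq x n * seq y n) *-cauchy
  where
  abstract
    *-cauchy : IsCauchy (λ n → seq x n * seq y n)
    *-cauchy ε ε>0 =
      let K , K>0 , A , x≤K = bounded x
          L , L>0 , B , y≤L = bounded y
          M , h = cauchy x (inv L * (ε * ½)) (*-pos (inv-pos L>0) (½-pos ε>0))
          N , k = cauchy y (inv K * (ε * ½)) (*-pos (inv-pos K>0) (½-pos ε>0))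
      in (A ℕ.⊔ B) ℕ.⊔ (M ℕ.⊔ N) , λ m n m≥ n≥ → subst (λ d → ∣ d ∣ < ε)
           (solve 4 (λ a b c d → a :* (c :- d) :+ d :* (a :- b) := a :* c :- b :* d) refl (seq x m) (seq x n) (seq y m) (seq y n))
           (+-close {seq x m * (seq y m - seq y n)} {seq y n * (seq x m - seq x n)}
             (*-close {seq x m} K>0 (x≤K m (≤ˡ (≤ˡ {A ℕ.⊔ B} m≥)))
               (k m n (≤ʳ {M} (≤ʳ {A ℕ.⊔ B} m≥)) (≤ʳ {M} (≤ʳ {A ℕ.⊔ B} n≥))))
             (*-close {seq y n} L>0 (y≤L n (≤ʳ {A} (≤ˡ {A ℕ.⊔ B} n≥)))
               (h m n (≤ˡ {M} (≤ʳ {A ℕ.⊔ B} m≥)) (≤ˡ {M} (≤ʳ {A ℕ.⊔ B} n≥)))))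

recip : (x : ℝ) → 0ℝ <ℝ x → ℝ
recip x (η , η>0 , A , x≥) = mkℝ (λ n → inv (seq x n)) inv-cauchy
  where
  abstract
    η≤ : ∀ n → A ℕ.≤ n → η ≤ seq x n
    η≤ n A≤n = subst (_≤ seq x n) (+-identityˡ η) (x≥ n A≤n)

    bound : ∀ {p q} → η ≤ p → η ≤ q → ∣ inv p * inv q ∣ ≤ inv η * inv η
    bound {p} {q} η≤p η≤q = begin
      ∣ inv p * inv q ∣  ≡⟨ 0≤p⇒∣p∣≡p (<⇒≤ (*-pos p⁻¹>0 q⁻¹>0)) ⟩
      inv p * inv q      ≤⟨ *-monoʳ-≤-nonNeg (inv q) {{nonNegative (<⇒≤ q⁻¹>0)}} (inv-anti η>0 η≤p) ⟩
      inv η * inv q      ≤⟨ *-monoˡ-≤-nonNeg (inv η) {{nonNegative (<⇒≤ (inv-pos η>0))}} (inv-anti η>0 η≤q) ⟩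
      inv η * inv η      ∎
      where
      open ≤-Reasoning
      p⁻¹>0 : 0ℚ < inv p
      p⁻¹>0 = inv-pos (<-≤-trans η>0 η≤p)
      q⁻¹>0 : 0ℚ < inv q
      q⁻¹>0 = inv-pos (<-≤-trans η>0 η≤q)

    inv-cauchy : IsCauchy (λ n → inv (seq x n))
    inv-cauchy ε ε>0 =
      let K   = inv η * inv η
          K>0 = *-pos (inv-pos η>0) (inv-pos η>0)
          M , h = cauchy x (inv K * ε) (*-pos (inv-pos K>0) ε>0)
      in A ℕ.⊔ M , λ m n m≥ n≥ →
           let a≥η = η≤ m (≤ˡ m≥)
               b≥η = η≤ n (≤ˡ n≥)
               a>0 = <-≤-trans η>0 a≥η
               b>0 = <-≤-trans η>0 b≥η
           in subst (λ d → ∣ d ∣ < ε) (inv-diff a>0 b>0)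
                (*-close {inv (seq x m) * inv (seq x n)} K>0 (bound a≥η b≥η) (h n m (≤ʳ {A} n≥) (≤ʳ {A} m≥)))

divide : (x y : ℝ) → 0ℝ <ℝ y → ℝ
divide x y y>0 = x *ℝ recip y y>0

syntax divide x y y>0 = x /ℝ y [ y>0 ]

sumℝ : List ℝ → ℝ
sumℝ = foldr _+ℝ_ 0ℝ

abstract
  private
    +-nonneg : ∀ {p q} → 0ℚ ≤ p → 0ℚ ≤ q → 0ℚ ≤ p + q
    +-nonneg {p} {q} h k = +-mono-≤ {0ℚ} {p} {0ℚ} {q} h k

    +-pos-nonneg : ∀ {ε p q} → 0ℚ + ε ≤ p → 0ℚ ≤ q → 0ℚ + ε ≤ p + q
    +-pos-nonneg {ε} {p} {q} h k = subst (_≤ p + q) (+-identityʳ (0ℚ + ε)) (+-mono-≤ {0ℚ + ε} {p} {0ℚ} {q} h k)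

    0+ε≤p⇒0≤p : ∀ {p ε} → 0ℚ < ε → 0ℚ + ε ≤ p → 0ℚ ≤ p
    0+ε≤p⇒0≤p {p} {ε} ε>0 h = ≤-trans (<⇒≤ ε>0) (subst (_≤ p) (+-identityˡ ε) h)

    double-≤ : ∀ {p ε} → 0ℚ + ε ≤ p → 0ℚ + (1ℚ + 1ℚ) * ε ≤ (1ℚ + 1ℚ) * p
    double-≤ {p} {ε} h = subst (_≤ (1ℚ + 1ℚ) * p)
      (trans (cong ((1ℚ + 1ℚ) *_) (+-identityˡ ε)) (sym (+-identityˡ ((1ℚ + 1ℚ) * ε))))
      (*-monoˡ-≤-nonNeg (1ℚ + 1ℚ) h)

    sum-nonneg : ∀ xs → All (0ℝ <ℝ_) xs → ∃ λ N → ∀ n → N ℕ.≤ n → 0ℚ ≤ seq (sumℝ xs) n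
    sum-nonneg []       []                           = 0 , λ _ _ → ≤-refl
    sum-nonneg (x ∷ xs) ((ε , ε>0 , M , h) ∷ ps) =
      let N , k = sum-nonneg xs ps
      in M ℕ.⊔ N , λ n n≥ →
        +-nonneg {seq x n} {seq (sumℝ xs) n} (0+ε≤p⇒0≤p ε>0 (h n (≤ˡ {M} {N} n≥))) (k n (≤ʳ {M} {N} n≥))

  sum-pos : ∀ {x xs} → All (0ℝ <ℝ_) xs → x ∈ xs → 0ℝ <ℝ sumℝ xs
  sum-pos {xs = y ∷ xs} ((ε , ε>0 , M , h) ∷ ps) _ =
    let N , k = sum-nonneg xs ps
    in ε , ε>0 , M ℕ.⊔ N , λ n n≥ →
      +-pos-nonneg {ε} {seq y n} {seq (sumℝ xs) n} (h n (≤ˡ {M} {N} n≥)) (k n (≤ʳ {M} {N} n≥))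

  ⊔-pos : ∀ {x} xs → 0ℝ <ℝ x → 0ℝ <ℝ foldr _⊔ℝ_ x xs
  ⊔-pos     []       p = p
  ⊔-pos {x} (y ∷ xs) p =
    let ε , ε>0 , N , h = ⊔-pos xs p
    in ε , ε>0 , N , λ n n≥ → ≤-trans (h n n≥) (p≤q⊔p (seq y n) (seq (foldr _⊔ℝ_ x xs) n))

  double-pos : ∀ {x} → 0ℝ <ℝ x → 0ℝ <ℝ 2ℝ *ℝ x
  double-pos {x} (ε , ε>0 , N , h) =
    (1ℚ + 1ℚ) * ε , *-pos (positive⁻¹ (1ℚ + 1ℚ)) ε>0 , N , λ n n≥ → double-≤ {seq x n} {ε} (h n n≥)

record Graph (n : ℕ) : Set where
  field
    adj        : Fin n → Fin n → Bool
    adj-sym    : ∀ {u v} → T (adj u v) → T (adj v u)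
    adj-irrefl : ∀ {v} → ¬ T (adj v v)

  Adj : Fin n → Fin n → Set
  Adj u v = T (adj u v)

-- The empty graph is not connected.
record Connected {n} (G : Graph n) : Set where
  field
    nonEmpty : Fin n
    path     : ∀ u v → Star (Graph.Adj G) u v

-- Each undirected edge is listed once, with its endpoints in increasing order.
record Edge {n} (G : Graph n) : Set where
  constructor edge
  field
    src tgt  : Fin n
    src<tgt  : src Fin.< tgt
    adjacent : Graph.Adj G src tgt

open Edge public

-- The pairs (v₁,v₂), …, (vₖ₋₁,vₖ), (vₖ,v₁) of a list v₁, …, vₖ.
cyclicPairs : ∀ {A : Set} → List A → List (A × A)
cyclicPairs []       = []
cyclicPairs (x ∷ xs) = zip (x ∷ xs) (xs ∷ʳ x)

lists : ∀ n → ℕ → List (List (Fin n))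
lists n zero    = [] ∷ []
lists n (suc k) = cartesianProductWith _∷_ (allFin n) (lists n k)

module _ {n : ℕ} (G : Graph n) where
  open Graph G using (adj; Adj)

  edge? : Fin n × Fin n → Maybe (Edge G)
  edge? (u , v) with u Fin.<? v | T? (adj u v)
  ... | yes u<v | yes uv = just (edge u v u<v uv)
  ... | _       | _      = nothing

  edges : List (Edge G)
  edges = mapMaybe edge? (cartesianProduct (allFin n) (allFin n))

  -- A cycle is given by its vertices in cyclic order; different lists may
  -- describe the same subgraph.
  IsCycle : List (Fin n) → Set
  IsCycle vs = 3 ℕ.≤ length vs × Unique vs × All (λ (u , v) → Adj u v) (cyclicPairs vs)

  Joins : Edge G → Fin n × Fin n → Set
  Joins e (u , v) = (src e ≡ u × tgt e ≡ v) ⊎ (src e ≡ v × tgt e ≡ u)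

  _∈E_ : Edge G → List (Fin n) → Set
  e ∈E vs = Any (Joins e) (cyclicPairs vs)

  _∈E?_ : ∀ e vs → Dec (e ∈E vs)
  e ∈E? vs = any? (λ (u , v) → (src e Fin.≟ u ×-dec tgt e Fin.≟ v) ⊎-dec (src e Fin.≟ v ×-dec tgt e Fin.≟ u)) (cyclicPairs vs)

  CycleThrough : Edge G → List (Fin n) → Set
  CycleThrough e vs = IsCycle vs × e ∈E vs

  cycleThrough? : ∀ e vs → Dec (CycleThrough e vs)
  cycleThrough? e vs = (3 ℕ.≤? length vs ×-dec unique? vs ×-dec all? (λ (u , v) → T? (adj u v)) (cyclicPairs vs)) ×-dec (e ∈E? vs)
    where open import Data.List.Relation.Unary.Unique.DecPropositional Fin._≟_ using (unique?)

  OnCycle : Edge G → Set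
  OnCycle e = ∃ (CycleThrough e)

  IsBridge : Edge G → Set
  IsBridge e = ¬ OnCycle e

  candidates : List (List (Fin n))
  candidates = concatMap (lists n) (upTo (suc n))

  -- A list without repetitions has at most n entries, so this finds every
  -- cycle through e (∈-cyclesThrough).
  cyclesThrough : Edge G → List (List (Fin n))
  cyclesThrough e = filter (cycleThrough? e) candidates

  edges-complete : ∀ e → e ∈ edges
  edges-complete e@(edge u v u<v uv) = Any.mapMaybe⁺ edge? (cartesianProduct (allFin n) (allFin n))
    (Any.map⁺ (Any.map (λ { refl → found }) (∈-cartesianProduct⁺ (∈-allFin u) (∈-allFin v))))
    where
    found : Maybe.Any (e ≡_) (edge? (u , v))
    found with u Fin.<? v | T? (adj u v)
    ... | yes p | yes q  = Maybe.just (cong₂ (edge u v) (ℕ.<-irrelevant u<v p) (T-irrelevant uv q))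
    ... | no ¬p | _      = ⊥-elim (¬p u<v)
    ... | yes _ | no ¬q  = ⊥-elim (¬q uv)

  edges-unique : Unique edges
  edges-unique = go (Unique.cartesianProduct⁺ (Unique.allFin⁺ n) (Unique.allFin⁺ n))
    where
    ends : ∀ p {e} → edge? p ≡ just e → (src e , tgt e) ≡ p
    ends (u , v) eq with u Fin.<? v | T? (adj u v)
    ends (u , v) refl | yes _ | yes _ = refl
    ends (u , v) ()   | yes _ | no _
    ends (u , v) ()   | no _  | _

    fresh : ∀ {p e} → edge? p ≡ just e → ∀ {ps} → All (p ≢_) ps → All (e ≢_) (mapMaybe edge? ps)
    fresh eq [] = []
    fresh {p} {e} eq {q ∷ _} (p≢q ∷ h) with edge? q in eq′
    ... | nothing = fresh eq h
    ... | just f  = (λ e≡f → p≢q (trans (sym (ends p eq)) (trans (cong (λ g → src g , tgt g) e≡f) (ends q eq′)))) ∷ fresh eq h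

    go : ∀ {ps} → Unique ps → Unique (mapMaybe edge? ps)
    go [] = []
    go {p ∷ _} (h ∷ u) with edge? p in eq
    ... | nothing = go u
    ... | just e  = fresh eq h ∷ go u

  ∈-candidates : ∀ {vs} → Unique vs → vs ∈ candidates
  ∈-candidates {vs} u = ∈-concatMap⁺ (lists n) (lose (∈-upTo⁺ (ℕ.s≤s (length≤n vs u))) (∈-lists vs))
    where
    ∈-lists : ∀ us → us ∈ lists n (length us)
    ∈-lists []       = here refl
    ∈-lists (v ∷ us) = ∈-cartesianProductWith⁺ _∷_ (∈-allFin v) (∈-lists us)

    lookup-injective : ∀ {us : List (Fin n)} → Unique us → ∀ {i j} → lookup us i ≡ lookup us j → i ≡ j
    lookup-injective (_ ∷ _) {Fin.zero}  {Fin.zero}  _  = refl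
    lookup-injective (h ∷ _) {Fin.zero}  {Fin.suc j} eq = ⊥-elim (All.lookup h (∈-lookup j) eq)
    lookup-injective (h ∷ _) {Fin.suc i} {Fin.zero}  eq = ⊥-elim (All.lookup h (∈-lookup i) (sym eq))
    lookup-injective (_ ∷ u) {Fin.suc i} {Fin.suc j} eq = cong Fin.suc (lookup-injective u eq)

    length≤n : ∀ us → Unique us → length us ℕ.≤ n
    length≤n us u = Fin.injective⇒≤ {f = lookup us} (lookup-injective u)

  ∈-cyclesThrough : ∀ {e vs} → CycleThrough e vs → vs ∈ cyclesThrough e
  ∈-cyclesThrough {e} c = ∈-filter⁺ (cycleThrough? e) (∈-candidates (proj₁ (proj₂ (proj₁ c)))) c

  onCycle? : ∀ e → Dec (OnCycle e)
  onCycle? e = map′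
    (λ a → let vs , _ , c = find a in vs , c)
    (λ (vs , c) → lose (∈-candidates (proj₁ (proj₂ (proj₁ c)))) c)
    (any? (cycleThrough? e) candidates)

  module _ (w : Edge G → ℝ) where

    weight : List (Fin n) → ℝ
    weight vs = sumℝ (map w (filter (_∈E? vs) edges))

    -- The fold starts from the weight of one of the listed cycles, so it is the
    -- maximum of the weights of cyclesThrough e.  The no case is IsBridge e.
    maxCycle : (e : Edge G) → Dec (OnCycle e) → ℝ
    maxCycle e (yes (vs , _)) = foldr _⊔ℝ_ (weight vs) (map weight (cyclesThrough e))
    maxCycle e (no _)         = 2ℝ *ℝ w e

    C : Edge G → ℝ
    C e = maxCycle e (onCycle? e)

    maxCycle-pos : (∀ e → 0ℝ <ℝ w e) → ∀ e d → 0ℝ <ℝ maxCycle e d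
    maxCycle-pos w>0 e (no _)                = double-pos {w e} (w>0 e)
    maxCycle-pos w>0 e (yes (vs , _ , e∈vs)) = ⊔-pos {weight vs} (map weight (cyclesThrough e))
      (sum-pos {w e} (All.map⁺ (All.universal w>0 _)) (∈-map⁺ w (∈-filter⁺ (_∈E? vs) (edges-complete e) e∈vs)))

    C-pos : (∀ e → 0ℝ <ℝ w e) → ∀ e → 0ℝ <ℝ C e
    C-pos w>0 e = maxCycle-pos w>0 e (onCycle? e)

{-# OPTIONS --safe #-}
-- Replace w by w(e) / C(e).  Then every cycle weighs at most 1 and a bridge weighs 1/2, so it suffices to
-- bound the total weight of such a graph by (n - 1) / 2 (the Bondy–Fan theorem on heavy cycles), and after
-- clearing denominators the weights are natural numbers: cycles weigh at most 2h and an edge heavier than h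
-- lies on a cycle.
--
-- Induct on the number of vertices.  Adding weightless edges, we may assume that the graph is complete or has a
-- path heavier than 2h.  In a complete graph, exchanging two edges of a heaviest Hamiltonian cycle
-- u₁ … uₙ gives w(uᵢ,uⱼ) + w(uᵢ₊₁,uⱼ₊₁) ≤ w(uᵢ,uᵢ₊₁) + w(uⱼ,uⱼ₊₁), and summing over all i, j finishes.
-- Otherwise the ends of a heaviest path are not adjacent, and either there is a cut vertex, where the graph splits,
-- or the degrees of the two ends sum to at most 2h, as they are dominated by a cycle.  Then one end v has degree at most h
-- and can be deleted, unless this leaves a heavy bridge xy; in that case the graph is split along v and xy, each side
-- receiving an edge of weight h from v to its end of the bridge.
module Submission where

open import Defs
open import Data.Empty using (⊥; ⊥-elim)
open import Data.List using (List; []; _∷_; _++_; cartesianProduct; [_]; reverse; length; filter)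
open import Data.List.Properties using (++-assoc; reverse-++; unfold-reverse; length-++; filter-accept; filter-reject)
open import Data.List.Membership.Propositional using (_∈_; _∉_; find; lose)
open import Data.List.Membership.Propositional.Properties using (∈-++⁺ˡ; ∈-++⁺ʳ; ∈-++⁻; ∈-∃++; ∈-filter⁺; ∈-filter⁻; ∈-cartesianProduct⁺)
open import Data.List.Relation.Binary.Permutation.Propositional using (_↭_; ↭-sym; ↭-trans; ↭-refl; prep)
import Data.List.Relation.Binary.Permutation.Propositional as Perm
import Data.List.Relation.Binary.Permutation.Propositional.Properties as Perm
open import Data.List.Relation.Binary.Subset.Propositional using (_⊆_)
open import Data.List.Relation.Unary.All as All using (All; []; _∷_)
open import Data.List.Relation.Unary.Any as Any using (Any; here; there)
open import Data.List.Relation.Unary.AllPairs using ([]; _∷_)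
open import Data.List.Relation.Unary.Linked using (Linked; []; [-]; _∷_)
open import Data.List.Relation.Unary.Unique.Propositional using (Unique)
import Data.List.Relation.Unary.Unique.Propositional.Properties as UniqueP
open import Data.Nat using (ℕ; zero; suc; _+_; _*_; _≤_; _<_; z≤n; s≤s; s≤s⁻¹)
open import Data.Nat.Properties
open import Data.Nat.Tactic.RingSolver using (solve-∀)
import Data.Product as Prod
import Data.Sum as Sum
open import Data.Product using (∃; ∃₂; _×_; _,_; proj₁; proj₂)
open import Data.Unit using (⊤; tt)
open import Data.Sum using (_⊎_; inj₁; inj₂)
open import Function using (_∘_; id; _⟨_⟩_)
open import Relation.Binary.PropositionalEquality using (_≡_; _≢_; refl; sym; trans; cong; cong₂; subst; subst₂; module ≡-Reasoning)
open import Relation.Nullary using (¬_; Dec; yes; no)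
open import Relation.Nullary.Decidable using (_×-dec_; _⊎-dec_; ¬?; decidable-stable)
open import Relation.Unary using (Decidable)
open import Data.Bool.Properties using (T?)
open import Data.Fin as Fin using (Fin)
import Data.Fin.Properties as Fin
open import Data.List using (map; mapMaybe; zip; drop; _∷ʳ_; allFin)
open import Data.List.Properties using (length-tabulate)
open import Data.List.Membership.Propositional.Properties using (∈-allFin)
open import Data.Maybe using (Maybe; just; nothing; maybe)
open import Relation.Binary.Definitions using (tri<; tri≈; tri>)

-- The value 1/2 at a bridge turns into the demand that an edge heavier than h lie on a cycle; cycle
-- bounds alone would say nothing about bridges. This demand is what obstructs the induction:
-- deleting v may destroy every cycle through a heavy edge xy. The weight h of the new edges is the
-- largest that is not heavy, so they need no cycles of their own. It is also large enough: a cycle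
-- through xy must return through v, which gives w(vx) + w(vy) + w(xy) ≤ 2h, so the two new edges
-- pay for the three that they replace. Deletion itself needs degree at most h because the bound
-- falls by h with each vertex.
--
-- Weightless edges leave the total unchanged, but an added edge ab turns each path from a to b into
-- a cycle of the same weight. They are harmless exactly while no such path exceeds 2h, which is the
-- source of the alternative between a complete graph and a path heavier than 2h.
--
-- No limit argument occurs: the inequality is proved separately at each index of the Cauchy
-- sequences at which all weights are positive.

private variable
  A B : Set

-- Finite sums of natural numbers

∑ : (A → ℕ) → List A → ℕ
∑ f []       = 0
∑ f (x ∷ xs) = f x + ∑ f xs

∑-++ : ∀ (f : A → ℕ) xs {ys} → ∑ f (xs ++ ys) ≡ ∑ f xs + ∑ f ys
∑-++ f []            = refl
∑-++ f (x ∷ xs) {ys} = trans (cong (f x +_) (∑-++ f xs)) (sym (+-assoc (f x) (∑ f xs) (∑ f ys)))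

∑-↭ : ∀ {xs ys} (f : A → ℕ) → xs ↭ ys → ∑ f xs ≡ ∑ f ys
∑-↭ f Perm.refl        = refl
∑-↭ f (Perm.prep x p)  = cong (f x +_) (∑-↭ f p)
∑-↭ f (Perm.swap {xs} {ys} x y p) = trans (cong (λ s → f x + (f y + s)) (∑-↭ f p)) (lemma (f x) (f y) (∑ f ys))
  where
  lemma : ∀ p q r → p + (q + r) ≡ q + (p + r)
  lemma = solve-∀
∑-↭ f (Perm.trans p q) = trans (∑-↭ f p) (∑-↭ f q)

∑-cong : ∀ {f g : A → ℕ} xs → (∀ {x} → x ∈ xs → f x ≡ g x) → ∑ f xs ≡ ∑ g xs
∑-cong []       h = refl
∑-cong (x ∷ xs) h = cong₂ _+_ (h (here refl)) (∑-cong xs (h ∘ there))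

∑-zero : ∀ {f : A → ℕ} xs → (∀ {x} → x ∈ xs → f x ≡ 0) → ∑ f xs ≡ 0
∑-zero []       h = refl
∑-zero (x ∷ xs) h = cong₂ _+_ (h (here refl)) (∑-zero xs (h ∘ there))

∑-+ : ∀ (f g : A → ℕ) xs → ∑ (λ x → f x + g x) xs ≡ ∑ f xs + ∑ g xs
∑-+ f g []       = refl
∑-+ f g (x ∷ xs) = trans (cong (f x + g x +_) (∑-+ f g xs)) (lemma (f x) (g x) (∑ f xs) (∑ g xs))
  where
  lemma : ∀ p q r s → p + q + (r + s) ≡ p + r + (q + s)
  lemma = solve-∀

∑-comm : ∀ (f : A → B → ℕ) xs ys → ∑ (λ x → ∑ (f x) ys) xs ≡ ∑ (λ y → ∑ (λ x → f x y) xs) ys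
∑-comm f []       ys = sym (∑-zero ys (λ _ → refl))
∑-comm f (x ∷ xs) ys = trans (cong (∑ (f x) ys +_) (∑-comm f xs ys)) (sym (∑-+ (f x) (λ y → ∑ (λ x → f x y) xs) ys))

-- Duplicate-free lists and weighted walks

module _ {A : Set} where

  private variable
    a b c d x y z : A
    xs ys zs : List A

  Unique-↭ : xs ↭ ys → Unique xs → Unique ys
  Unique-↭ Perm.refl         u       = u
  Unique-↭ (Perm.prep x p)   (h ∷ u) = Perm.All-resp-↭ p h ∷ Unique-↭ p u
  Unique-↭ (Perm.swap x y p) ((h ∷ k) ∷ l ∷ u) =
    (h ∘ sym ∷ Perm.All-resp-↭ p l) ∷ Perm.All-resp-↭ p k ∷ Unique-↭ p u
  Unique-↭ (Perm.trans p q)  u       = Unique-↭ q (Unique-↭ p u)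

  Unique-++ : ∀ xs → Unique xs → Unique ys → (∀ {x} → x ∈ xs → x ∉ ys) → Unique (xs ++ ys)
  Unique-++ []       u       v h = v
  Unique-++ {ys = ys} (x ∷ xs) (k ∷ u) v h =
    All.tabulate (λ {z} z∈ → case z z∈) ∷ Unique-++ xs u v (h ∘ there)
    where
    case : ∀ z → z ∈ xs ++ ys → x ≢ z
    case z z∈ with ∈-++⁻ xs z∈
    ... | inj₁ z∈xs = All.lookup k z∈xs
    ... | inj₂ z∈ys = λ { refl → h (here refl) z∈ys }

  Unique-++⁻ : ∀ xs → Unique (xs ++ ys) → Unique xs × Unique ys × (∀ {x} → x ∈ xs → x ∉ ys)
  Unique-++⁻ []       u       = [] , u , λ ()
  Unique-++⁻ (x ∷ xs) (h ∷ u) with Unique-++⁻ xs u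
  ... | v , v′ , k = All.tabulate (λ z∈ → All.lookup h (∈-++⁺ˡ z∈)) ∷ v , v′ , λ
    { (here refl) z∈ → All.lookup h (∈-++⁺ʳ xs z∈) refl
    ; (there p)   z∈ → k p z∈ }

  Unique-tail : Unique (x ∷ xs) → Unique xs
  Unique-tail (_ ∷ u) = u

  Unique-∉ : Unique (x ∷ xs) → x ∉ xs
  Unique-∉ (h ∷ _) x∈xs = All.lookup h x∈xs refl

  -- Since `xs` has no repetitions, each entry of `ys` has to pay for at most one nonzero term: it
  -- is moved to the front of `ys` and removed.
  ∑-⊆ : ∀ (f : A → ℕ) xs ys → Unique xs → (∀ {x} → x ∈ xs → f x ≡ 0 ⊎ x ∈ ys) → ∑ f xs ≤ ∑ f ys
  ∑-⊆ f []       ys u       h = z≤n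
  ∑-⊆ f (x ∷ xs) ys (k ∷ u) h with h (here refl)
  ... | inj₁ fx≡0 = subst (λ s → s + ∑ f xs ≤ ∑ f ys) (sym fx≡0) (∑-⊆ f xs ys u (h ∘ there))
  ... | inj₂ x∈ys with ∈-∃++ x∈ys
  ... | ys₁ , ys₂ , refl = begin
    f x + ∑ f xs           ≤⟨ +-monoʳ-≤ (f x) (∑-⊆ f xs (ys₁ ++ ys₂) u rest) ⟩
    f x + ∑ f (ys₁ ++ ys₂) ≡⟨ ∑-↭ f (Perm.shift x ys₁ ys₂) ⟨
    ∑ f (ys₁ ++ x ∷ ys₂)   ∎
    where
    open ≤-Reasoning
    rest : ∀ {z} → z ∈ xs → f z ≡ 0 ⊎ z ∈ ys₁ ++ ys₂
    rest z∈ with h (there z∈)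
    ... | inj₁ p = inj₁ p
    ... | inj₂ q with Perm.∈-resp-↭ (Perm.shift x ys₁ ys₂) q
    ... | here refl = ⊥-elim (All.lookup k z∈ refl)
    ... | there r   = inj₂ r

  Linked-++⁻ : ∀ {R : A → A → Set} xs → Linked R (xs ++ ys) → Linked R xs × Linked R ys
  Linked-++⁻ {ys = ys} []       l = [] , l
  Linked-++⁻ {ys = []} (x ∷ []) l = [-] , []
  Linked-++⁻ {ys = _ ∷ _} (x ∷ []) (_ ∷ l) = [-] , l
  Linked-++⁻ (x ∷ y ∷ xs) (r ∷ l) with Linked-++⁻ (y ∷ xs) l
  ... | l₁ , l₂ = r ∷ l₁ , l₂

  Linked-tabulate : ∀ {R : A → A → Set} xs → (∀ ys {a b zs} → xs ≡ ys ++ a ∷ b ∷ zs → R a b) → Linked R xs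
  Linked-tabulate []           h = []
  Linked-tabulate (x ∷ [])     h = [-]
  Linked-tabulate (x ∷ y ∷ xs) h = h [] refl ∷ Linked-tabulate (y ∷ xs) (λ ys eq → h (x ∷ ys) (cong (x ∷_) eq))

  -- Pth R a b xs: xs lists the vertices of an R-walk from a to b.
  data Pth (R : A → A → Set) : A → A → List A → Set where
    one : ∀ {a} → Pth R a a (a ∷ [])
    _∷_ : ∀ {a b c xs} → R a b → Pth R b c xs → Pth R a c (a ∷ xs)

  private variable
    R Q : A → A → Set

  Pth-map : (∀ {x y} → x ∈ xs → y ∈ xs → R x y → Q x y) → Pth R a b xs → Pth Q a b xs
  first∈ : Pth R a b xs → a ∈ xs
  first∈ one     = here refl
  first∈ (_ ∷ _) = here refl

  last∈ : Pth R a b xs → b ∈ xs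
  last∈ one     = here refl
  last∈ (_ ∷ p) = there (last∈ p)

  Pth-map f one     = one
  Pth-map f (r ∷ p) = f (here refl) (there (first∈ p)) r ∷ Pth-map (λ x∈ y∈ → f (there x∈) (there y∈)) p

  head≡ : Pth R a b (x ∷ xs) → a ≡ x
  head≡ one     = refl
  head≡ (_ ∷ _) = refl

  Pth-∷ : Pth R a b xs → ∃ λ ys → xs ≡ a ∷ ys
  Pth-∷ one     = _ , refl
  Pth-∷ (_ ∷ _) = _ , refl

  joinE : Pth R a b xs → R b c → Pth R c d ys → Pth R a d (xs ++ ys)
  joinE one     r q = r ∷ q
  joinE (s ∷ p) r q = s ∷ joinE p r q

  joinV : Pth R a b xs → Pth R b c (b ∷ ys) → Pth R a c (xs ++ ys)
  joinV one     q = q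
  joinV (s ∷ p) q = s ∷ joinV p q

  Pth-reverse : (∀ {x y} → R x y → R y x) → Pth R a b xs → Pth R b a (reverse xs)
  Pth-reverse s one = one
  Pth-reverse {xs = x ∷ xs} s (r ∷ p) = subst (Pth _ _ _) (sym (unfold-reverse x xs)) (joinE (Pth-reverse s p) (s r) one)

  splitV : ∀ ys → Pth R a b (ys ++ c ∷ zs) → Pth R a c (ys ++ [ c ]) × Pth R c b (c ∷ zs)
  splitV []           p with refl ← head≡ p = one , p
  splitV (y ∷ [])     (r ∷ p) with splitV [] p
  ... | q , q′ = r ∷ q , q′
  splitV (y ∷ z ∷ ys) (r ∷ p) with splitV (z ∷ ys) p
  ... | q , q′ = r ∷ q , q′

  splitE : ∀ ys → Pth R a b (ys ++ c ∷ d ∷ zs) → Pth R a c (ys ++ [ c ]) × R c d × Pth R d b (d ∷ zs)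
  splitE ys p with splitV ys p
  ... | q , r ∷ q′ with refl ← head≡ q′ = q , r , q′

  Pth-loop : Unique xs → Pth R a a xs → xs ≡ [ a ]
  Pth-loop u one = refl
  Pth-loop u (r ∷ p) = ⊥-elim (Unique-∉ u (last∈ p))

  3≤length : Pth R a b xs → a ≢ b → ¬ R a b → 3 ≤ length xs
  3≤length one               a≢b _ = ⊥-elim (a≢b refl)
  3≤length (r ∷ one)         _ ¬r  = ⊥-elim (¬r r)
  3≤length (r ∷ s ∷ one)     _ _   = s≤s (s≤s (s≤s z≤n))
  3≤length (r ∷ s ∷ t ∷ p)   _ _   = s≤s (s≤s (s≤s z≤n))

  2≤length : Pth R a b xs → a ≢ b → 2 ≤ length xs
  2≤length one           a≢b = ⊥-elim (a≢b refl)
  2≤length (r ∷ one)     _   = s≤s (s≤s z≤n)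
  2≤length (r ∷ s ∷ p)   _   = s≤s (s≤s z≤n)

  pth? : (∀ (x y : A) → Dec (x ≡ y)) → (∀ x y → Dec (R x y)) → ∀ a b xs → Dec (Pth R a b xs)
  pth? _≟_ r? a b [] = no λ ()
  pth? _≟_ r? a b (x ∷ []) with a ≟ x | b ≟ x
  ... | yes refl | yes refl = yes one
  ... | no a≢x   | _        = no λ p → a≢x (head≡ p)
  ... | yes refl | no b≢x   = no λ { one → b≢x refl ; (r ∷ ()) }
  pth? _≟_ r? a b (x ∷ y ∷ xs) with a ≟ x | r? x y | pth? _≟_ r? y b (y ∷ xs)
  ... | yes refl | yes r | yes p = yes (r ∷ p)
  ... | no a≢x   | _     | _     = no λ p → a≢x (head≡ p)
  ... | yes refl | no ¬r | _     = no λ { (r ∷ p) → ¬r (subst (_ ) (head≡ p) r) }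
  ... | yes refl | yes _ | no ¬p = no λ { (r ∷ p) → ¬p (subst (λ z → Pth _ z _ _) (head≡ p) p) }

  pw : (A → A → ℕ) → List A → ℕ
  pw w []           = 0
  pw w (x ∷ [])     = 0
  pw w (x ∷ y ∷ xs) = w x y + pw w (y ∷ xs)

  pw-∷ : ∀ (w : A → A → ℕ) → Pth R a b xs → pw w (x ∷ xs) ≡ w x a + pw w xs
  pw-∷ w one     = refl
  pw-∷ w (_ ∷ _) = refl

  pw-split : ∀ (w : A → A → ℕ) ys → pw w (ys ++ c ∷ zs) ≡ pw w (ys ++ [ c ]) + pw w (c ∷ zs)
  pw-split w []           = refl
  pw-split {c} {zs} w (y ∷ []) = cong (_+ pw w (c ∷ zs)) (sym (+-identityʳ (w y c)))
  pw-split w (y ∷ z ∷ ys) = trans (cong (w y z +_) (pw-split w (z ∷ ys))) (sym (+-assoc (w y z) _ _))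

  pw-joinE : ∀ (w : A → A → ℕ) → Pth R a b xs → Pth Q c d ys → pw w (xs ++ ys) ≡ pw w xs + (w b c + pw w ys)
  pw-joinE w one q = pw-∷ w q
  pw-joinE {c = c} {ys = ys} w (_∷_ {a} {b} r one) q = trans (cong (w a b +_) (pw-∷ w q)) (cong (_+ (w b c + pw w ys)) (sym (+-identityʳ (w a b))))
  pw-joinE w (_∷_ {a} {b} r (s ∷ p)) q = trans (cong (w a b +_) (pw-joinE w (s ∷ p) q)) (sym (+-assoc (w a b) _ _))

  pw-joinV : ∀ (w : A → A → ℕ) → Pth R a b xs → pw w (xs ++ ys) ≡ pw w xs + pw w (b ∷ ys)
  pw-joinV w one = refl
  pw-joinV {ys = ys} w (_∷_ {a} {b} r one) = cong (_+ pw w (b ∷ ys)) (sym (+-identityʳ (w a b)))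
  pw-joinV w (_∷_ {a} {b} r (s ∷ p)) = trans (cong (w a b +_) (pw-joinV w (s ∷ p))) (sym (+-assoc (w a b) _ _))

  pw-reverse : ∀ (w : A → A → ℕ) → (∀ x y → w x y ≡ w y x) → ∀ xs → pw w (reverse xs) ≡ pw w xs
  pw-reverse w w-sym []           = refl
  pw-reverse w w-sym (x ∷ [])     = refl
  pw-reverse w w-sym (x ∷ y ∷ xs) = begin
    pw w (reverse (x ∷ y ∷ xs))                         ≡⟨ cong (pw w) (trans (unfold-reverse x (y ∷ xs)) (cong (_++ [ x ]) (unfold-reverse y xs))) ⟩
    pw w ((reverse xs ++ [ y ]) ++ [ x ])               ≡⟨ cong (pw w) (++-assoc (reverse xs) [ y ] [ x ]) ⟩
    pw w (reverse xs ++ y ∷ x ∷ [])                     ≡⟨ pw-split w (reverse xs) ⟩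
    pw w (reverse xs ++ [ y ]) + (w y x + 0)            ≡⟨ cong₂ (λ s t → pw w s + t) (sym (unfold-reverse y xs)) (trans (+-identityʳ (w y x)) (w-sym y x)) ⟩
    pw w (reverse (y ∷ xs)) + w x y                     ≡⟨ cong (_+ w x y) (pw-reverse w w-sym (y ∷ xs)) ⟩
    pw w (y ∷ xs) + w x y                               ≡⟨ +-comm (pw w (y ∷ xs)) (w x y) ⟩
    w x y + pw w (y ∷ xs)                               ∎
    where open ≡-Reasoning

  pw-cong : ∀ {w w′ : A → A → ℕ} → (∀ {x y} → R x y → w x y ≡ w′ x y) → Pth R a b xs → pw w xs ≡ pw w′ xs
  pw-cong h one           = refl
  pw-cong h (r ∷ one)     = cong (_+ 0) (h r)
  pw-cong h (r ∷ (s ∷ p)) = cong₂ _+_ (h r) (pw-cong h (s ∷ p))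

  pw-* : ∀ k (w : A → A → ℕ) xs → pw (λ x y → k * w x y) xs ≡ k * pw w xs
  pw-* k w []           = sym (*-zeroʳ k)
  pw-* k w (x ∷ [])     = sym (*-zeroʳ k)
  pw-* k w (x ∷ y ∷ xs) = trans (cong (k * w x y +_) (pw-* k w (y ∷ xs))) (sym (*-distribˡ-+ k (w x y) _))

  -- Adds up one inequality per step of the walk. The right end of a step carries `f` and its left
  -- end `g`, so the sum of `f` misses the first vertex, and `g b` is added on both sides to
  -- complete the sum of `g`.
  ∑-linked : ∀ {f g : A → ℕ} {v : A → A → ℕ} {t} → Linked (λ a b → f b + g a ≤ v a b + t) (x ∷ xs) → Pth R x b (x ∷ xs) →
    ∑ f xs + ∑ g (x ∷ xs) ≤ pw v (x ∷ xs) + g b + length xs * t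
  ∑-linked [-] one = ≤-refl
  ∑-linked {x = x} {xs = y ∷ xs} {b = b} {f = f} {g} {v} {t} (h ∷ l) (r ∷ p) with refl ← head≡ p = begin
    f y + ∑ f xs + (g x + ∑ g (y ∷ xs))                    ≡⟨ lemma₁ (f y) (∑ f xs) (g x) (∑ g (y ∷ xs)) ⟩
    f y + g x + (∑ f xs + ∑ g (y ∷ xs))                    ≤⟨ +-mono-≤ h (∑-linked l p) ⟩
    v x y + t + (pw v (y ∷ xs) + g b + length xs * t)      ≡⟨ lemma₂ (v x y) t (pw v (y ∷ xs)) (g b) (length xs * t) ⟩
    v x y + pw v (y ∷ xs) + g b + (t + length xs * t)      ∎
    where
    open ≤-Reasoning
    lemma₁ : ∀ p q r s → p + q + (r + s) ≡ p + r + (q + s)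
    lemma₁ = solve-∀
    lemma₂ : ∀ p q r s t → p + q + (r + s + t) ≡ p + r + s + (q + t)
    lemma₂ = solve-∀

  ∑-linkedˡ : ∀ {f : A → ℕ} {v : A → A → ℕ} → Linked (λ a b → f b ≤ v a b) (x ∷ xs) → ∑ f xs ≤ pw v (x ∷ xs)
  ∑-linkedˡ [-]     = z≤n
  ∑-linkedˡ (h ∷ l) = +-mono-≤ h (∑-linkedˡ l)

  argmax : ∀ (f : A → ℕ) {P : A → Set} → Decidable P → ∀ xs → x ∈ xs → P x →
    ∃ λ y → P y × (∀ {z} → z ∈ xs → P z → f z ≤ f y)
  argmax {x = u} f {P} P? (x ∷ xs) u∈ pu with Any.any? P? xs
  argmax {x = u} f {P} P? (x ∷ xs) (here refl) pu | no ¬q = x , pu , λ { (here refl) _ → ≤-refl ; (there z∈) pz → ⊥-elim (¬q (Any.map (λ { refl → pz }) z∈)) }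
  argmax {x = u} f {P} P? (x ∷ xs) (there u∈) pu | no ¬q = ⊥-elim (¬q (Any.map (λ { refl → pu }) u∈))
  argmax {x = u} f {P} P? (x ∷ xs) u∈ pu | yes q with find q
  ... | z , z∈ , pz with argmax f P? xs z∈ pz | P? x
  ... | y , py , h | no ¬px = y , py , λ { (here refl) px → ⊥-elim (¬px px) ; (there v∈) pv → h v∈ pv }
  ... | y , py , h | yes px with ≤-total (f x) (f y)
  ... | inj₁ le = y , py , λ { (here refl) _ → le ; (there v∈) pv → h v∈ pv }
  ... | inj₂ ge = x , px , λ { (here refl) _ → ≤-refl ; (there v∈) pv → ≤-trans (h v∈ pv) ge }

-- Weighted graphs

module _ {A : Set} where

  record WGraph : Set₁ where
    field
      Adj     : A → A → Set
      adj?    : ∀ u v → Dec (Adj u v)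
      adj-sym : ∀ {u v} → Adj u v → Adj v u
      adj-irr : ∀ {u} → ¬ Adj u u
      w       : A → A → ℕ
      w-sym   : ∀ u v → w u v ≡ w v u
      w-off   : ∀ {u v} → ¬ Adj u v → w u v ≡ 0

    w-loop : ∀ u → w u u ≡ 0
    w-loop u = w-off adj-irr

    0<w⇒adj : ∀ {k u v} → k < w u v → Adj u v
    0<w⇒adj {k} {u} {v} k<w with adj? u v
    ... | yes uv = uv
    ... | no ¬uv = ⊥-elim (n≮0 (subst (k <_) (w-off ¬uv) k<w))

  open WGraph

  record Path (G : WGraph) (V : List A) (a b : A) (xs : List A) : Set where
    constructor mkPath
    field
      pth  : Pth (Adj G) a b xs
      uniq : Unique xs
      sub  : xs ⊆ V

  open Path public

  private variable
    a b c d u v x y : A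
    xs ys zs U V : List A
    R Q : A → A → Set

  Path-⊆ : ∀ {G} → U ⊆ V → Path G U a b xs → Path G V a b xs
  Path-⊆ s (mkPath p u k) = mkPath p u (s ∘ k)

  Path-reverse : ∀ {G} → Path G V a b xs → Path G V b a (reverse xs)
  Path-reverse {xs = xs} {G} (mkPath p u s) = mkPath (Pth-reverse (adj-sym G) p)
    (Unique-↭ (↭-sym (Perm.↭-reverse xs)) u) (s ∘ Perm.∈-resp-↭ (Perm.↭-reverse xs))

  length-reverse-≤ : ∀ {k} (xs : List A) → k ≤ length xs → k ≤ length (reverse xs)
  length-reverse-≤ xs = subst (_ ≤_) (sym (Perm.↭-length (Perm.↭-reverse xs)))

  Same : A → A → A → A → Set
  Same a b u v = (u ≡ a × v ≡ b) ⊎ (u ≡ b × v ≡ a)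

  Same-sym : Same a b u v → Same a b v u
  Same-sym (inj₁ (p , q)) = inj₂ (q , p)
  Same-sym (inj₂ (p , q)) = inj₁ (q , p)

  Remove : (A → A → Set) → A → A → A → A → Set
  Remove R a b u v = R u v × ¬ Same a b u v

  -- The first step cannot end in `b`, since further vertices follow and `b` occurs only at the end;
  -- the later steps never touch `a` again.
  Pth-remove : Pth R a b xs → Unique xs → 3 ≤ length xs → Pth (Remove R a b) a b xs
  Pth-remove one u (s≤s ())
  Pth-remove {a = a} {b} {xs = a ∷ ys} (_∷_ {b = c} r p) u 3≤ = (r , new) ∷ Pth-map (λ x∈ y∈ s → s , λ
      { (inj₁ (refl , _)) → Unique-∉ u x∈ ; (inj₂ (_ , refl)) → Unique-∉ u y∈ }) p
    where
    new : ¬ Same a b a c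
    new (inj₁ (_ , refl)) with s≤s (s≤s ()) ← subst (λ zs → 3 ≤ suc (length zs)) (Pth-loop (Unique-tail u) p) 3≤
    new (inj₂ (refl , _)) = Unique-∉ u (last∈ p)

  module _ {U : A → Set} (U? : Decidable U) (∂ : A → Set)
    (exit  : ∀ {r t} → U r → ¬ U t → R r t → ∂ r)
    (enter : ∀ {r t} → U r → ¬ U t → R t r → ∂ r)
    (short : ∀ {r s} → ∂ r → ∂ s → r ≢ s → Q r s)
    (keep  : ∀ {r s} → U r → U s → R r s → Q r s) where

    -- An excursion leaving the region at r and re-entering it at s is cut short by the Q-edge from r to s.
    Pth-filter : Pth R a b xs → Unique xs → U a → U b → Pth Q a b (filter U? xs)
    Pth-filter-out : Pth R a b xs → Unique xs → ¬ U a → U b → ∃ λ c → ∂ c × c ∈ xs × Pth Q c b (filter U? xs)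

    Pth-filter {a} one u Ua Ub = subst (Pth Q a a) (sym (filter-accept U? Ua)) one
    Pth-filter {a} (_∷_ {b = c} r p) (h ∷ u) Ua Ub with U? c
    ... | yes Uc = subst (Pth Q a _) (sym (filter-accept U? Ua)) (keep Ua Uc r ∷ Pth-filter p u Uc Ub)
    ... | no ¬Uc with Pth-filter-out p u ¬Uc Ub
    ... | e , ∂e , e∈ , q = subst (Pth Q a _) (sym (filter-accept U? Ua)) (short (exit Ua ¬Uc r) ∂e (All.lookup h e∈) ∷ q)

    Pth-filter-out one u ¬Ua Ub = ⊥-elim (¬Ua Ub)
    Pth-filter-out (_∷_ {b = c} r p) (h ∷ u) ¬Ua Ub with U? c
    ... | yes Uc = c , enter Uc ¬Ua r , there (first∈ p) , subst (Pth Q c _) (sym (filter-reject U? ¬Ua)) (Pth-filter p u Uc Ub)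
    ... | no ¬Uc with Pth-filter-out p u ¬Uc Ub
    ... | e , ∂e , e∈ , q = e , ∂e , there e∈ , subst (Pth Q e _) (sym (filter-reject U? ¬Ua)) q

  -- Every edge is counted twice.
  T : (A → A → ℕ) → List A → ℕ
  T w V = ∑ (λ u → ∑ (w u) V) V

  T-↭ : ∀ w → U ↭ V → T w U ≡ T w V
  T-↭ {U} w p = trans (∑-cong U (λ {u} _ → ∑-↭ (w u) p)) (∑-↭ _ p)

  T-cong : ∀ {w w′ : A → A → ℕ} V → (∀ {u v} → u ∈ V → v ∈ V → w u v ≡ w′ u v) → T w V ≡ T w′ V
  T-cong V h = ∑-cong V (λ u∈ → ∑-cong V (λ v∈ → h u∈ v∈))

  module _ {w : A → A → ℕ} (w-sym : ∀ u v → w u v ≡ w v u) where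

    T-++ : ∀ X Y → T w (X ++ Y) ≡ T w X + T w Y + 2 * ∑ (λ x → ∑ (w x) Y) X
    T-++ X Y = begin
      ∑ (λ u → ∑ (w u) (X ++ Y)) (X ++ Y)
        ≡⟨ ∑-++ _ X ⟩
      ∑ (λ u → ∑ (w u) (X ++ Y)) X + ∑ (λ u → ∑ (w u) (X ++ Y)) Y
        ≡⟨ cong₂ _+_ (expand X) (expand Y) ⟩
      (T w X + K) + (∑ (λ u → ∑ (w u) X) Y + T w Y)
        ≡⟨ cong (λ s → (T w X + K) + (s + T w Y)) (trans (∑-comm w Y X) (∑-cong X (λ {x} _ → ∑-cong Y (λ {y} _ → w-sym y x)))) ⟩
      (T w X + K) + (K + T w Y)
        ≡⟨ lemma (T w X) (T w Y) K ⟩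
      T w X + T w Y + 2 * K ∎
      where
      open ≡-Reasoning
      K = ∑ (λ x → ∑ (w x) Y) X
      expand : ∀ Z → ∑ (λ u → ∑ (w u) (X ++ Y)) Z ≡ ∑ (λ u → ∑ (w u) X) Z + ∑ (λ u → ∑ (w u) Y) Z
      expand Z = trans (∑-cong Z (λ {u} _ → ∑-++ (w u) X)) (∑-+ _ _ Z)
      lemma : ∀ p q r → (p + r) + (r + q) ≡ p + q + 2 * r
      lemma = solve-∀

    module _ (w-loop : ∀ u → w u u ≡ 0) where

      T-∷ : ∀ v V → T w (v ∷ V) ≡ T w V + 2 * ∑ (w v) V
      T-∷ v V = trans (T-++ [ v ] V) (lemma (w v v) (T w V) (∑ (w v) V) (w-loop v))
        where
        lemma : ∀ l p q → l ≡ 0 → l + 0 + 0 + p + 2 * (q + 0) ≡ p + 2 * q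
        lemma .0 p q refl = cong (λ s → p + 2 * s) (+-identityʳ q)

      T-split : ∀ v X Y → T w (v ∷ X ++ Y) ≡ T w (v ∷ X) + T w (v ∷ Y) + 2 * ∑ (λ x → ∑ (w x) Y) X
      T-split v X Y = begin
        T w (v ∷ X ++ Y)
          ≡⟨ T-∷ v (X ++ Y) ⟩
        T w (X ++ Y) + 2 * ∑ (w v) (X ++ Y)
          ≡⟨ cong₂ (λ s t → s + 2 * t) (T-++ X Y) (∑-++ (w v) X) ⟩
        T w X + T w Y + 2 * K + 2 * (∑ (w v) X + ∑ (w v) Y)
          ≡⟨ lemma (T w X) (T w Y) K (∑ (w v) X) (∑ (w v) Y) ⟩
        T w X + 2 * ∑ (w v) X + (T w Y + 2 * ∑ (w v) Y) + 2 * K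
          ≡⟨ cong₂ (λ s t → s + t + 2 * K) (T-∷ v X) (T-∷ v Y) ⟨
        T w (v ∷ X) + T w (v ∷ Y) + 2 * K ∎
        where
        open ≡-Reasoning
        K = ∑ (λ x → ∑ (w x) Y) X
        lemma : ∀ p q k r s → p + q + 2 * k + 2 * (r + s) ≡ p + 2 * r + (q + 2 * s) + 2 * k
        lemma = solve-∀

-- Setting the weight of one edge

module SetEdge {A : Set} (_≟_ : ∀ (u v : A) → Dec (u ≡ v)) (G : WGraph {A}) {a b : A} (a≢b : a ≢ b) (t : ℕ) where
  open WGraph G

  same? : ∀ u v → Dec (Same a b u v)
  same? u v = (u ≟ a ×-dec v ≟ b) ⊎-dec (u ≟ b ×-dec v ≟ a)

  override : ∀ {P : Set} → Dec P → ℕ → ℕ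
  override (yes _) s = t
  override (no _)  s = s

  override-yes : ∀ {P : Set} (P? : Dec P) {s} → P → override P? s ≡ t
  override-yes (yes _) p = refl
  override-yes (no ¬p) p = ⊥-elim (¬p p)

  override-no : ∀ {P : Set} (P? : Dec P) {s} → ¬ P → override P? s ≡ s
  override-no (yes p) ¬p = ⊥-elim (¬p p)
  override-no (no _)  ¬p = refl

  -- The pair ab becomes adjacent if it was not. Two values of `t` matter: `h` for the new edges of
  -- a split, and 0 for weightless edges.
  setEdge : WGraph
  setEdge = record
    { Adj     = λ u v → Same a b u v ⊎ Adj u v
    ; adj?    = λ u v → same? u v ⊎-dec adj? u v
    ; adj-sym = λ { (inj₁ s) → inj₁ (Same-sym s) ; (inj₂ r) → inj₂ (adj-sym r) }
    ; adj-irr = λ { (inj₁ (inj₁ (refl , e))) → a≢b e ; (inj₁ (inj₂ (refl , e))) → a≢b (sym e) ; (inj₂ r) → adj-irr r }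
    ; w       = λ u v → override (same? u v) (w u v)
    ; w-sym   = symm
    ; w-off   = λ {u} {v} ¬r → trans (override-no (same? u v) (¬r ∘ inj₁)) (w-off (¬r ∘ inj₂))
    }
    where
    symm : ∀ u v → override (same? u v) (w u v) ≡ override (same? v u) (w v u)
    symm u v with same? u v
    ... | yes s = sym (override-yes (same? v u) (Same-sym s))
    ... | no ¬s = trans (w-sym u v) (sym (override-no (same? v u) (¬s ∘ Same-sym)))

  private
    w′ : A → A → ℕ
    w′ = WGraph.w setEdge

  w′-same : ∀ {u v} → Same a b u v → w′ u v ≡ t
  w′-same {u} {v} = override-yes (same? u v)

  w′-other : ∀ {u v} → ¬ Same a b u v → w′ u v ≡ w u v
  w′-other {u} {v} = override-no (same? u v)

  private
    Rem : A → A → Set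
    Rem = Remove Adj a b

    -- A path without repeated vertices takes the edge ab at most once; cut there, both halves are
    -- walks of the old graph that avoid ab. The names `a′` and `b′` record the direction in which
    -- the edge is taken.
    cut-at : ∀ {c d xs} → Pth (WGraph.Adj setEdge) c d xs → Unique xs → Pth Rem c d xs ⊎
      ∃₂ λ ys zs → ∃₂ λ a′ b′ → xs ≡ ys ++ zs × Same a b a′ b′ × Pth Rem c a′ ys × Pth Rem b′ d zs
    cut-at one u = inj₁ one
    cut-at {c} (_∷_ {b = e} r p) (h ∷ u) with cut-at p u | same? c e
    ... | inj₁ q | yes s = inj₂ ([ c ] , _ , c , e , refl , s , one , q)
    ... | inj₁ q | no ¬s with r
    ...   | inj₁ s = ⊥-elim (¬s s)
    ...   | inj₂ r′ = inj₁ ((r′ , ¬s) ∷ q)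
    cut-at {c} (_∷_ {b = e} r p) (h ∷ u) | inj₂ (ys , zs , a′ , b′ , refl , s , q , q′) | yes s′ = ⊥-elim (bad s s′)
      where
      c≢a′ = All.lookup h (∈-++⁺ˡ (last∈ q))
      c≢b′ = All.lookup h (∈-++⁺ʳ ys (first∈ q′))
      bad : Same a b a′ b′ → Same a b c e → ⊥
      bad (inj₁ (refl , refl)) (inj₁ (refl , _)) = c≢a′ refl
      bad (inj₁ (refl , refl)) (inj₂ (refl , _)) = c≢b′ refl
      bad (inj₂ (refl , refl)) (inj₁ (refl , _)) = c≢b′ refl
      bad (inj₂ (refl , refl)) (inj₂ (refl , _)) = c≢a′ refl
    cut-at {c} (_∷_ {b = e} r p) (h ∷ u) | inj₂ (ys , zs , a′ , b′ , refl , s , q , q′) | no ¬s with r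
    ... | inj₁ s′ = ⊥-elim (¬s s′)
    ... | inj₂ r′ = inj₂ (c ∷ ys , zs , a′ , b′ , refl , s , (r′ , ¬s) ∷ q , q′)

    pw-rem : ∀ {c d xs} → Pth Rem c d xs → pw w′ xs ≡ pw w xs
    pw-rem = pw-cong (λ (_ , ¬s) → w′-other ¬s)

    rem⇒adj : ∀ {c d xs} → Pth Rem c d xs → Pth Adj c d xs
    rem⇒adj = Pth-map (λ _ _ → proj₁)

  -- A cycle that uses ab can be rotated, and reversed if necessary, until ab is its closing edge;
  -- the rest is then a path of `G` from `a` to `b`, and the second hypothesis applies.
  setEdge-cycles : ∀ {V k} →
    (∀ {c d xs} → Path G V c d xs → 3 ≤ length xs → Adj d c → pw w xs + w d c ≤ k) →
    (∀ {xs} → Path G V a b xs → 3 ≤ length xs → pw w xs + t ≤ k) →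
    ∀ {c d xs} → Path setEdge V c d xs → 3 ≤ length xs → WGraph.Adj setEdge d c → pw w′ xs + w′ d c ≤ k
  setEdge-cycles {V} {k} cyc thru {c} {d} {xs} (mkPath p u s) 3≤ dc with cut-at p u | same? d c
  ... | inj₁ q | yes dc≡ = subst (_≤ k) (cong (_+ t) (sym (pw-rem q))) (either dc≡ (mkPath (rem⇒adj q) u s) 3≤)
    where
    either : ∀ {c d xs} → Same a b d c → Path G V c d xs → 3 ≤ length xs → pw w xs + t ≤ k
    either {xs = xs} (inj₁ (refl , refl)) P 3≤ = subst (λ m → m + t ≤ k) (pw-reverse w w-sym xs) (thru (Path-reverse P) (length-reverse-≤ xs 3≤))
    either (inj₂ (refl , refl)) P 3≤ = thru P 3≤
  ... | inj₁ q | no ¬s with dc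
  ...   | inj₁ s′ = ⊥-elim (¬s s′)
  ...   | inj₂ dc′ = subst (_≤ k) (cong (_+ w d c) (sym (pw-rem q))) (cyc (mkPath (rem⇒adj q) u s) 3≤ dc′)
  -- Here both the closing edge and an inner step would be ab, which is possible on two vertices
  -- only.
  setEdge-cycles {V} {k} cyc thru {c} {d} {xs} (mkPath p u s) 3≤ dc | inj₂ (ys , zs , a′ , b′ , refl , ab , q , q′) | yes dc≡ = ⊥-elim (bad ab dc≡)
    where
    parts = Unique-++⁻ ys u
    short : a′ ≡ c → b′ ≡ d → ⊥
    short refl refl with s≤s (s≤s ()) ← subst₂ (λ us vs → 3 ≤ length (us ++ vs)) (Pth-loop (proj₁ parts) q) (Pth-loop (proj₁ (proj₂ parts)) q′) 3≤
    cross : a′ ≢ d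
    cross refl = proj₂ (proj₂ parts) (last∈ q) (last∈ q′)
    bad : Same a b a′ b′ → Same a b d c → ⊥
    bad (inj₁ (refl , refl)) (inj₁ (refl , refl)) = cross refl
    bad (inj₁ (refl , refl)) (inj₂ (refl , refl)) = short refl refl
    bad (inj₂ (refl , refl)) (inj₁ (refl , refl)) = short refl refl
    bad (inj₂ (refl , refl)) (inj₂ (refl , refl)) = cross refl
  setEdge-cycles {V} {k} cyc thru {c} {d} {xs} (mkPath p u s) 3≤ dc | inj₂ (ys , zs , a′ , b′ , refl , ab , q , q′) | no ¬s with dc
  ... | inj₁ s′ = ⊥-elim (¬s s′)
  ... | inj₂ dc′ = begin
    pw w′ (ys ++ zs) + w d c                   ≡⟨ cong (_+ w d c) (pw-joinE w′ q q′) ⟩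
    pw w′ ys + (w′ a′ b′ + pw w′ zs) + w d c   ≡⟨ cong (_+ w d c) (cong₂ _+_ (pw-rem q) (cong₂ _+_ (w′-same ab) (pw-rem q′))) ⟩
    pw w ys + (t + pw w zs) + w d c            ≡⟨ lemma (pw w ys) t (pw w zs) (w d c) ⟩
    pw w zs + (w d c + pw w ys) + t            ≡⟨ cong (_+ t) (pw-joinE w q′ q) ⟨
    pw w (zs ++ ys) + t                        ≤⟨ rotated ab ⟩
    k ∎
    where
    open ≤-Reasoning
    lemma : ∀ p q r s → p + (q + r) + s ≡ r + (s + p) + q
    lemma = solve-∀
    P : Path G V b′ a′ (zs ++ ys)
    P = mkPath (joinE (rem⇒adj q′) dc′ (rem⇒adj q)) (Unique-↭ (Perm.++-comm ys zs) u) (s ∘ Perm.∈-resp-↭ (Perm.++-comm zs ys))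
    len : 3 ≤ length (zs ++ ys)
    len = subst (3 ≤_) (Perm.↭-length (Perm.++-comm ys zs)) 3≤
    rotated : Same a b a′ b′ → pw w (zs ++ ys) + t ≤ k
    rotated (inj₂ (refl , refl)) = thru P len
    rotated (inj₁ (refl , refl)) = subst (λ m → m + t ≤ k) (pw-reverse w w-sym (zs ++ ys)) (thru (Path-reverse P) (length-reverse-≤ (zs ++ ys) len))

-- Splitting at a cut vertex, or along a vertex and a heavy edge

module Splitting {A : Set} (_≟_ : ∀ (u v : A) → Dec (u ≡ v)) (h : ℕ) where

  open WGraph

  private
    _∈?_ : ∀ (x : A) xs → Dec (x ∈ xs)
    x ∈? xs = Any.any? (x ≟_) xs

  -- A cycle is a path together with a closing edge; asking for three vertices rules out an edge run
  -- back and forth. All paths stay in `V`, so that deleting a vertex merely shortens the list.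
  -- `hvy` replaces the condition on bridges, with `h` in the place of 1/2.
  record Good (G : WGraph {A}) (V : List A) : Set where
    field
      cyc : ∀ {a b xs} → Path G V a b xs → 3 ≤ length xs → Adj G b a → pw (w G) xs + w G b a ≤ h + h
      hvy : ∀ {a b} → a ∈ V → b ∈ V → h < w G a b → ∃ λ xs → Path G V a b xs × 3 ≤ length xs

  open Good public

  -- `T` counts edges twice, so the total weight is at most `h` times one less than the number of
  -- vertices; subtraction is avoided.
  Bound : WGraph {A} → List A → Set
  Bound G V = T (w G) V + (h + h) ≤ length V * (h + h)

  Good-↭ : ∀ {G U V} → U ↭ V → Good G U → Good G V
  Good-↭ p g = record
    { cyc = λ P → cyc g (Path-⊆ (Perm.∈-resp-↭ (↭-sym p)) P)
    ; hvy = λ a∈ b∈ h<w → let xs , P , 3≤ = hvy g (Perm.∈-resp-↭ (↭-sym p) a∈) (Perm.∈-resp-↭ (↭-sym p) b∈) h<w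
                          in xs , Path-⊆ (Perm.∈-resp-↭ p) P , 3≤
    }

  Bound-↭ : ∀ {G U V} → U ↭ V → Bound G U → Bound G V
  Bound-↭ {G} p = subst₂ (λ s l → s + (h + h) ≤ l * (h + h)) (T-↭ (w G) p) (Perm.↭-length p)

  -- A heavy edge ab inside `U` lies on a cycle of `V`, whose excursions out of `U` are replaced by
  -- edges between vertices of `∂`. If `a` and `b` were both in `∂`, the shortcut could be ab itself
  -- and the cycle would collapse; hence the condition `¬ (∂ a × ∂ b)`.
  hvy-region : ∀ {G G′ : WGraph {A}} {V U} (∂ : A → Set) → Good G V → U ⊆ V →
    (∀ {r t} → r ∈ U → t ∈ V → t ∉ U → Adj G r t → ∂ r) →
    (∀ {r s} → ∂ r → ∂ s → r ≢ s → Adj G′ r s) →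
    (∀ {r s} → Adj G r s → Adj G′ r s) →
    (∀ {a b} → h < w G′ a b → h < w G a b × ¬ (∂ a × ∂ b)) →
    ∀ {a b} → a ∈ U → b ∈ U → h < w G′ a b → ∃ λ xs → Path G′ U a b xs × 3 ≤ length xs
  hvy-region {G} {G′} {V} {U} ∂ good U⊆V exit short keep heavy {a} {b} a∈ b∈ h<w′ =
    let h<w , inner = heavy h<w′
        xs , mkPath p u s , 3≤ = hvy good (U⊆V a∈) (U⊆V b∈) h<w
        p′ = Pth-map {Q = λ x y → Remove (Adj G) a b x y × x ∈ V × y ∈ V} (λ x∈ y∈ r → r , s x∈ , s y∈) (Pth-remove p u 3≤)
        q  = Pth-filter {Q = Remove (Adj G′) a b} (_∈? U) ∂
               (λ r∈ t∉ ((r , _) , _ , t∈V) → exit r∈ t∈V t∉ r)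
               (λ r∈ t∉ ((r , _) , t∈V , _) → exit r∈ t∈V t∉ (adj-sym G r))
               (λ ∂r ∂s r≢s → short ∂r ∂s r≢s , λ { (inj₁ (refl , refl)) → inner (∂r , ∂s) ; (inj₂ (refl , refl)) → inner (∂s , ∂r) })
               (λ _ _ ((r , ¬s) , _) → keep r , ¬s)
               p′ u a∈ b∈
    in _ , mkPath (Pth-map (λ _ _ → proj₁) q) (UniqueP.filter⁺ (_∈? U) u) (λ z∈ → proj₂ (∈-filter⁻ (_∈? U) {xs = xs} z∈))
         , 3≤length q (λ { refl → adj-irr G (0<w⇒adj G h<w) }) (λ r → proj₂ r (inj₁ (refl , refl)))

  -- A path that leaves `U` at `m` could return only at `m`, so no shortcut is ever taken.
  Good-cut : ∀ {G V U m} → Good G V → U ⊆ V → (∀ {r t} → r ∈ U → t ∈ V → t ∉ U → Adj G r t → r ≡ m) → Good G U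
  Good-cut {G} {m = m} good U⊆V exit = record
    { cyc = λ P → cyc good (Path-⊆ U⊆V P)
    ; hvy = hvy-region {G} {G} (_≡ m) good U⊆V exit (λ { refl refl m≢m → ⊥-elim (m≢m refl) }) id
              (λ h<w → h<w , λ { (refl , refl) → adj-irr G (0<w⇒adj G h<w) })
    }

  -- The vertices other than `v` fall into `X` and `Y`, joined at most by xy: an edge xy is a bridge
  -- once `v` is deleted.
  record Separated (G : WGraph {A}) (V : List A) (v x y : A) (X Y : List A) : Set where
    field
      cover : ∀ {t} → t ∈ V → t ≡ v ⊎ t ∈ X ⊎ t ∈ Y
      v∈V   : v ∈ V
      X⊆V   : X ⊆ V
      Y⊆V   : Y ⊆ V
      v∉X   : v ∉ X
      v∉Y   : v ∉ Y
      disj  : ∀ {t} → t ∈ X → t ∉ Y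
      x∈X   : x ∈ X
      y∈Y   : y ∈ Y
      cross : ∀ {r t} → r ∈ X → t ∈ Y → Adj G r t → r ≡ x × t ≡ y

  flip : ∀ {G V v x y X Y} → Separated G V v x y X Y → Separated G V v y x Y X
  flip {G} S = record
    { cover = λ t∈ → Sum.map id Sum.swap (cover t∈)
    ; v∈V = v∈V ; X⊆V = Y⊆V ; Y⊆V = X⊆V ; v∉X = v∉Y ; v∉Y = v∉X ; disj = λ p q → disj q p ; x∈X = y∈Y ; y∈Y = x∈X
    ; cross = λ r∈ t∈ r → Prod.swap (cross t∈ r∈ (adj-sym G r))
    }
    where open Separated S

  module _ {G V v x y X Y} (S : Separated G V v x y X Y) where
    open Separated S

    stay : ∀ {a b zs} → Pth (Remove (Adj G) x y) a b zs → v ∉ zs → zs ⊆ V → a ∈ X → zs ⊆ X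
    stay one v∉ s a∈ (here refl) = a∈
    stay (r ∷ p) v∉ s a∈ (here refl) = a∈
    stay (r ∷ p) v∉ s a∈ (there z∈) with cover (s (there (first∈ p)))
    ... | inj₁ refl = ⊥-elim (v∉ (there (first∈ p)))
    ... | inj₂ (inj₁ c∈X) = stay p (v∉ ∘ there) (s ∘ there) c∈X z∈
    ... | inj₂ (inj₂ c∈Y) = ⊥-elim (proj₂ r (inj₁ (cross a∈ c∈Y (proj₁ r))))

  module _ {G V v x y X Y} (S : Separated G V v x y X Y) where
    open Separated S

    from-v : ∀ {b zs} → Pth (Remove (Adj G) x y) v b zs → Unique zs → zs ⊆ V → b ∈ Y → Path G (v ∷ Y) v b zs
    from-v one u s b∈ = ⊥-elim (v∉Y b∈)
    from-v {b} (_∷_ {xs = xs} r p) u@(_ ∷ u′) s b∈ with cover (s (there (first∈ p)))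
    ... | inj₁ refl = ⊥-elim (Unique-∉ u (first∈ p))
    ... | inj₂ (inj₁ c∈X) = ⊥-elim (disj (stay S p (Unique-∉ u) (s ∘ there) c∈X (last∈ p)) b∈)
    ... | inj₂ (inj₂ c∈Y) = mkPath (Pth-map (λ _ _ → proj₁) (r ∷ p)) u
        λ { (here refl) → here refl ; (there z∈) → there (stay (flip S) p′ (Unique-∉ u) (s ∘ there) c∈Y z∈) }
      where p′ = Pth-map (λ _ _ (r , ¬s) → r , ¬s ∘ Sum.swap) p

    through-v : ∀ {a b zs} → Pth (Remove (Adj G) x y) a b zs → Unique zs → zs ⊆ V → a ∈ X → b ∈ Y → ∃ λ ys → Path G (v ∷ Y) v b ys
    through-v one u s a∈ b∈ = ⊥-elim (disj a∈ b∈)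
    through-v (r ∷ p) (_ ∷ u) s a∈ b∈ with cover (s (there (first∈ p)))
    ... | inj₁ refl = _ , from-v p u (s ∘ there) b∈
    ... | inj₂ (inj₁ c∈X) = through-v p u (s ∘ there) c∈X b∈
    ... | inj₂ (inj₂ c∈Y) = ⊥-elim (proj₂ r (inj₁ (cross a∈ c∈Y (proj₁ r))))

    -- The cycle through the heavy edge xy has no second way from `X` to `Y` except through `v`; its
    -- stretch from `v` on is the path.
    return : Good G V → h < w G x y → ∃ λ ys → Path G (v ∷ Y) v y ys
    return good h<w with hvy good (X⊆V x∈X) (Y⊆V y∈Y) h<w
    ... | xs , mkPath p u s , 3≤ = through-v (Pth-remove p u 3≤) u s x∈X y∈Y

    -- The two paths meet in `v` only, so xy closes them to a cycle.
    triangle : Good G V → h < w G x y → ∀ {xs ys} → Path G (v ∷ X) v x xs → Path G (v ∷ Y) v y ys →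
      pw (w G) xs + pw (w G) ys + w G x y ≤ h + h
    triangle good h<w {xs} P Q with Pth-∷ (pth Q)
    ... | ys , refl = begin
      pw (w G) xs + pw (w G) (v ∷ ys) + w G x y           ≡⟨ cong₂ (λ p q → p + pw (w G) (v ∷ ys) + q) (sym (pw-reverse (w G) (w-sym G) xs)) (w-sym G x y) ⟩
      pw (w G) (reverse xs) + pw (w G) (v ∷ ys) + w G y x ≡⟨ cong (_+ w G y x) (pw-joinV (w G) (pth P′)) ⟨
      pw (w G) (reverse xs ++ ys) + w G y x               ≤⟨ cyc good (mkPath (joinV (pth P′) (pth Q)) uq sb) len (adj-sym G (0<w⇒adj G h<w)) ⟩
      h + h ∎
      where
      open ≤-Reasoning
      P′ = Path-reverse P
      uQ : Unique (v ∷ ys)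
      uQ = uniq Q
      uq : Unique (reverse xs ++ ys)
      uq = Unique-++ (reverse xs) (uniq P′) (Unique-tail uQ) clash
        where
        clash : ∀ {z} → z ∈ reverse xs → z ∉ ys
        clash z∈ z∈′ with sub P′ z∈ | sub Q (there z∈′)
        ... | here refl | _         = Unique-∉ uQ z∈′
        ... | there p   | here refl = v∉X p
        ... | there p   | there q   = disj p q
      v∷⊆ : ∀ {Z} → Z ⊆ V → v ∷ Z ⊆ V
      v∷⊆ s (here refl) = v∈V
      v∷⊆ s (there z∈)  = s z∈
      sb : reverse xs ++ ys ⊆ V
      sb z∈ with ∈-++⁻ (reverse xs) z∈
      ... | inj₁ z∈′ = v∷⊆ X⊆V (sub P′ z∈′)
      ... | inj₂ z∈′ = v∷⊆ Y⊆V (sub Q (there z∈′))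
      len : 3 ≤ length (reverse xs ++ ys)
      len = subst (3 ≤_) (sym (length-++ (reverse xs)))
        (+-mono-≤ (2≤length (pth P′) (λ { refl → v∉X x∈X })) (s≤s⁻¹ (2≤length (pth Q) (λ { refl → v∉Y y∈Y }))))

    -- Lets `triangle` bound the weights of vx, vy and xy together: if vy is an edge, it serves as
    -- the path itself; otherwise its weight is 0 and the path of `return` will do.
    heavy-enough : Good G V → h < w G x y → ∃ λ ys → Path G (v ∷ Y) v y ys × w G v y ≤ pw (w G) ys
    heavy-enough good h<w with adj? G v y
    ... | yes vy = v ∷ y ∷ [] , mkPath (vy ∷ one) (((λ { refl → v∉Y y∈Y }) ∷ []) ∷ [] ∷ []) (λ { (here refl) → here refl ; (there (here refl)) → there y∈Y })
                 , m≤m+n (w G v y) 0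
    ... | no ¬vy with return good h<w
    ... | ys , Q = ys , Q , ≤-trans (≤-reflexive (w-off G ¬vy)) z≤n

  -- A path from `v` to `x` in this half, the way back through the other half and xy make a cycle of
  -- weight at most 2h. As xy weighs more than `h`, an edge of weight `h` may close the path
  -- instead. That edge is not heavy, so it asks for no cycle, and it is the shortcut for excursions
  -- into the other half.
  Good-half : ∀ {G V v x y X Y} (S : Separated G V v x y X Y) → Good G V → h < w G x y → (v≢x : v ≢ x) →
    Good (SetEdge.setEdge _≟_ G v≢x h) (v ∷ X)
  Good-half {G} {V} {v} {x} {y} {X} {Y} S good h<w v≢x = record
    { cyc = setEdge-cycles (λ P → cyc good (Path-⊆ v∷X⊆V P)) thru
    ; hvy = hvy-region {G} {setEdge} ∂ good v∷X⊆V exit short inj₂ heavy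
    }
    where
    open Separated S
    open SetEdge _≟_ G v≢x h
    ∂ : A → Set
    ∂ r = r ≡ v ⊎ r ≡ x
    v∷X⊆V : v ∷ X ⊆ V
    v∷X⊆V (here refl) = v∈V
    v∷X⊆V (there z∈)  = X⊆V z∈
    thru : ∀ {xs} → Path G (v ∷ X) v x xs → 3 ≤ length xs → pw (w G) xs + h ≤ h + h
    thru {xs} P _ with return S good h<w
    ... | ys , Q = ≤-trans (+-monoʳ-≤ (pw (w G) xs) (<⇒≤ h<w))
      (≤-trans (+-monoˡ-≤ (w G x y) (m≤m+n (pw (w G) xs) (pw (w G) ys))) (triangle S good h<w P Q))
    exit : ∀ {r t} → r ∈ v ∷ X → t ∈ V → t ∉ v ∷ X → Adj G r t → ∂ r
    exit (here refl) t∈ t∉ r = inj₁ refl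
    exit (there r∈)  t∈ t∉ r with cover t∈
    ... | inj₁ refl = ⊥-elim (t∉ (here refl))
    ... | inj₂ (inj₁ t∈X) = ⊥-elim (t∉ (there t∈X))
    ... | inj₂ (inj₂ t∈Y) = inj₂ (proj₁ (cross r∈ t∈Y r))
    short : ∀ {r s} → ∂ r → ∂ s → r ≢ s → Same v x r s ⊎ Adj G r s
    short (inj₁ refl) (inj₁ refl) n = ⊥-elim (n refl)
    short (inj₁ refl) (inj₂ refl) n = inj₁ (inj₁ (refl , refl))
    short (inj₂ refl) (inj₁ refl) n = inj₁ (inj₂ (refl , refl))
    short (inj₂ refl) (inj₂ refl) n = ⊥-elim (n refl)
    heavy : ∀ {a b} → h < w setEdge a b → h < w G a b × ¬ (∂ a × ∂ b)
    heavy {a} {b} h<w′ with same? a b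
    ... | yes s = ⊥-elim (<-irrefl refl h<w′)
    ... | no ¬s = h<w′ , λ
      { (inj₁ refl , inj₁ refl) → adj-irr G (0<w⇒adj G h<w′)
      ; (inj₁ refl , inj₂ refl) → ¬s (inj₁ (refl , refl))
      ; (inj₂ refl , inj₁ refl) → ¬s (inj₂ (refl , refl))
      ; (inj₂ refl , inj₂ refl) → adj-irr G (0<w⇒adj G h<w′) }

  T-setEdge : ∀ (G : WGraph) {v x} (v≢x : v ≢ x) X → v ∉ X → x ∉ X →
    T (w G) (v ∷ x ∷ X) + (h + h) ≡ T (w (SetEdge.setEdge _≟_ G v≢x h)) (v ∷ x ∷ X) + (w G v x + w G v x)
  T-setEdge G {v} {x} v≢x X v∉X x∉X = begin
    T (w G) (v ∷ x ∷ X) + (h + h)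
      ≡⟨ cong (_+ (h + h)) (expand G) ⟩
    T (w G) X + 2 * ∑ (w G x) X + 2 * (w G v x + ∑ (w G v) X) + (h + h)
      ≡⟨ lemma (T (w G) X) (∑ (w G x) X) (w G v x) (∑ (w G v) X) h ⟩
    T (w G) X + 2 * ∑ (w G x) X + 2 * (h + ∑ (w G v) X) + (w G v x + w G v x)
      ≡⟨ cong (_+ (w G v x + w G v x)) (cong₂ _+_ (cong₂ (λ s t → s + 2 * t)
           (T-cong X (λ u∈ z∈ → sym (w′-other λ { (inj₁ (refl , _)) → v∉X u∈ ; (inj₂ (refl , _)) → x∉X u∈ })))
           (∑-cong X (λ z∈ → sym (w′-other λ { (inj₁ (p , _)) → v≢x (sym p) ; (inj₂ (_ , refl)) → v∉X z∈ }))))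
           (cong (2 *_) (cong₂ _+_ (sym (w′-same (inj₁ (refl , refl))))
             (∑-cong X (λ z∈ → sym (w′-other λ { (inj₁ (_ , refl)) → x∉X z∈ ; (inj₂ (p , _)) → v≢x p })))))) ⟩
    T (w setEdge) X + 2 * ∑ (w setEdge x) X + 2 * (w setEdge v x + ∑ (w setEdge v) X) + (w G v x + w G v x)
      ≡⟨ cong (_+ (w G v x + w G v x)) (expand setEdge) ⟨
    T (w setEdge) (v ∷ x ∷ X) + (w G v x + w G v x) ∎
    where
    open ≡-Reasoning
    open SetEdge _≟_ G v≢x h
    expand : ∀ (H : WGraph) → T (w H) (v ∷ x ∷ X) ≡ T (w H) X + 2 * ∑ (w H x) X + 2 * (w H v x + ∑ (w H v) X)
    expand H = trans (T-∷ (w-sym H) (w-loop H) v (x ∷ X)) (cong (_+ 2 * (w H v x + ∑ (w H v) X)) (T-∷ (w-sym H) (w-loop H) x X))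
    lemma : ∀ a b c d h → a + 2 * b + 2 * (c + d) + (h + h) ≡ a + 2 * b + 2 * (h + d) + (c + c)
    lemma = solve-∀

-- Induction steps: cut vertex, heavy bridge, deletion of a vertex

search : ∀ {A B : Set} {Q : A → B → Set} → (∀ r t → Dec (Q r t)) → ∀ S U →
  (∃₂ λ r t → r ∈ S × t ∈ U × Q r t) ⊎ (∀ {r t} → r ∈ S → t ∈ U → ¬ Q r t)
search Q? S U with Any.any? (λ r → Any.any? (Q? r) U) S
... | yes q = let r , r∈ , q′ = find q ; t , t∈ , Qrt = find q′ in inj₁ (r , t , r∈ , t∈ , Qrt)
... | no ¬q = inj₂ (λ r∈ t∈ Qrt → ¬q (lose r∈ (lose t∈ Qrt)))

collect : ∀ {A B : Set} {P : A → Set} xs → (∀ {x} → x ∈ xs → P x ⊎ B) → (∀ {x} → x ∈ xs → P x) ⊎ B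
collect []       f = inj₁ λ ()
collect (x ∷ xs) f with f (here refl) | collect xs (f ∘ there)
... | inj₂ b | _      = inj₂ b
... | inj₁ p | inj₂ b = inj₂ b
... | inj₁ p | inj₁ g = inj₁ λ { (here refl) → p ; (there x∈) → g x∈ }

∈-drop : ∀ {A : Set} {x y : A} xs {ys} → y ∈ xs ++ x ∷ ys → y ≢ x → y ∈ xs ++ ys
∈-drop {x = x} xs {ys} y∈ y≢x with Perm.∈-resp-↭ (Perm.shift x xs ys) y∈
... | here y≡x = ⊥-elim (y≢x y≡x)
... | there q  = q

module Reduction {A : Set} (_≟_ : ∀ (u v : A) → Dec (u ≡ v)) (h : ℕ) where

  open WGraph
  open Splitting _≟_ h

  IH : ℕ → Set₁
  IH N = ∀ {G V} → length V < N → 1 ≤ length V → Unique V → Good G V → Bound G V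

  -- Each side is allowed `k` for every vertex but one; the sides share one vertex, so the same
  -- holds for their union.
  combine : ∀ p q k m n → p + k ≤ suc m * k → q + k ≤ suc n * k → p + q + k ≤ suc (m + n) * k
  combine p q k m n i j = begin
    p + q + k               ≤⟨ +-monoˡ-≤ k (+-mono-≤ (cancel m i) (cancel n j)) ⟩
    m * k + n * k + k       ≡⟨ lemma m n k ⟩
    k + (m + n) * k         ∎
    where
    open ≤-Reasoning
    cancel : ∀ {p} m → p + k ≤ suc m * k → p ≤ m * k
    cancel {p} m i = +-cancelˡ-≤ k p (m * k) (subst (_≤ suc m * k) (+-comm p k) i)
    lemma : ∀ m n k → m * k + n * k + k ≡ k + (m + n) * k
    lemma = solve-∀

  shorterˡ : ∀ (X Y : List A) → 1 ≤ length Y → suc (length X) < suc (length (X ++ Y))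
  shorterˡ X Y 1≤ = s≤s (subst (length X <_) (sym (length-++ X)) (m<m+n (length X) 1≤))

  shorterʳ : ∀ (X Y : List A) → 1 ≤ length X → suc (length Y) < suc (length (X ++ Y))
  shorterʳ X Y 1≤ = s≤s (subst (length Y <_) (sym (length-++ X)) (m<n+m (length Y) 1≤))

  Unique-sides : ∀ {m : A} X {Y : List A} → Unique (m ∷ X ++ Y) → Unique (m ∷ X) × Unique (m ∷ Y)
  Unique-sides X (k ∷ u) with Unique-++⁻ X u
  ... | uX , uY , _ = All.tabulate (λ z∈ → All.lookup k (∈-++⁺ˡ z∈)) ∷ uX , All.tabulate (λ z∈ → All.lookup k (∈-++⁺ʳ X z∈)) ∷ uY

  cut-step : ∀ {G} m X Y → IH (length (m ∷ X ++ Y)) → 1 ≤ length X → 1 ≤ length Y →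
    Unique (m ∷ X ++ Y) → Good G (m ∷ X ++ Y) → (∀ {r t} → r ∈ X → t ∈ Y → ¬ Adj G r t) → Bound G (m ∷ X ++ Y)
  cut-step {G} m X Y ih 1≤X 1≤Y u good cross = subst₂ (λ s l → s + (h + h) ≤ suc l * (h + h)) (sym total) (sym (length-++ X))
    (combine (T (w G) (m ∷ X)) (T (w G) (m ∷ Y)) (h + h) (length X) (length Y)
      (ih (shorterˡ X Y 1≤Y) (s≤s z≤n) (proj₁ sides) (Good-cut {m = m} good inX exitX))
      (ih (shorterʳ X Y 1≤X) (s≤s z≤n) (proj₂ sides) (Good-cut {m = m} good inY exitY)))
    where
    sides = Unique-sides X u
    inX : m ∷ X ⊆ m ∷ X ++ Y
    inX = ∈-++⁺ˡ
    inY : m ∷ Y ⊆ m ∷ X ++ Y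
    inY (here refl) = here refl
    inY (there z∈)  = there (∈-++⁺ʳ X z∈)
    exitX : ∀ {r t} → r ∈ m ∷ X → t ∈ m ∷ X ++ Y → t ∉ m ∷ X → Adj G r t → r ≡ m
    exitX (here refl) _ _ _ = refl
    exitX (there r∈) (here refl) t∉ _ = ⊥-elim (t∉ (here refl))
    exitX (there r∈) (there t∈) t∉ r with ∈-++⁻ X t∈
    ... | inj₁ t∈X = ⊥-elim (t∉ (there t∈X))
    ... | inj₂ t∈Y = ⊥-elim (cross r∈ t∈Y r)
    exitY : ∀ {r t} → r ∈ m ∷ Y → t ∈ m ∷ X ++ Y → t ∉ m ∷ Y → Adj G r t → r ≡ m
    exitY (here refl) _ _ _ = refl
    exitY (there r∈) (here refl) t∉ _ = ⊥-elim (t∉ (here refl))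
    exitY (there r∈) (there t∈) t∉ r with ∈-++⁻ X t∈
    ... | inj₁ t∈X = ⊥-elim (cross t∈X r∈ (adj-sym G r))
    ... | inj₂ t∈Y = ⊥-elim (t∉ (there t∈Y))
    total : T (w G) (m ∷ X ++ Y) ≡ T (w G) (m ∷ X) + T (w G) (m ∷ Y)
    total = trans (T-split (w-sym G) (w-loop G) m X Y)
      (trans (cong (λ s → T (w G) (m ∷ X) + T (w G) (m ∷ Y) + 2 * s)
        (∑-zero X (λ r∈ → ∑-zero Y (λ t∈ → w-off G (cross r∈ t∈))))) (+-identityʳ _))

  split-step : ∀ {G} v x y X Y → IH (length (v ∷ (x ∷ X) ++ y ∷ Y)) → Unique (v ∷ (x ∷ X) ++ y ∷ Y) →
    Good G (v ∷ (x ∷ X) ++ y ∷ Y) → h < w G x y →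
    (∀ {r t} → r ∈ x ∷ X → t ∈ y ∷ Y → Adj G r t → r ≡ x × t ≡ y) → Bound G (v ∷ (x ∷ X) ++ y ∷ Y)
  split-step {G} v x y X Y ih u@(kv ∷ uXY) good h<w cross = begin
    T (w G) (v ∷ (x ∷ X) ++ y ∷ Y) + (h + h)   ≤⟨ +-monoˡ-≤ (h + h) total ⟩
    TX + TY + (h + h)                          ≤⟨ combine TX TY (h + h) (length (x ∷ X)) (length (y ∷ Y))
                                                    (ih (shorterˡ (x ∷ X) (y ∷ Y) (s≤s z≤n)) (s≤s z≤n) (proj₁ sides) (Good-half S good h<w v≢x))
                                                    (ih (shorterʳ (x ∷ X) (y ∷ Y) (s≤s z≤n)) (s≤s z≤n) (proj₂ sides) (Good-half (flip S) good h<w′ v≢y)) ⟩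
    suc (length (x ∷ X) + length (y ∷ Y)) * (h + h)  ≡⟨ cong (λ l → suc l * (h + h)) (length-++ (x ∷ X)) ⟨
    length (v ∷ (x ∷ X) ++ y ∷ Y) * (h + h)    ∎
    where
    open ≤-Reasoning
    sides = Unique-sides (x ∷ X) u
    parts = Unique-++⁻ (x ∷ X) uXY
    h<w′ : h < w G y x
    h<w′ = subst (h <_) (w-sym G x y) h<w
    v∉X : v ∉ x ∷ X
    v∉X = Unique-∉ (proj₁ sides)
    v∉Y : v ∉ y ∷ Y
    v∉Y = Unique-∉ (proj₂ sides)
    v≢x : v ≢ x
    v≢x refl = v∉X (here refl)
    v≢y : v ≢ y
    v≢y refl = v∉Y (here refl)
    x∉X : x ∉ X
    x∉X = Unique-∉ (proj₁ parts)
    y∉Y : y ∉ Y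
    y∉Y = Unique-∉ (proj₁ (proj₂ parts))
    S : Separated G (v ∷ (x ∷ X) ++ y ∷ Y) v x y (x ∷ X) (y ∷ Y)
    S = record
      { cover = λ { (here refl) → inj₁ refl ; (there t∈) → inj₂ (∈-++⁻ (x ∷ X) t∈) }
      ; v∈V = here refl ; X⊆V = there ∘ ∈-++⁺ˡ ; Y⊆V = there ∘ ∈-++⁺ʳ (x ∷ X) ; v∉X = v∉X ; v∉Y = v∉Y
      ; disj = proj₂ (proj₂ parts) ; x∈X = here refl ; y∈Y = here refl ; cross = cross }
    TX = T (w (SetEdge.setEdge _≟_ G v≢x h)) (v ∷ x ∷ X)
    TY = T (w (SetEdge.setEdge _≟_ G v≢y h)) (v ∷ y ∷ Y)
    cross-sum : ∑ (λ r → ∑ (w G r) (y ∷ Y)) (x ∷ X) ≡ w G x y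
    cross-sum = trans (cong₂ _+_
      (trans (cong (w G x y +_) (∑-zero Y (λ t∈ → w-off G λ r → y∉Y (subst (_∈ Y) (proj₂ (cross (here refl) (there t∈) r)) t∈)))) (+-identityʳ (w G x y)))
      (∑-zero X (λ r∈ → ∑-zero (y ∷ Y) (λ t∈ → w-off G λ r → x∉X (subst (_∈ X) (proj₁ (cross (there r∈) t∈ r)) r∈)))))
      (+-identityʳ (w G x y))
    -- This balances the split: counted twice, the two new edges contribute 4h to `TX + TY`, in
    -- place of twice the weights of vx, vy and xy.
    tri : w G v x + w G v y + w G x y ≤ h + h
    tri = let xs , P , vx≤ = heavy-enough (flip S) good h<w′ ; ys , Q , vy≤ = heavy-enough S good h<w
          in ≤-trans (+-monoˡ-≤ (w G x y) (+-mono-≤ vx≤ vy≤)) (triangle S good h<w P Q)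
    total : T (w G) (v ∷ (x ∷ X) ++ y ∷ Y) ≤ TX + TY
    total = +-cancelʳ-≤ (h + h + (h + h)) _ _ (begin
      T (w G) (v ∷ (x ∷ X) ++ y ∷ Y) + (h + h + (h + h))
        ≡⟨ cong (_+ (h + h + (h + h))) (trans (T-split (w-sym G) (w-loop G) v (x ∷ X) (y ∷ Y)) (cong (λ s → T (w G) (v ∷ x ∷ X) + T (w G) (v ∷ y ∷ Y) + 2 * s) cross-sum)) ⟩
      T (w G) (v ∷ x ∷ X) + T (w G) (v ∷ y ∷ Y) + 2 * w G x y + (h + h + (h + h))
        ≡⟨ lemma₁ (T (w G) (v ∷ x ∷ X)) (T (w G) (v ∷ y ∷ Y)) (2 * w G x y) (h + h) ⟩
      T (w G) (v ∷ x ∷ X) + (h + h) + (T (w G) (v ∷ y ∷ Y) + (h + h)) + 2 * w G x y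
        ≡⟨ cong₂ (λ s t → s + t + 2 * w G x y) (T-setEdge G v≢x X (v∉X ∘ there) x∉X) (T-setEdge G v≢y Y (v∉Y ∘ there) y∉Y) ⟩
      TX + (w G v x + w G v x) + (TY + (w G v y + w G v y)) + 2 * w G x y
        ≡⟨ lemma₂ TX TY (w G v x) (w G v y) (w G x y) ⟩
      TX + TY + (w G v x + w G v y + w G x y + (w G v x + w G v y + w G x y))
        ≤⟨ +-monoʳ-≤ (TX + TY) (+-mono-≤ tri tri) ⟩
      TX + TY + (h + h + (h + h)) ∎)
      where
      lemma₁ : ∀ p q r k → p + q + r + (k + k) ≡ p + k + (q + k) + r
      lemma₁ = solve-∀
      lemma₂ : ∀ p q a b c → p + (a + a) + (q + (b + b)) + 2 * c ≡ p + q + (a + b + c + (a + b + c))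
      lemma₂ = solve-∀

  module _ (G : WGraph {A}) {V : List A} {x y : A} (u : Unique V) where

    -- S collects vertices joined to x by a path inside S; it stops growing when only xy leaves it.
    separate : ∀ k S U → length U ≤ k → V ↭ S ++ U → x ∈ S → y ∈ U → (∀ {z} → z ∈ S → ∃ λ xs → Path G S x z xs) →
      (∃ λ xs → Path G V x y xs × 3 ≤ length xs) ⊎
      (∃₂ λ S U → V ↭ S ++ U × x ∈ S × y ∈ U × (∀ {r t} → r ∈ S → t ∈ U → Adj G r t → r ≡ x × t ≡ y))
    separate k S U le p x∈ y∈ K
      with search {Q = λ r t → Adj G r t × ¬ (r ≡ x × t ≡ y)} (λ r t → adj? G r t ×-dec ¬? (r ≟ x ×-dec t ≟ y)) S U
    ... | inj₂ none = inj₂ (S , U , p , x∈ , y∈ , λ {r} {t} r∈ t∈ a → decidable-stable (r ≟ x ×-dec t ≟ y) (λ n → none r∈ t∈ (a , n)))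
    ... | inj₁ (r , t , r∈ , t∈ , a , n) with K r∈ | Unique-++⁻ S (Unique-↭ p u) | t ≟ y
    -- Here `y` is reached by an edge other than xy. Then `r` is not `x`, which makes the path at
    -- least three vertices long.
    ... | xs , mkPath q uq s | _ , _ , disj | yes refl = inj₁ (xs ++ [ y ]
          , mkPath (joinE q a one) (Unique-++ xs uq ([] ∷ []) λ { z∈ (here refl) → disj (s z∈) y∈ }) sb
          , subst (3 ≤_) (sym (length-++ xs)) (+-monoˡ-≤ 1 (2≤length q λ { refl → n (refl , refl) })))
      where
      sb : xs ++ [ y ] ⊆ V
      sb z∈ with ∈-++⁻ xs z∈
      ... | inj₁ z∈xs        = Perm.∈-resp-↭ (↭-sym p) (∈-++⁺ˡ (s z∈xs))
      ... | inj₂ (here refl) = Perm.∈-resp-↭ (↭-sym p) (∈-++⁺ʳ S y∈)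
    ... | xs , mkPath q uq s | _ , _ , disj | no t≢y with ∈-∃++ t∈
    separate zero S U le p x∈ y∈ K | inj₁ _ | _ | _ | _ | U₁ , U₂ , refl with () ← subst (_≤ 0) (trans (length-++ U₁) (+-suc (length U₁) (length U₂))) le
    separate (suc k) S U le p x∈ y∈ K | inj₁ (r , t , r∈ , t∈ , a , n) | xs , mkPath q uq s | _ , _ , disj | no t≢y | U₁ , U₂ , refl =
      separate k (t ∷ S) (U₁ ++ U₂)
        (s≤s⁻¹ (subst (_≤ suc k) (Perm.↭-length (Perm.shift t U₁ U₂)) le))
        (↭-trans p (↭-trans (Perm.++⁺ˡ S (Perm.shift t U₁ U₂)) (Perm.shift t S (U₁ ++ U₂))))
        (there x∈)
        (∈-drop U₁ y∈ (t≢y ∘ sym))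
        λ { (here refl) → xs ++ [ t ] , mkPath (joinE q a one) (Unique-++ xs uq ([] ∷ []) λ { z∈ (here refl) → disj (s z∈) t∈ }) sb
          ; (there z∈)  → let zs , P = K z∈ in zs , Path-⊆ there P }
      where
      sb : xs ++ [ t ] ⊆ t ∷ S
      sb z∈ with ∈-++⁻ xs z∈
      ... | inj₁ z∈xs        = there (s z∈xs)
      ... | inj₂ (here refl) = here refl

  -- If the search from `x` finds no way to `y` other than xy, then xy is a heavy bridge of the
  -- graph without `v`, and `split-step` yields the bound at once.
  heavy-or-split : ∀ {G} v V → IH (length (v ∷ V)) → Unique (v ∷ V) → Good G (v ∷ V) → ∀ {x y} → x ∈ V → y ∈ V →
    (h < w G x y → ∃ λ xs → Path G V x y xs × 3 ≤ length xs) ⊎ Bound G (v ∷ V)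
  heavy-or-split {G} v V ih u@(_ ∷ uV) good {x} {y} x∈ y∈ with h <? w G x y
  ... | no h≮w = inj₁ λ h<w → ⊥-elim (h≮w h<w)
  ... | yes h<w with ∈-∃++ x∈
  ... | V₁ , V₂ , refl with separate G uV (length V) [ x ] (V₁ ++ V₂) (≤-trans (n≤1+n _) (≤-reflexive (sym (Perm.↭-length (Perm.shift x V₁ V₂)))))
                              (Perm.shift x V₁ V₂) (here refl) (∈-drop V₁ y∈ (λ { refl → adj-irr G (0<w⇒adj G h<w) }))
                              (λ { (here refl) → [ x ] , mkPath one ([] ∷ []) id })
  ... | inj₁ P = inj₁ λ _ → P
  ... | inj₂ (S , U , p , x∈S , y∈U , cross) with ∈-∃++ x∈S | ∈-∃++ y∈U
  ... | S₁ , S₂ , refl | U₁ , U₂ , refl = inj₂ (Bound-↭ {G} (↭-sym perm)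
        (split-step v x y (S₁ ++ S₂) (U₁ ++ U₂) (subst IH (Perm.↭-length perm) ih) (Unique-↭ perm u) (Good-↭ perm good) h<w
          (λ r∈ t∈ → cross (Perm.∈-resp-↭ (↭-sym (Perm.shift x S₁ S₂)) r∈) (Perm.∈-resp-↭ (↭-sym (Perm.shift y U₁ U₂)) t∈))))
    where
    perm : v ∷ V ↭ v ∷ (x ∷ S₁ ++ S₂) ++ (y ∷ U₁ ++ U₂)
    perm = prep v (↭-trans p (Perm.++⁺ (Perm.shift x S₁ S₂) (Perm.shift y U₁ U₂)))

  -- Removing `v` lowers `T` by twice its degree, at most 2h, which is the share of one vertex. The
  -- remaining heavy edges must keep a cycle that avoids `v`; any that does not gives the bound by
  -- splitting.
  delete-step : ∀ {G} v V → IH (length (v ∷ V)) → 1 ≤ length V → Unique (v ∷ V) → Good G (v ∷ V) → ∑ (w G v) V ≤ h → Bound G (v ∷ V)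
  delete-step {G} v V ih 1≤V u@(_ ∷ uV) good d≤h with collect V (λ x∈ → collect V (λ y∈ → heavy-or-split v V ih u good x∈ y∈))
  ... | inj₂ b = b
  ... | inj₁ all = begin
    T (w G) (v ∷ V) + (h + h)                       ≡⟨ cong (_+ (h + h)) (T-∷ (w-sym G) (w-loop G) v V) ⟩
    T (w G) V + 2 * ∑ (w G v) V + (h + h)           ≡⟨ lemma (T (w G) V) (∑ (w G v) V) (h + h) ⟩
    T (w G) V + (h + h) + (∑ (w G v) V + ∑ (w G v) V) ≤⟨ +-mono-≤ (ih ≤-refl 1≤V uV good′) (+-mono-≤ d≤h d≤h) ⟩
    length V * (h + h) + (h + h)                    ≡⟨ +-comm (length V * (h + h)) (h + h) ⟩
    length (v ∷ V) * (h + h)                        ∎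
    where
    open ≤-Reasoning
    lemma : ∀ p q k → p + 2 * q + k ≡ p + k + (q + q)
    lemma = solve-∀
    good′ : Good G V
    good′ = record { cyc = λ P → cyc good (Path-⊆ there P) ; hvy = λ a∈ b∈ h<w → all a∈ b∈ h<w }

-- Complete graphs

length≡∑ : ∀ {A : Set} (xs : List A) → length xs ≡ ∑ (λ _ → 1) xs
length≡∑ []       = refl
length≡∑ (x ∷ xs) = cong suc (length≡∑ xs)

length-⊆ : ∀ {A : Set} {xs ys : List A} → Unique xs → xs ⊆ ys → length xs ≤ length ys
length-⊆ {xs = xs} {ys} u s = subst₂ _≤_ (sym (length≡∑ xs)) (sym (length≡∑ ys)) (∑-⊆ _ xs ys u (λ z∈ → inj₂ (s z∈)))

Pth-any : ∀ {A : Set} (x : A) xs → ∃ λ b → Pth (λ _ _ → ⊤) x b (x ∷ xs)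
Pth-any x []       = x , one
Pth-any x (y ∷ xs) = let b , p = Pth-any y xs in b , tt ∷ p

Pth-distinct : ∀ {A : Set} {R Q : A → A → Set} {a b xs} → Unique xs → (∀ {x y} → x ∈ xs → y ∈ xs → x ≢ y → Q x y) → Pth R a b xs → Pth Q a b xs
Pth-distinct u f one = one
Pth-distinct (k ∷ u) f (r ∷ p) = f (here refl) (there (first∈ p)) (All.lookup k (first∈ p)) ∷ Pth-distinct u (λ x∈ y∈ → f (there x∈) (there y∈)) p

module Complete {A : Set} (_≟_ : ∀ (u v : A) → Dec (u ≡ v)) (h : ℕ)
  (enum : List (List A)) (enum-complete : ∀ {xs} → Unique xs → xs ∈ enum) where

  open WGraph
  open Splitting _≟_ h
  open import Data.List.Relation.Unary.Unique.DecPropositional _≟_ using (unique?)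

  private
    _∈?_ : ∀ (x : A) xs → Dec (x ∈ xs)
    x ∈? xs = Any.any? (x ≟_) xs

    Any-rel : A → A → Set
    Any-rel _ _ = ⊤

  module _ (G : WGraph {A}) {V} (3≤V : 3 ≤ length V) (uV : Unique V) (good : Good G V)
    (complete : ∀ {a b} → a ∈ V → b ∈ V → a ≢ b → Adj G a b) where

    private
      W : A → A → ℕ
      W = w G

      deg : A → ℕ
      deg u = ∑ (W u) V

      Ham : List A → Set
      Ham xs = Unique xs × All (_∈ V) xs × All (_∈ xs) V

      ham? : Decidable Ham
      ham? xs = unique? xs ×-dec All.all? (_∈? V) xs ×-dec All.all? (_∈? xs) V

      Ham-↭ : ∀ {xs ys} → xs ↭ ys → Ham xs → Ham ys
      Ham-↭ p (u , s , t) = Unique-↭ p u , Perm.All-resp-↭ p s , All.map (Perm.∈-resp-↭ p) t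

      cw : List A → ℕ
      cw []       = 0
      cw (x ∷ xs) = pw W (x ∷ xs ++ [ x ])

      cw-pth : ∀ {R a b xs} → Pth R a b xs → cw xs ≡ pw W xs + W b a
      cw-pth {a = a} {b} p with Pth-∷ p
      ... | ys , refl = trans (pw-joinE W p (one {R = Any-rel})) (cong (pw W (a ∷ ys) +_) (+-identityʳ (W b a)))

      deg-≤ : ∀ {xs} → Ham xs → ∀ u → deg u ≤ ∑ (W u) xs
      deg-≤ (_ , _ , t) u = ∑-⊆ (W u) V _ uV (λ z∈ → inj₂ (All.lookup t z∈))

      module _ {γ} (max : ∀ {xs} → Ham xs → cw xs ≤ γ) where

        -- Reversing the stretch from `t` to `b` trades the edges st and ba of the cycle for sb and
        -- ta; the new Hamiltonian cycle weighs at most `γ`.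
        exchange : ∀ {a b ys} → Ham ys → cw ys ≡ γ → Pth Any-rel a b ys → ∀ ps {s t qs} → ys ≡ ps ++ s ∷ t ∷ qs →
          W a t + W b s ≤ W s t + W b a
        exchange {a} {b} H cw≡γ p ps {s} {t} {qs} refl with splitE ps p
        ... | p₁ , _ , p₂ = +-cancelˡ-≤ (pw W (ps ++ [ s ]) + pw W (t ∷ qs)) _ _ (begin
          pw W (ps ++ [ s ]) + pw W (t ∷ qs) + (W a t + W b s)
            ≡⟨ lemma₁ (pw W (ps ++ [ s ])) (pw W (t ∷ qs)) (W a t) (W b s) ⟩
          pw W (ps ++ [ s ]) + (W b s + pw W (t ∷ qs)) + W a t
            ≡⟨ cong₂ (λ i j → pw W (ps ++ [ s ]) + i + j) (cong₂ _+_ (w-sym G b s) (sym (pw-reverse W (w-sym G) (t ∷ qs)))) (w-sym G a t) ⟩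
          pw W (ps ++ [ s ]) + (W s b + pw W (reverse (t ∷ qs))) + W t a
            ≡⟨ cong (_+ W t a) (pw-joinE W p₁ r₂) ⟨
          pw W ((ps ++ [ s ]) ++ reverse (t ∷ qs)) + W t a
            ≡⟨ cw-pth (joinE p₁ tt r₂) ⟨
          cw ((ps ++ [ s ]) ++ reverse (t ∷ qs))
            ≤⟨ max (Ham-↭ perm H) ⟩
          γ
            ≡⟨ cw≡γ ⟨
          cw (ps ++ s ∷ t ∷ qs)
            ≡⟨ cw-pth p ⟩
          pw W (ps ++ s ∷ t ∷ qs) + W b a
            ≡⟨ cong (_+ W b a) (pw-split W ps) ⟩
          pw W (ps ++ [ s ]) + (W s t + pw W (t ∷ qs)) + W b a
            ≡⟨ lemma₂ (pw W (ps ++ [ s ])) (W s t) (pw W (t ∷ qs)) (W b a) ⟩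
          pw W (ps ++ [ s ]) + pw W (t ∷ qs) + (W s t + W b a) ∎)
          where
          open ≤-Reasoning
          r₂ : Pth Any-rel b t (reverse (t ∷ qs))
          r₂ = Pth-reverse (λ _ → tt) p₂
          perm : ps ++ s ∷ t ∷ qs ↭ (ps ++ [ s ]) ++ reverse (t ∷ qs)
          perm = ↭-trans (Perm.↭-reflexive (sym (++-assoc ps [ s ] (t ∷ qs)))) (Perm.++⁺ˡ (ps ++ [ s ]) (↭-sym (Perm.↭-reverse (t ∷ qs))))
          lemma₁ : ∀ p q r s → p + q + (r + s) ≡ p + (s + q) + r
          lemma₁ = solve-∀
          lemma₂ : ∀ p q r s → p + (q + r) + s ≡ p + r + (q + s)
          lemma₂ = solve-∀

        -- `exchange` is added up over the `suc k` steps of the path. One of the `suc k` copies of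
        -- `W b a` closes the path to the whole cycle, of weight `γ`; the other `k` remain.
        degree-sum : ∀ {a b ys k} → Ham ys → cw ys ≡ γ → length ys ≡ 2 + k → Pth Any-rel a b ys → deg a + deg b ≤ k * W b a + γ
        degree-sum {a} {b} {k = k} H cw≡γ len p with Pth-∷ p
        ... | ys , refl = begin
          deg a + deg b
            ≤⟨ +-mono-≤ (deg-≤ H a) (deg-≤ H b) ⟩
          W a a + ∑ (W a) ys + ∑ (W b) (a ∷ ys)
            ≡⟨ cong (λ l → l + ∑ (W a) ys + ∑ (W b) (a ∷ ys)) (w-loop G a) ⟩
          ∑ (W a) ys + ∑ (W b) (a ∷ ys)
            ≤⟨ ∑-linked {f = W a} {W b} {W} {W b a} (Linked-tabulate (a ∷ ys) (exchange H cw≡γ p)) p ⟩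
          pw W (a ∷ ys) + W b b + length ys * W b a
            ≡⟨ cong₂ (λ l m → pw W (a ∷ ys) + l + m * W b a) (w-loop G b) (suc-injective len) ⟩
          pw W (a ∷ ys) + 0 + suc k * W b a
            ≡⟨ lemma (pw W (a ∷ ys)) (W b a) k ⟩
          k * W b a + (pw W (a ∷ ys) + W b a)
            ≡⟨ cong (k * W b a +_) (trans (sym (cw-pth p)) cw≡γ) ⟩
          k * W b a + γ ∎
          where
          open ≤-Reasoning
          lemma : ∀ p q k → p + 0 + suc k * q ≡ k * q + (p + q)
          lemma = solve-∀

        -- Rotation makes any edge of the cycle the closing one. With the last vertex `l` put in
        -- front, the edges of the cycle are the consecutive pairs of `l ∷ xs`.
        consecutive : ∀ {x l xs k} → Ham xs → cw xs ≡ γ → length xs ≡ 2 + k → Pth Any-rel x l xs →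
          ∀ ps {a b qs} → l ∷ xs ≡ ps ++ a ∷ b ∷ qs → deg b + deg a ≤ k * W a b + γ
        consecutive H cw≡γ len p [] refl with refl ← head≡ p = degree-sum H cw≡γ len p
        consecutive {x} {l} H cw≡γ len p (_ ∷ ps) {a} {b} {qs} refl with splitE ps p
        ... | p₁ , _ , p₂ = degree-sum (Ham-↭ perm H) (trans weights cw≡γ) (trans (sym (Perm.↭-length perm)) len) (joinE p₂ tt p₁)
          where
          open ≡-Reasoning
          perm : ps ++ a ∷ b ∷ qs ↭ (b ∷ qs) ++ (ps ++ [ a ])
          perm = ↭-trans (Perm.↭-reflexive (sym (++-assoc ps [ a ] (b ∷ qs)))) (Perm.++-comm (ps ++ [ a ]) (b ∷ qs))
          lemma : ∀ p q r s → p + (q + r) + s ≡ r + (s + p) + q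
          lemma = solve-∀
          weights : cw ((b ∷ qs) ++ (ps ++ [ a ])) ≡ cw (ps ++ a ∷ b ∷ qs)
          weights = begin
            cw ((b ∷ qs) ++ (ps ++ [ a ]))                         ≡⟨ cw-pth (joinE p₂ tt p₁) ⟩
            pw W ((b ∷ qs) ++ (ps ++ [ a ])) + W a b               ≡⟨ cong (_+ W a b) (pw-joinE W p₂ p₁) ⟩
            pw W (b ∷ qs) + (W l x + pw W (ps ++ [ a ])) + W a b   ≡⟨ lemma (pw W (b ∷ qs)) (W l x) (pw W (ps ++ [ a ])) (W a b) ⟩
            pw W (ps ++ [ a ]) + (W a b + pw W (b ∷ qs)) + W l x   ≡⟨ cong (_+ W l x) (pw-split W ps) ⟨
            pw W (ps ++ a ∷ b ∷ qs) + W l x                        ≡⟨ cw-pth p ⟨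
            cw (ps ++ a ∷ b ∷ qs)                                  ∎

    complete-bound : Bound G V
    complete-bound with argmax cw ham? enum (enum-complete uV) (uV , All.tabulate id , All.tabulate id)
    ... | [] , (_ , _ , t) , _ with () ← ≤-trans 3≤V (length-⊆ {ys = []} uV (λ z∈ → All.lookup t z∈))
    ... | xs@(x ∷ xs′) , H@(u , s , t) , best with Pth-any x xs′
    ... | l , p with length xs in len | ≤-trans 3≤V (length-⊆ {ys = xs} uV (λ z∈ → All.lookup t z∈))
    ... | suc zero | s≤s ()
    ... | suc (suc k) | 3≤xs = begin
      T W V + (h + h)             ≤⟨ +-monoˡ-≤ (h + h) (∑-⊆ deg V xs uV (λ z∈ → inj₂ (All.lookup t z∈))) ⟩
      ∑ deg xs + (h + h)          ≤⟨ +-monoˡ-≤ (h + h) half ⟩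
      suc k * γ + (h + h)         ≤⟨ +-monoˡ-≤ (h + h) (*-monoʳ-≤ (suc k) γ≤) ⟩
      suc k * (h + h) + (h + h)   ≡⟨ +-comm (suc k * (h + h)) (h + h) ⟩
      suc (suc k) * (h + h)       ≡⟨ cong (_* (h + h)) len ⟨
      length xs * (h + h)         ≤⟨ *-monoˡ-≤ (h + h) (length-⊆ u (λ z∈ → All.lookup s z∈)) ⟩
      length V * (h + h)          ∎
      where
      open ≤-Reasoning
      γ = cw xs
      max : ∀ {ys} → Ham ys → cw ys ≤ γ
      max H′ = best (enum-complete (proj₁ H′)) H′
      x≢l : l ≢ x
      x≢l refl with s≤s () ← ≤-trans 3≤xs (≤-reflexive (trans (sym len) (cong length (Pth-loop u p))))
      γ≤ : γ ≤ h + h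
      γ≤ = subst (_≤ h + h) (sym (cw-pth p)) (cyc good
        (mkPath (Pth-distinct u (λ a∈ b∈ → complete (All.lookup s a∈) (All.lookup s b∈)) p) u (λ z∈ → All.lookup s z∈))
        (subst (3 ≤_) (sym len) 3≤xs)
        (complete (All.lookup s (last∈ p)) (All.lookup s (first∈ p)) x≢l))
      lemma₁ : ∀ d e → d + d + e ≡ d + (e + d)
      lemma₁ = solve-∀
      lemma₂ : ∀ k g e → k * g + e + suc (suc k) * g ≡ suc k * g + suc k * g + e
      lemma₂ = solve-∀
      -- The sum over all `suc (suc k)` edges of the cycle counts each degree twice. Their weights
      -- add up to `γ`, which gives `k` and `suc (suc k)`, together twice `suc k`, copies of `γ`.
      double : ∑ deg xs + ∑ deg xs ≤ suc k * γ + suc k * γ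
      double = +-cancelʳ-≤ (deg l) _ _ (begin
        ∑ deg xs + ∑ deg xs + deg l                   ≡⟨ lemma₁ (∑ deg xs) (deg l) ⟩
        ∑ deg xs + ∑ deg (l ∷ xs)                     ≤⟨ ∑-linked {f = deg} {deg} {λ a b → k * W a b} {γ} (Linked-tabulate (l ∷ xs) (consecutive max H refl len p)) (tt ∷ p) ⟩
        pw (λ a b → k * W a b) (l ∷ xs) + deg l + length xs * γ
          ≡⟨ cong₂ (λ i j → i + deg l + j * γ) (trans (pw-* k W (l ∷ xs)) (cong (k *_) (trans (+-comm (W l x) (pw W xs)) (sym (cw-pth p))))) len ⟩
        k * γ + deg l + suc (suc k) * γ               ≡⟨ lemma₂ k γ (deg l) ⟩
        suc k * γ + suc k * γ + deg l                 ∎)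
      half : ∑ deg xs ≤ suc k * γ
      half with ≤-total (∑ deg xs) (suc k * γ)
      ... | inj₁ le = le
      ... | inj₂ ge = +-cancelʳ-≤ (∑ deg xs) _ _ (≤-trans double (+-monoʳ-≤ (suc k * γ) ge))

-- Heaviest paths

None : ∀ {A : Set} → (A → Set) → List A → Set
None Q xs = ∀ {x} → x ∈ xs → ¬ Q x

module _ {A : Set} where

  None-∷ : ∀ {Q : A → Set} {x xs} → ¬ Q x → None Q xs → None Q (x ∷ xs)
  None-∷ ¬q n (here refl) = ¬q
  None-∷ ¬q n (there x∈)  = n x∈

  None-++ : ∀ {Q : A → Set} xs {ys} → None Q xs → None Q ys → None Q (xs ++ ys)
  None-++ xs m n z∈ with ∈-++⁻ xs z∈
  ... | inj₁ z∈xs = m z∈xs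
  ... | inj₂ z∈ys = n z∈ys

  module _ {Q : A → Set} (Q? : Decidable Q) where

    first-such : ∀ xs → (∃₂ λ μ t → ∃ λ ν → xs ≡ μ ++ t ∷ ν × Q t × None Q μ) ⊎ None Q xs
    first-such [] = inj₂ λ ()
    first-such (x ∷ xs) with Q? x | first-such xs
    ... | yes q | _                                = inj₁ ([] , x , xs , refl , q , λ ())
    ... | no ¬q | inj₁ (μ , t , ν , refl , q , n) = inj₁ (x ∷ μ , t , ν , refl , q , None-∷ ¬q n)
    ... | no ¬q | inj₂ n                           = inj₂ (None-∷ ¬q n)

    last-such : ∀ xs → (∃₂ λ ρ m → ∃ λ σ → xs ≡ ρ ++ m ∷ σ × Q m × None Q σ) ⊎ None Q xs
    last-such [] = inj₂ λ ()
    last-such (x ∷ xs) with Q? x | last-such xs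
    ... | _     | inj₁ (ρ , m , σ , refl , q , n) = inj₁ (x ∷ ρ , m , σ , refl , q , n)
    ... | yes q | inj₂ n                           = inj₁ ([] , x , xs , refl , q , n)
    ... | no ¬q | inj₂ n                           = inj₂ (None-∷ ¬q n)

  module _ {P Q : A → Set} (P? : Decidable P) (Q? : Decidable Q) where

    -- Meant for `P` and `Q` the neighbours of the last and the first vertex of a path: edges from
    -- the ends to `s` and `t` then close the path without `μ` to a cycle.
    Crossing : List A → Set
    Crossing us = ∃₂ λ ps s → ∃₂ λ μ t → ∃ λ qs → us ≡ ps ++ s ∷ μ ++ t ∷ qs × P s × Q t × None P μ × None Q μ

    Nested : List A → Set
    Nested us = ∃₂ λ α c → ∃ λ β → us ≡ α ++ c ∷ β × P c × None P α × None Q β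

    -- If some `P` stands before some `Q`, a closest such pair has neither in between. If none does,
    -- the first `P`, where there is one, has no `Q` behind it.
    crossing : ∀ us → Crossing us ⊎ None P us ⊎ Nested us
    crossing [] = inj₂ (inj₁ λ ())
    crossing (x ∷ us) with crossing us | P? x
    ... | inj₁ (ps , s , μ , t , qs , refl , rest) | _ = inj₁ (x ∷ ps , s , μ , t , qs , refl , rest)
    ... | inj₂ (inj₁ n) | no ¬p = inj₂ (inj₁ (None-∷ ¬p n))
    ... | inj₂ (inj₁ n) | yes p with first-such Q? us
    ...   | inj₁ (μ , t , ν , refl , q , n′) = inj₁ ([] , x , μ , t , ν , refl , p , q , n ∘ ∈-++⁺ˡ , n′)
    ...   | inj₂ n′ = inj₂ (inj₂ ([] , x , us , refl , p , (λ ()) , n′))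
    crossing (x ∷ us) | inj₂ (inj₂ (α , c , β , refl , pc , n , n′)) | no ¬p = inj₂ (inj₂ (x ∷ α , c , β , refl , pc , None-∷ ¬p n , n′))
    crossing (x ∷ us) | inj₂ (inj₂ (α , c , β , refl , pc , n , n′)) | yes p with first-such Q? α
    ... | inj₁ (μ , t , ν , refl , q , m) = inj₁ ([] , x , μ , t , ν ++ c ∷ β , cong (x ∷_) (++-assoc μ (t ∷ ν) (c ∷ β)) , p , q , n ∘ ∈-++⁺ˡ , m)
    ... | inj₂ m with Q? c
    ...   | yes q = inj₁ ([] , x , α , c , β , refl , p , q , n , m)
    ...   | no ¬q = inj₂ (inj₂ ([] , x , us , refl , p , (λ ()) , None-++ α m (None-∷ ¬q n′)))

  extract : ∀ {us V : List A} → Unique us → us ⊆ V → ∃ λ O → V ↭ us ++ O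
  extract {[]} {V} u s = V , ↭-refl
  extract {x ∷ us} {V} u@(_ ∷ u′) s with ∈-∃++ (s (here refl))
  ... | V₁ , V₂ , refl with extract {us} {V₁ ++ V₂} u′ (λ z∈ → ∈-drop V₁ (s (there z∈)) (λ { refl → Unique-∉ u z∈ }))
  ... | O , p = O , ↭-trans (Perm.shift x V₁ V₂) (prep x p)

  first-step : ∀ {R : A → A → Set} {a b xs} → Pth R a b xs → a ≢ b → ∃ λ z → z ∈ xs × R a z
  first-step one     a≢b = ⊥-elim (a≢b refl)
  first-step (r ∷ p) _   = _ , there (first∈ p) , r

  penultimate : ∀ {R : A → A → Set} {a b xs} → Pth R a b xs → a ≢ b → ∃ λ z → z ∈ xs × R z b
  penultimate one a≢b = ⊥-elim (a≢b refl)
  penultimate (r ∷ p) _ = go r p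
    where
    go : ∀ {R : A → A → Set} {a b c xs} → R a b → Pth R b c xs → ∃ λ z → z ∈ a ∷ xs × R z c
    go r one     = _ , here refl , r
    go r (s ∷ p) = let z , z∈ , t = go s p in z , there z∈ , t

  ∈⇒1≤ : ∀ {z} {xs : List A} → z ∈ xs → 1 ≤ length xs
  ∈⇒1≤ (here _)  = s≤s z≤n
  ∈⇒1≤ (there _) = s≤s z≤n

-- Growing a region towards a cut vertex

module Growth {A : Set} (_≟_ : ∀ (u v : A) → Dec (u ≡ v)) (h : ℕ) where

  open WGraph
  open Splitting _≟_ h

  reversed : ∀ {G : WGraph {A}} {V a b xs} → Path G V a b xs → ∃ λ ys → Path G V b a (b ∷ ys) × pw (w G) (b ∷ ys) ≡ pw (w G) xs
  reversed {G} {xs = xs} P with Pth-∷ (pth (Path-reverse P))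
  ... | ys , eq = ys , subst (Path G _ _ _) eq (Path-reverse P) , trans (cong (pw (w G)) (sym eq)) (pw-reverse (w G) (w-sym G) xs)

  CutVertex : WGraph {A} → List A → Set
  CutVertex G V = ∃ λ m → ∃₂ λ S U → V ↭ m ∷ S ++ U × 1 ≤ length S × 1 ≤ length U × (∀ {r t} → r ∈ S → t ∈ U → ¬ Adj G r t)

  module _ (G : WGraph {A}) {V} (uV : Unique V) (good : Good G V) {c : A} {β : List A} {δ δ′ : ℕ} (1≤β : 1 ≤ length β)
    (right : ∀ {t} → t ∈ β → ∃ λ ys → Path G (c ∷ β) t c ys × δ′ ≤ pw (w G) ys) where

    private
      W : A → A → ℕ
      W = w G

    -- m ∷ θ is a path from m to c; every vertex of S reaches m inside S at weight at least δ.
    record State (S : List A) (m : A) (θ O : List A) : Set where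
      field
        perm : V ↭ m ∷ S ++ (θ ++ β ++ O)
        1≤S  : 1 ≤ length S
        seg  : Pth (Adj G) m c (m ∷ θ)
        left : ∀ {z} → z ∈ S → ∃ λ xs → Path G (m ∷ S) z m xs × δ ≤ pw W xs

    module _ {S m θ O} (st : State S m θ O) where
      open State st

      private
        u′ : Unique (m ∷ S ++ (θ ++ β ++ O))
        u′ = Unique-↭ perm uV
        parts = Unique-++⁻ (m ∷ S) u′
        parts′ = Unique-++⁻ θ (proj₁ (proj₂ parts))
        out : ∀ {z} → z ∈ m ∷ S → z ∉ θ ++ β ++ O
        out = proj₂ (proj₂ parts)
        V-left : m ∷ S ⊆ V
        V-left z∈ = Perm.∈-resp-↭ (↭-sym perm) (∈-++⁺ˡ z∈)
        V-right : θ ++ β ++ O ⊆ V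
        V-right z∈ = Perm.∈-resp-↭ (↭-sym perm) (∈-++⁺ʳ (m ∷ S) z∈)
        c∉β : c ∉ β
        c∉β c∈ with last∈ seg
        ... | here refl = out (here refl) (∈-++⁺ʳ θ (∈-++⁺ˡ c∈))
        ... | there c∈θ = proj₂ (proj₂ parts′) c∈θ (∈-++⁺ˡ c∈)

      -- The path from `r` to `m`, the segment from `m` to `c` and the path from `c` to `t` follow
      -- one another without repetition, and the edge rt closes them to a cycle.
      finish : ∀ {r t} → r ∈ S → t ∈ β → Adj G r t → δ + δ′ ≤ h + h
      finish {r} {t} r∈ t∈ rt with left r∈ | right t∈
      ... | xs , P , δ≤ | ys , Q , δ′≤ with reversed Q
      ... | zs , Q′ , eq = begin
        δ + δ′                                            ≤⟨ +-mono-≤ δ≤ (≤-trans δ′≤ (≤-reflexive (sym eq))) ⟩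
        pw W xs + pw W (c ∷ zs)                           ≤⟨ +-monoˡ-≤ (pw W (c ∷ zs)) (m≤m+n (pw W xs) (pw W (m ∷ θ))) ⟩
        pw W xs + pw W (m ∷ θ) + pw W (c ∷ zs)            ≡⟨ cong (_+ pw W (c ∷ zs)) (pw-joinV W (pth P)) ⟨
        pw W (xs ++ θ) + pw W (c ∷ zs)                    ≡⟨ pw-joinV W p₁ ⟨
        pw W ((xs ++ θ) ++ zs)                            ≤⟨ m≤m+n _ (W t r) ⟩
        pw W ((xs ++ θ) ++ zs) + W t r                    ≤⟨ cyc good (mkPath (joinV p₁ (pth Q′)) uq sb) len (adj-sym G rt) ⟩
        h + h                                             ∎
        where
        open ≤-Reasoning
        p₁ : Pth (Adj G) r c (xs ++ θ)
        p₁ = joinV (pth P) seg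
        zs⊆β : zs ⊆ β
        zs⊆β z∈ with sub Q′ (there z∈)
        ... | here refl = ⊥-elim (Unique-∉ (uniq Q′) z∈)
        ... | there z∈β = z∈β
        uq : Unique ((xs ++ θ) ++ zs)
        uq = Unique-++ (xs ++ θ) (Unique-++ xs (uniq P) (proj₁ parts′) (λ z∈ z∈θ → out (sub P z∈) (∈-++⁺ˡ z∈θ)))
               (Unique-tail (uniq Q′)) clash
          where
          clash : ∀ {z} → z ∈ xs ++ θ → z ∉ zs
          clash z∈ z∈zs with ∈-++⁻ xs z∈
          ... | inj₁ z∈xs = out (sub P z∈xs) (∈-++⁺ʳ θ (∈-++⁺ˡ (zs⊆β z∈zs)))
          ... | inj₂ z∈θ  = proj₂ (proj₂ parts′) z∈θ (∈-++⁺ˡ (zs⊆β z∈zs))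
        sb : (xs ++ θ) ++ zs ⊆ V
        sb z∈ with ∈-++⁻ (xs ++ θ) z∈
        ... | inj₂ z∈zs = V-right (∈-++⁺ʳ θ (∈-++⁺ˡ (zs⊆β z∈zs)))
        ... | inj₁ z∈′ with ∈-++⁻ xs z∈′
        ...   | inj₁ z∈xs = V-left (sub P z∈xs)
        ...   | inj₂ z∈θ  = V-right (∈-++⁺ˡ z∈θ)
        len : 3 ≤ length ((xs ++ θ) ++ zs)
        len = subst (3 ≤_) (sym (length-++ (xs ++ θ))) (+-mono-≤
          (≤-trans (2≤length (pth P) (λ { refl → Unique-∉ u′ (∈-++⁺ˡ r∈) })) (≤-trans (m≤m+n (length xs) (length θ)) (≤-reflexive (sym (length-++ xs)))))
          (s≤s⁻¹ (2≤length (pth Q′) (λ { refl → c∉β t∈ }))))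

      -- A vertex off the path inherits the way that its neighbour `r` has to `m`.
      absorb : ∀ {r t O₁ O₂} → O ≡ O₁ ++ t ∷ O₂ → r ∈ S → Adj G r t → State (t ∷ S) m θ (O₁ ++ O₂)
      absorb {r} {t} {O₁} {O₂} refl r∈ rt = record
        { perm = ↭-trans perm (prep m perm′)
        ; 1≤S  = s≤s z≤n
        ; seg  = seg
        ; left = λ { (here refl) → let xs , P , δ≤ = left r∈ in t ∷ xs
                       , mkPath (adj-sym G rt ∷ pth P) (All.tabulate (λ z∈ → λ { refl → out (sub P z∈) (∈-++⁺ʳ θ (∈-++⁺ʳ β (∈-++⁺ʳ O₁ (here refl)))) }) ∷ uniq P)
                           (λ { (here refl) → there (here refl) ; (there z∈) → weaken (sub P z∈) })
                       , ≤-trans δ≤ (≤-trans (m≤n+m _ (W t r)) (≤-reflexive (sym (pw-∷ W (pth P)))))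
                   ; (there z∈) → let xs , P , δ≤ = left z∈ in xs , Path-⊆ weaken P , δ≤ }
        }
        where
        weaken : m ∷ S ⊆ m ∷ t ∷ S
        weaken (here refl) = here refl
        weaken (there z∈)  = there (there z∈)
        perm′ : S ++ (θ ++ β ++ O₁ ++ t ∷ O₂) ↭ t ∷ S ++ (θ ++ β ++ O₁ ++ O₂)
        perm′ = ↭-trans (Perm.++⁺ˡ S (↭-trans (Perm.++⁺ˡ θ (↭-trans (Perm.++⁺ˡ β (Perm.shift t O₁ O₂)) (Perm.shift t β (O₁ ++ O₂)))) (Perm.shift t θ (β ++ O₁ ++ O₂))))
                  (Perm.shift t S (θ ++ β ++ O₁ ++ O₂))

      -- The edge rt bypasses m, so the vertices up to t can be reached from S in either direction.
      advance : ∀ {r t μ θ′} → θ ≡ μ ++ t ∷ θ′ → r ∈ S → Adj G r t → State (m ∷ μ ++ S) t θ′ O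
      advance {r} {t} {μ} {θ′} refl r∈ rt = record
        { perm = ↭-trans perm perm′
        ; 1≤S  = s≤s z≤n
        ; seg  = proj₂ halves
        ; left = reach
        }
        where
        open ≤-Reasoning
        halves = splitV (m ∷ μ) seg
        to-t : Pth (Adj G) m t (m ∷ μ ++ [ t ])
        to-t = proj₁ halves
        perm′ : m ∷ S ++ ((μ ++ t ∷ θ′) ++ β ++ O) ↭ t ∷ (m ∷ μ ++ S) ++ (θ′ ++ β ++ O)
        perm′ = ↭-trans (prep m (↭-trans (Perm.↭-reflexive (trans (cong (S ++_) (++-assoc μ (t ∷ θ′) (β ++ O))) (sym (++-assoc S μ (t ∷ θ′ ++ β ++ O)))))
                   (Perm.++⁺ʳ (t ∷ θ′ ++ β ++ O) (Perm.++-comm S μ)))) (Perm.shift t (m ∷ μ ++ S) (θ′ ++ β ++ O))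
        old : m ∷ S ⊆ t ∷ m ∷ μ ++ S
        old (here refl) = there (here refl)
        old (there z∈)  = there (there (∈-++⁺ʳ μ z∈))
        on-seg : m ∷ μ ++ [ t ] ⊆ t ∷ m ∷ μ ++ S
        on-seg (here refl) = there (here refl)
        on-seg (there z∈) with ∈-++⁻ μ z∈
        ... | inj₁ z∈μ         = there (there (∈-++⁺ˡ z∈μ))
        ... | inj₂ (here refl) = here refl
        μt⊆θ : μ ++ [ t ] ⊆ μ ++ t ∷ θ′
        μt⊆θ z∈ with ∈-++⁻ μ z∈
        ... | inj₁ z∈μ         = ∈-++⁺ˡ z∈μ
        ... | inj₂ (here refl) = ∈-++⁺ʳ μ (here refl)
        u-seg : Unique (m ∷ μ ++ [ t ])
        u-seg = All.tabulate (λ z∈ → λ { refl → out (here refl) (∈-++⁺ˡ (μt⊆θ z∈)) })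
              ∷ proj₁ (Unique-++⁻ (μ ++ [ t ]) (subst Unique (sym (++-assoc μ [ t ] θ′)) (proj₁ parts′)))
        forward : ∀ {z} → z ∈ S → ∃ λ xs → Path G (t ∷ m ∷ μ ++ S) z t xs × δ ≤ pw W xs
        forward z∈ with left z∈
        ... | xs , P , δ≤ = xs ++ (μ ++ [ t ])
          , mkPath (joinV (pth P) to-t) (Unique-++ xs (uniq P) (Unique-tail u-seg) (λ y∈ y∈′ → out (sub P y∈) (∈-++⁺ˡ (μt⊆θ y∈′)))) sb
          , ≤-trans δ≤ (≤-trans (m≤m+n _ _) (≤-reflexive (sym (pw-joinV W (pth P)))))
          where
          sb : xs ++ (μ ++ [ t ]) ⊆ t ∷ m ∷ μ ++ S
          sb y∈ with ∈-++⁻ xs y∈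
          ... | inj₁ p = old (sub P p)
          ... | inj₂ p = on-seg (there p)
        -- Back along the segment to `m`, through `S` to `r`, and over the edge rt; the middle part
        -- alone supplies the weight `δ`.
        backward : ∀ {z} → z ∈ m ∷ μ → ∃ λ xs → Path G (t ∷ m ∷ μ ++ S) z t xs × δ ≤ pw W xs
        backward {z} z∈ with ∈-∃++ z∈ | left r∈
        ... | σ₁ , σ₂ , eq | xs , P , δ≤ with reversed P
        ... | rs , P′ , eqw = (reverse (σ₁ ++ [ z ]) ++ rs) ++ [ t ]
          , mkPath (joinE p₁ rt one) (Unique-++ (reverse (σ₁ ++ [ z ]) ++ rs) u₁ ([] ∷ []) (λ { y∈ (here refl) → t-new y∈ })) sb
          , (begin
              δ                                                ≤⟨ δ≤ ⟩
              pw W xs                                          ≡⟨ eqw ⟨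
              pw W (m ∷ rs)                                    ≤⟨ m≤n+m _ _ ⟩
              pw W (reverse (σ₁ ++ [ z ])) + pw W (m ∷ rs)     ≡⟨ pw-joinV W back ⟨
              pw W (reverse (σ₁ ++ [ z ]) ++ rs)               ≤⟨ m≤m+n _ _ ⟩
              pw W (reverse (σ₁ ++ [ z ]) ++ rs) + (W r t + 0) ≡⟨ pw-joinE W p₁ (one {R = Adj G}) ⟨
              pw W ((reverse (σ₁ ++ [ z ]) ++ rs) ++ [ t ])    ∎)
          where
          whole : m ∷ μ ++ [ t ] ≡ σ₁ ++ z ∷ (σ₂ ++ [ t ])
          whole = trans (cong (_++ [ t ]) eq) (++-assoc σ₁ (z ∷ σ₂) [ t ])
          back : Pth (Adj G) z m (reverse (σ₁ ++ [ z ]))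
          back = Pth-reverse (adj-sym G) (proj₁ (splitV σ₁ (subst (Pth (Adj G) m t) whole to-t)))
          p₁ : Pth (Adj G) z r (reverse (σ₁ ++ [ z ]) ++ rs)
          p₁ = joinV back (pth P′)
          prefix : reverse (σ₁ ++ [ z ]) ⊆ m ∷ μ
          prefix y∈ with ∈-++⁻ σ₁ (Perm.∈-resp-↭ (Perm.↭-reverse (σ₁ ++ [ z ])) y∈)
          ... | inj₁ p           = subst (_ ∈_) (sym eq) (∈-++⁺ˡ p)
          ... | inj₂ (here refl) = z∈
          rs⊆S : rs ⊆ S
          rs⊆S y∈ with sub P′ (there y∈)
          ... | here refl = ⊥-elim (Unique-∉ (uniq P′) y∈)
          ... | there p   = p
          u₁ : Unique (reverse (σ₁ ++ [ z ]) ++ rs)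
          u₁ = Unique-++ (reverse (σ₁ ++ [ z ]))
                 (Unique-↭ (↭-sym (Perm.↭-reverse (σ₁ ++ [ z ]))) (proj₁ (Unique-++⁻ (σ₁ ++ [ z ])
                   (subst Unique (trans whole (sym (++-assoc σ₁ [ z ] (σ₂ ++ [ t ])))) u-seg))))
                 (Unique-tail (uniq P′)) clash
            where
            clash : ∀ {y} → y ∈ reverse (σ₁ ++ [ z ]) → y ∉ rs
            clash y∈ y∈′ with prefix y∈
            ... | here refl = Unique-∉ u′ (∈-++⁺ˡ (rs⊆S y∈′))
            ... | there p   = out (there (rs⊆S y∈′)) (∈-++⁺ˡ (∈-++⁺ˡ p))
          t-new : t ∉ reverse (σ₁ ++ [ z ]) ++ rs
          t-new t∈ with ∈-++⁻ (reverse (σ₁ ++ [ z ])) t∈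
          ... | inj₁ p = proj₂ (proj₂ (Unique-++⁻ (m ∷ μ) u-seg)) (prefix p) (here refl)
          ... | inj₂ p = out (there (rs⊆S p)) (∈-++⁺ˡ (∈-++⁺ʳ μ (here refl)))
          sb : (reverse (σ₁ ++ [ z ]) ++ rs) ++ [ t ] ⊆ t ∷ m ∷ μ ++ S
          sb y∈ with ∈-++⁻ (reverse (σ₁ ++ [ z ]) ++ rs) y∈
          ... | inj₂ (here refl) = here refl
          ... | inj₁ y∈′ with ∈-++⁻ (reverse (σ₁ ++ [ z ])) y∈′
          ...   | inj₁ p = there (∈-++⁺ˡ (prefix p))
          ...   | inj₂ p = there (∈-++⁺ʳ (m ∷ μ) (rs⊆S p))
        reach : ∀ {z} → z ∈ m ∷ μ ++ S → ∃ λ xs → Path G (t ∷ m ∷ μ ++ S) z t xs × δ ≤ pw W xs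
        reach z∈ with ∈-++⁻ (m ∷ μ) z∈
        ... | inj₁ p = backward p
        ... | inj₂ p = forward p

    -- Each round takes vertices out of `θ ++ β ++ O`, whose length `k` bounds. It stops when an
    -- edge from `S` hits `β`, giving the cycle of `finish`, or when edges leave `S` to `m` only;
    -- then `m` is a cut vertex, as `β` is not empty.
    grow : ∀ k {S m θ O} → length (θ ++ β ++ O) ≤ k → State S m θ O → δ + δ′ ≤ h + h ⊎ CutVertex G V
    grow k {S} {m} {θ} {O} le st with search (adj? G) S (θ ++ β ++ O)
    ... | inj₂ none = inj₂ (m , S , θ ++ β ++ O , State.perm st , State.1≤S st , nonempty , none)
      where
      nonempty : 1 ≤ length (θ ++ β ++ O)
      nonempty = subst (1 ≤_) (sym (trans (length-++ θ) (cong (length θ +_) (length-++ β))))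
        (≤-trans 1≤β (≤-trans (m≤m+n (length β) (length O)) (m≤n+m _ (length θ))))
    ... | inj₁ (r , t , r∈ , t∈ , rt) with ∈-++⁻ θ t∈
    ... | inj₂ t∈′ with ∈-++⁻ β t∈′
    ...   | inj₁ t∈β = inj₁ (finish st r∈ t∈β rt)
    ...   | inj₂ t∈O with ∈-∃++ t∈O
    grow zero {θ = θ} le st | inj₁ _ | inj₂ t∈′ | inj₂ t∈O | O₁ , O₂ , refl with () ← ≤-trans (∈⇒1≤ (∈-++⁺ʳ θ t∈′)) le
    grow (suc k) {θ = θ} le st | inj₁ (r , t , r∈ , t∈ , rt) | inj₂ t∈′ | inj₂ t∈O | O₁ , O₂ , refl =
      grow k (s≤s⁻¹ (subst (_≤ suc k) (Perm.↭-length (↭-trans (Perm.++⁺ˡ θ (↭-trans (Perm.++⁺ˡ β (Perm.shift t O₁ O₂)) (Perm.shift t β (O₁ ++ O₂)))) (Perm.shift t θ (β ++ O₁ ++ O₂)))) le))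
        (absorb st refl r∈ rt)
    grow k {θ = θ} {O} le st | inj₁ (r , t , r∈ , t∈ , rt) | inj₁ t∈θ with ∈-∃++ t∈θ
    grow zero le st | inj₁ _ | inj₁ _ | [] , θ′ , refl with () ← le
    grow zero le st | inj₁ _ | inj₁ _ | _ ∷ _ , θ′ , refl with () ← le
    grow (suc k) {O = O} le st | inj₁ (r , t , r∈ , t∈ , rt) | inj₁ _ | μ , θ′ , refl =
      grow k (s≤s⁻¹ (≤-trans (≤-trans (s≤s shorter) (≤-reflexive (sym (Perm.↭-length perm″)))) le)) (advance st refl r∈ rt)
      where
      perm″ : (μ ++ t ∷ θ′) ++ β ++ O ↭ t ∷ μ ++ (θ′ ++ β ++ O)
      perm″ = ↭-trans (Perm.↭-reflexive (++-assoc μ (t ∷ θ′) (β ++ O))) (Perm.shift t μ (θ′ ++ β ++ O))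
      shorter : length (θ′ ++ β ++ O) ≤ length (μ ++ (θ′ ++ β ++ O))
      shorter = ≤-trans (m≤n+m _ (length μ)) (≤-reflexive (sym (length-++ μ)))

-- Degrees at the ends of a heaviest path

reverse-∷∷ : ∀ {A : Set} (ps : List A) {s qs} → reverse (ps ++ s ∷ qs) ≡ reverse qs ++ s ∷ reverse ps
reverse-∷∷ ps {s} {qs} = trans (reverse-++ ps (s ∷ qs)) (trans (cong (_++ reverse ps) (unfold-reverse s qs)) (++-assoc (reverse qs) [ s ] (reverse ps)))

module HeavyPath {A : Set} (_≟_ : ∀ (u v : A) → Dec (u ≡ v)) (h : ℕ) where

  open WGraph
  open Splitting _≟_ h
  open Growth _≟_ h

  module _ (G : WGraph {A}) {V} (uV : Unique V) (good : Good G V) where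

    private
      W : A → A → ℕ
      W = w G

      deg : A → ℕ
      deg u = ∑ (W u) V

    record Heaviest (u u′ : A) (us : List A) : Set where
      field
        path : Path G V u u′ us
        max  : ∀ {a b xs} → Path G V a b xs → pw W xs ≤ pw W us
        big  : h + h < pw W us

    open Heaviest

    Heaviest-reverse : ∀ {u u′ us} → Heaviest u u′ us → Heaviest u′ u (reverse us)
    Heaviest-reverse {us = us} H = record
      { path = Path-reverse (path H)
      ; max  = λ P → ≤-trans (max H P) (≤-reflexive (sym (pw-reverse W (w-sym G) us)))
      ; big  = subst (h + h <_) (sym (pw-reverse W (w-sym G) us)) (big H)
      }

    -- Adjacent ends would close the path to a cycle heavier than 2h. A path of one edge does not
    -- close this way, but its edge is heavy, hence on a cycle, and already exceeds 2h by itself.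
    nonadjacent-ends : ∀ {u u′ us} → Path G V u u′ us → h + h < pw W us → ¬ Adj G u′ u
    nonadjacent-ends (mkPath one _ _) ()
    nonadjacent-ends {u} {u′} (mkPath (r ∷ one) _ s) h< u′u
      with hvy good (s (here refl)) (s (there (here refl))) (≤-<-trans (m≤m+n h h) (subst (h + h <_) (+-identityʳ (W u u′)) h<))
    ... | xs , P , 3≤ = <⇒≱ h< (≤-trans (≤-reflexive (trans (+-identityʳ (W u u′)) (w-sym G u u′))) (≤-trans (m≤n+m _ (pw W xs)) (cyc good P 3≤ u′u)))
    nonadjacent-ends P@(mkPath (r ∷ s ∷ q) _ _) h< u′u =
      <⇒≱ h< (≤-trans (m≤m+n _ _) (cyc good P (s≤s (s≤s (∈⇒1≤ (first∈ q)))) u′u))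

    distinct-ends : ∀ {u u′ us} → Path G V u u′ us → h + h < pw W us → u ≢ u′
    distinct-ends (mkPath one _ _) ()
    distinct-ends (mkPath (_ ∷ p) u _) _ refl = Unique-∉ u (last∈ p)

    module _ {u u′ us} (H : Heaviest u u′ us) where

      private
        p = pth (path H)

      -- By maximality, putting a neighbour of `u` in front of the path gains nothing, so edges from
      -- `u` to vertices off the path weigh 0.
      deg-path : deg u ≤ ∑ (W u) us
      deg-path = ∑-⊆ (W u) V us uV far
        where
        far : ∀ {v} → v ∈ V → W u v ≡ 0 ⊎ v ∈ us
        far {v} v∈ with Any.any? (v ≟_) us | adj? G v u
        ... | yes v∈us | _      = inj₂ v∈us
        ... | no _     | no ¬vu = inj₁ (w-off G (¬vu ∘ adj-sym G))
        ... | no v∉us  | yes vu = inj₁ (trans (w-sym G u v) (n≤0⇒n≡0 (+-cancelʳ-≤ (pw W us) (W v u) 0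
          (≤-trans (≤-reflexive (sym (pw-∷ W p)))
            (max H (mkPath (vu ∷ p) (All.tabulate (λ z∈ → λ { refl → v∉us z∈ }) ∷ uniq (path H))
              (λ { (here refl) → v∈ ; (there z∈) → sub (path H) z∈ })))))))

      -- Pósa rotation: with the part up to `s` turned round, the edge ut takes the place of st, and
      -- the new path is no heavier.
      rotation : ∀ ps {s t qs} → us ≡ ps ++ s ∷ t ∷ qs → W u t ≤ W s t
      rotation ps {s} {t} {qs} refl with adj? G u t | splitE ps p
      ... | no ¬ut | _ = subst (_≤ W s t) (sym (w-off G ¬ut)) z≤n
      ... | yes ut | p₁ , _ , p₂ = +-cancelʳ-≤ (pw W (t ∷ qs)) _ _ (+-cancelˡ-≤ (pw W (ps ++ [ s ])) _ _ (begin
        pw W (ps ++ [ s ]) + (W u t + pw W (t ∷ qs))            ≡⟨ cong (_+ (W u t + pw W (t ∷ qs))) (pw-reverse W (w-sym G) (ps ++ [ s ])) ⟨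
        pw W (reverse (ps ++ [ s ])) + (W u t + pw W (t ∷ qs))  ≡⟨ pw-joinE W r₁ p₂ ⟨
        pw W (reverse (ps ++ [ s ]) ++ t ∷ qs)                  ≤⟨ max H (mkPath (joinE r₁ ut p₂) (Unique-↭ perm (uniq (path H))) (sub (path H) ∘ Perm.∈-resp-↭ (↭-sym perm))) ⟩
        pw W (ps ++ s ∷ t ∷ qs)                                 ≡⟨ pw-split W ps ⟩
        pw W (ps ++ [ s ]) + (W s t + pw W (t ∷ qs))            ∎))
        where
        open ≤-Reasoning
        r₁ = Pth-reverse (adj-sym G) p₁
        perm : ps ++ s ∷ t ∷ qs ↭ reverse (ps ++ [ s ]) ++ t ∷ qs
        perm = ↭-trans (Perm.↭-reflexive (sym (++-assoc ps [ s ] (t ∷ qs)))) (Perm.++⁺ʳ (t ∷ qs) (↭-sym (Perm.↭-reverse (ps ++ [ s ]))))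

      -- From `u` along the path to `s`, over to `u′`, back along the path to `t` and home to `u`.
      crossing-cycle : ∀ ps s μ t qs → us ≡ ps ++ s ∷ μ ++ t ∷ qs → Adj G u′ s → Adj G u t →
        pw W (ps ++ [ s ]) + (W u′ s + pw W (t ∷ qs)) + W u t ≤ h + h
      crossing-cycle ps s μ t qs refl u′s ut = begin
        pw W (ps ++ [ s ]) + (W u′ s + pw W (t ∷ qs)) + W u t
          ≡⟨ cong₂ (λ i j → pw W (ps ++ [ s ]) + i + j) (cong₂ _+_ (w-sym G u′ s) (sym (pw-reverse W (w-sym G) (t ∷ qs)))) (w-sym G u t) ⟩
        pw W (ps ++ [ s ]) + (W s u′ + pw W (reverse (t ∷ qs))) + W t u
          ≡⟨ cong (_+ W t u) (pw-joinE W p₁ r₂) ⟨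
        pw W ((ps ++ [ s ]) ++ reverse (t ∷ qs)) + W t u
          ≤⟨ cyc good (mkPath (joinE p₁ (adj-sym G u′s) r₂) uq sb) (len ps refl) (adj-sym G ut) ⟩
        h + h ∎
        where
        open ≤-Reasoning
        p₁ = proj₁ (splitV ps p)
        p₂ : Pth (Adj G) t u′ (t ∷ qs)
        p₂ = proj₂ (splitV (ps ++ s ∷ μ) (subst (Pth (Adj G) u u′) (sym (++-assoc ps (s ∷ μ) (t ∷ qs))) p))
        r₂ = Pth-reverse (adj-sym G) p₂
        inside : (ps ++ [ s ]) ++ reverse (t ∷ qs) ⊆ ps ++ s ∷ μ ++ t ∷ qs
        inside z∈ with ∈-++⁻ (ps ++ [ s ]) z∈
        ... | inj₂ q = ∈-++⁺ʳ ps (there (∈-++⁺ʳ μ (Perm.∈-resp-↭ (Perm.↭-reverse (t ∷ qs)) q)))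
        ... | inj₁ q with ∈-++⁻ ps q
        ...   | inj₁ q′          = ∈-++⁺ˡ q′
        ...   | inj₂ (here refl) = ∈-++⁺ʳ ps (here refl)
        sb : (ps ++ [ s ]) ++ reverse (t ∷ qs) ⊆ V
        sb z∈ = sub (path H) (inside z∈)
        parts = Unique-++⁻ (ps ++ [ s ]) (subst Unique (sym (++-assoc ps [ s ] (μ ++ t ∷ qs))) (uniq (path H)))
        uq : Unique ((ps ++ [ s ]) ++ reverse (t ∷ qs))
        uq = Unique-++ (ps ++ [ s ]) (proj₁ parts)
          (Unique-↭ (↭-sym (Perm.↭-reverse (t ∷ qs))) (proj₁ (proj₂ (Unique-++⁻ μ (proj₁ (proj₂ parts))))))
          (λ z∈ z∈′ → proj₂ (proj₂ parts) z∈ (∈-++⁺ʳ μ (Perm.∈-resp-↭ (Perm.↭-reverse (t ∷ qs)) z∈′)))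
        len : ∀ ps′ → ps ≡ ps′ → 3 ≤ length ((ps ++ [ s ]) ++ reverse (t ∷ qs))
        -- With `ps` empty, `s` would be `u`, and the ends of the path would be adjacent.
        len [] refl with refl ← head≡ p = ⊥-elim (nonadjacent-ends (path H) (big H) u′s)
        len (x ∷ ps′) refl = s≤s (subst (2 ≤_) (sym (length-++ (ps′ ++ [ s ])))
          (+-mono-≤ (∈⇒1≤ (∈-++⁺ʳ ps′ (here refl))) (∈⇒1≤ (Perm.∈-resp-↭ (↭-sym (Perm.↭-reverse (t ∷ qs))) (here refl)))))

      -- If both edges are present, they close the path without st into a cycle, which is lighter than the path.
      bypass : ∀ ps {s t qs} → us ≡ ps ++ s ∷ t ∷ qs → (∀ {s t} ps {qs} → reverse us ≡ ps ++ t ∷ s ∷ qs → W u′ s ≤ W t s) → W u t + W u′ s ≤ W s t + 0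
      bypass ps {s} {t} {qs} eq rot′ with adj? G u t | adj? G u′ s
      -- A missing edge weighs 0, so a rotation that bounds the other one suffices.
      ... | no ¬ut | _ = subst (λ i → i + W u′ s ≤ W s t + 0) (sym (w-off G ¬ut)) (≤-trans
        (rot′ (reverse qs) (trans (cong reverse eq) (trans (cong reverse (sym (++-assoc ps [ s ] (t ∷ qs)))) (trans (reverse-∷∷ (ps ++ [ s ])) (cong (λ l → reverse qs ++ t ∷ l) (reverse-++ ps [ s ]))))))
        (≤-reflexive (trans (w-sym G t s) (sym (+-identityʳ (W s t))))))
      ... | yes _ | no ¬u′s = subst₂ _≤_ (trans (sym (+-identityʳ (W u t))) (cong (W u t +_) (sym (w-off G ¬u′s)))) (sym (+-identityʳ (W s t))) (rotation ps eq)
      ... | yes ut | yes u′s = +-cancelˡ-≤ (pw W (ps ++ [ s ]) + pw W (t ∷ qs)) _ _ (begin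
        pw W (ps ++ [ s ]) + pw W (t ∷ qs) + (W u t + W u′ s)       ≡⟨ lemma₁ (pw W (ps ++ [ s ])) (pw W (t ∷ qs)) (W u t) (W u′ s) ⟩
        pw W (ps ++ [ s ]) + (W u′ s + pw W (t ∷ qs)) + W u t       ≤⟨ crossing-cycle ps s [] t qs eq u′s ut ⟩
        h + h                                                       ≤⟨ <⇒≤ (big H) ⟩
        pw W us                                                     ≡⟨ trans (cong (pw W) eq) (pw-split W ps) ⟩
        pw W (ps ++ [ s ]) + (W s t + pw W (t ∷ qs))                ≡⟨ lemma₂ (pw W (ps ++ [ s ])) (W s t) (pw W (t ∷ qs)) ⟩
        pw W (ps ++ [ s ]) + pw W (t ∷ qs) + (W s t + 0)            ∎)
        where
        open ≤-Reasoning
        lemma₁ : ∀ p q r s → p + q + (r + s) ≡ p + (s + q) + r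
        lemma₁ = solve-∀
        lemma₂ : ∀ p q r → p + (q + r) ≡ p + r + (q + 0)
        lemma₂ = solve-∀

      -- Go from `z` back to `u`, over to `b`, the first neighbour of `u` behind `z`, and on to `m`.
      -- By `rotation`, an edge from `u` to another vertex on this route weighs at most the path
      -- edge entering that vertex, and ub is part of the route. The vertices skipped between `z`
      -- and `b` and those behind `m` are not neighbours of `u`.
      approach : ∀ ρ m τ → us ≡ ρ ++ m ∷ τ → Adj G u m → None (Adj G u) τ → ∀ {z} → z ∈ ρ →
        ∃ λ xs → Path G (m ∷ ρ) z m xs × deg u ≤ pw W xs
      approach ρ m τ refl um none {z} z∈ with ∈-∃++ z∈
      ... | ρ₁ , ρ₂ , refl with first-such (adj? G u) (ρ₂ ++ [ m ])
      ... | inj₂ n = ⊥-elim (n (∈-++⁺ʳ ρ₂ (here refl)) um)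
      ... | inj₁ (μ , b , ν , eq , ub , n) = reverse (ρ₁ ++ [ z ]) ++ b ∷ ν
        , mkPath (joinE r₁ ub p₂) uq sb
        , (begin
          deg u                                                     ≤⟨ deg-path ⟩
          ∑ (W u) ((ρ₁ ++ z ∷ ρ₂) ++ m ∷ τ)                         ≡⟨ cong (∑ (W u)) whole ⟩
          ∑ (W u) ((ρ₁ ++ [ z ]) ++ μ ++ (b ∷ ν) ++ τ)              ≡⟨ trans (∑-++ (W u) (ρ₁ ++ [ z ])) (cong (∑ (W u) (ρ₁ ++ [ z ]) +_) (trans (∑-++ (W u) μ) (cong (∑ (W u) μ +_) (∑-++ (W u) (b ∷ ν))))) ⟩
          ∑ (W u) (ρ₁ ++ [ z ]) + (∑ (W u) μ + (∑ (W u) (b ∷ ν) + ∑ (W u) τ))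
            ≡⟨ cong₂ (λ i j → ∑ (W u) (ρ₁ ++ [ z ]) + (i + (∑ (W u) (b ∷ ν) + j))) (∑-zero μ (λ y∈ → w-off G (n y∈))) (∑-zero τ (λ y∈ → w-off G (none y∈))) ⟩
          ∑ (W u) (ρ₁ ++ [ z ]) + (∑ (W u) (b ∷ ν) + 0)             ≡⟨ cong (∑ (W u) (ρ₁ ++ [ z ]) +_) (+-identityʳ _) ⟩
          ∑ (W u) (ρ₁ ++ [ z ]) + (W u b + ∑ (W u) ν)               ≤⟨ +-mono-≤ first (+-monoʳ-≤ (W u b) (∑-linkedˡ l₂)) ⟩
          pw W (ρ₁ ++ [ z ]) + (W u b + pw W (b ∷ ν))               ≡⟨ cong (_+ (W u b + pw W (b ∷ ν))) (pw-reverse W (w-sym G) (ρ₁ ++ [ z ])) ⟨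
          pw W (reverse (ρ₁ ++ [ z ])) + (W u b + pw W (b ∷ ν))     ≡⟨ pw-joinE W r₁ p₂ ⟨
          pw W (reverse (ρ₁ ++ [ z ]) ++ b ∷ ν)                     ∎)
        where
        open ≤-Reasoning
        to-m : (ρ₁ ++ z ∷ ρ₂) ++ [ m ] ≡ (ρ₁ ++ [ z ]) ++ μ ++ b ∷ ν
        to-m = trans (++-assoc ρ₁ (z ∷ ρ₂) [ m ]) (trans (cong (λ l → ρ₁ ++ z ∷ l) eq) (sym (++-assoc ρ₁ [ z ] (μ ++ b ∷ ν))))
        whole : (ρ₁ ++ z ∷ ρ₂) ++ m ∷ τ ≡ (ρ₁ ++ [ z ]) ++ μ ++ (b ∷ ν) ++ τ
        whole = trans (sym (++-assoc (ρ₁ ++ z ∷ ρ₂) [ m ] τ)) (trans (cong (_++ τ) to-m)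
          (trans (++-assoc (ρ₁ ++ [ z ]) (μ ++ b ∷ ν) τ) (cong ((ρ₁ ++ [ z ]) ++_) (++-assoc μ (b ∷ ν) τ))))
        pm : Pth (Adj G) u m (ρ₁ ++ z ∷ (μ ++ b ∷ ν))
        pm = subst (Pth (Adj G) u m) (trans to-m (++-assoc ρ₁ [ z ] (μ ++ b ∷ ν))) (proj₁ (splitV (ρ₁ ++ z ∷ ρ₂) p))
        p₁ = proj₁ (splitV ρ₁ pm)
        r₁ = Pth-reverse (adj-sym G) p₁
        p₂ : Pth (Adj G) b m (b ∷ ν)
        p₂ = proj₂ (splitV (z ∷ μ) (proj₂ (splitV ρ₁ pm)))
        links : Linked (λ s t → W u t ≤ W s t) ((ρ₁ ++ [ z ]) ++ μ ++ (b ∷ ν) ++ τ)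
        links = subst (Linked _) whole (Linked-tabulate _ rotation)
        l₁ = proj₁ (Linked-++⁻ (ρ₁ ++ [ z ]) links)
        l₂ = proj₁ (Linked-++⁻ (b ∷ ν) (proj₂ (Linked-++⁻ μ (proj₂ (Linked-++⁻ (ρ₁ ++ [ z ]) links)))))
        first : ∑ (W u) (ρ₁ ++ [ z ]) ≤ pw W (ρ₁ ++ [ z ])
        first with Pth-∷ p₁
        ... | zs , e = subst (λ l → ∑ (W u) l ≤ pw W l) (sym e) (≤-trans (≤-reflexive (cong (_+ ∑ (W u) zs) (w-loop G u)))
                         (∑-linkedˡ (subst (Linked _) e l₁)))
        parts = Unique-++⁻ (ρ₁ ++ [ z ]) (subst Unique whole (uniq (path H)))
        uq : Unique (reverse (ρ₁ ++ [ z ]) ++ b ∷ ν)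
        uq = Unique-++ (reverse (ρ₁ ++ [ z ])) (Unique-↭ (↭-sym (Perm.↭-reverse (ρ₁ ++ [ z ]))) (proj₁ parts))
          (proj₁ (Unique-++⁻ (b ∷ ν) (proj₁ (proj₂ (Unique-++⁻ μ (proj₁ (proj₂ parts)))))))
          (λ y∈ y∈′ → proj₂ (proj₂ parts) (Perm.∈-resp-↭ (Perm.↭-reverse (ρ₁ ++ [ z ])) y∈) (∈-++⁺ʳ μ (∈-++⁺ˡ y∈′)))
        sb : reverse (ρ₁ ++ [ z ]) ++ b ∷ ν ⊆ m ∷ ρ₁ ++ z ∷ ρ₂
        sb {y} y∈ = Perm.∈-resp-↭ (Perm.++-comm (ρ₁ ++ z ∷ ρ₂) [ m ]) (subst (y ∈_) (sym to-m) (inner (∈-++⁻ (reverse (ρ₁ ++ [ z ])) y∈)))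
          where
          inner : y ∈ reverse (ρ₁ ++ [ z ]) ⊎ y ∈ b ∷ ν → y ∈ (ρ₁ ++ [ z ]) ++ μ ++ b ∷ ν
          inner (inj₁ q) = ∈-++⁺ˡ (Perm.∈-resp-↭ (Perm.↭-reverse (ρ₁ ++ [ z ])) q)
          inner (inj₂ q) = ∈-++⁺ʳ (ρ₁ ++ [ z ]) (∈-++⁺ʳ μ q)

    -- `∑-linked` with constant term 0; `f a` appears because the sum of `f` now includes the first
    -- vertex.
    segment : ∀ {f g : A → ℕ} {a b xs} → Linked (λ s t → f t + g s ≤ W s t + 0) xs → Pth (Adj G) a b xs →
      ∑ f xs + ∑ g xs ≤ f a + pw W xs + g b
    segment {f} {g} {a} {b} l p with Pth-∷ p
    ... | ys , refl = begin
      f a + ∑ f ys + ∑ g (a ∷ ys)                        ≡⟨ +-assoc (f a) _ _ ⟩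
      f a + (∑ f ys + ∑ g (a ∷ ys))                      ≤⟨ +-monoʳ-≤ (f a) (∑-linked l p) ⟩
      f a + (pw W (a ∷ ys) + g b + length ys * 0)        ≡⟨ lemma (f a) (pw W (a ∷ ys)) (g b) (length ys) ⟩
      f a + pw W (a ∷ ys) + g b                          ∎
      where
      open ≤-Reasoning
      lemma : ∀ p q r k → p + (q + r + k * 0) ≡ p + q + r
      lemma = solve-∀

    module _ {u u′ us} (H : Heaviest u u′ us) where

      private
        p  = pth (path H)
        H′ = Heaviest-reverse H

      deg-path′ : deg u′ ≤ ∑ (W u′) us
      deg-path′ = ≤-trans (deg-path H′) (≤-reflexive (∑-↭ (W u′) (Perm.↭-reverse us)))

      -- By `bypass`, each step of the two parts outside `μ` pays for `W u` at its right end and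
      -- `W u′` at its left end. The terms `W u′ s` and `W u t` left over at the gap are the chords
      -- of `crossing-cycle`.
      crossing-degrees : ∀ ps s μ t qs → us ≡ ps ++ s ∷ μ ++ t ∷ qs → Adj G u′ s → Adj G u t → None (Adj G u′) μ → None (Adj G u) μ →
        deg u + deg u′ ≤ h + h
      crossing-degrees ps s μ t qs eq u′s ut n′ n = begin
        deg u + deg u′
          ≤⟨ +-mono-≤ (deg-path H) deg-path′ ⟩
        ∑ (W u) us + ∑ (W u′) us
          ≡⟨ cong₂ _+_ (expand (W u) (λ y∈ → w-off G (n y∈))) (expand (W u′) (λ y∈ → w-off G (n′ y∈))) ⟩
        (∑ (W u) (ps ++ [ s ]) + ∑ (W u) (t ∷ qs)) + (∑ (W u′) (ps ++ [ s ]) + ∑ (W u′) (t ∷ qs))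
          ≡⟨ lemma₁ (∑ (W u) (ps ++ [ s ])) (∑ (W u) (t ∷ qs)) (∑ (W u′) (ps ++ [ s ])) (∑ (W u′) (t ∷ qs)) ⟩
        (∑ (W u) (ps ++ [ s ]) + ∑ (W u′) (ps ++ [ s ])) + (∑ (W u) (t ∷ qs) + ∑ (W u′) (t ∷ qs))
          ≤⟨ +-mono-≤ (segment {W u} {W u′} l₁ p₁) (segment {W u} {W u′} l₂ p₂) ⟩
        (W u u + pw W (ps ++ [ s ]) + W u′ s) + (W u t + pw W (t ∷ qs) + W u′ u′)
          ≡⟨ cong₂ (λ i j → (i + pw W (ps ++ [ s ]) + W u′ s) + (W u t + pw W (t ∷ qs) + j)) (w-loop G u) (w-loop G u′) ⟩
        (pw W (ps ++ [ s ]) + W u′ s) + (W u t + pw W (t ∷ qs) + 0)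
          ≡⟨ lemma₂ (pw W (ps ++ [ s ])) (W u′ s) (W u t) (pw W (t ∷ qs)) ⟩
        pw W (ps ++ [ s ]) + (W u′ s + pw W (t ∷ qs)) + W u t
          ≤⟨ crossing-cycle H ps s μ t qs eq u′s ut ⟩
        h + h ∎
        where
        open ≤-Reasoning
        lemma₁ : ∀ a b c d → (a + b) + (c + d) ≡ (a + c) + (b + d)
        lemma₁ = solve-∀
        lemma₂ : ∀ a b c d → (a + b) + (c + d + 0) ≡ a + (b + d) + c
        lemma₂ = solve-∀
        eq′ : us ≡ (ps ++ [ s ]) ++ μ ++ t ∷ qs
        eq′ = trans eq (sym (++-assoc ps [ s ] (μ ++ t ∷ qs)))
        expand : ∀ f → (∀ {y} → y ∈ μ → f y ≡ 0) → ∑ f us ≡ ∑ f (ps ++ [ s ]) + ∑ f (t ∷ qs)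
        expand f z = trans (cong (∑ f) eq′) (trans (∑-++ f (ps ++ [ s ])) (cong (∑ f (ps ++ [ s ]) +_) (trans (∑-++ f μ) (cong (_+ ∑ f (t ∷ qs)) (∑-zero μ z)))))
        links : Linked (λ s t → W u t + W u′ s ≤ W s t + 0) ((ps ++ [ s ]) ++ μ ++ t ∷ qs)
        links = subst (Linked _) eq′ (Linked-tabulate us (λ ps e → bypass H ps e (λ ps e → rotation H′ ps e)))
        l₁ = proj₁ (Linked-++⁻ (ps ++ [ s ]) links)
        l₂ = proj₂ (Linked-++⁻ μ (proj₂ (Linked-++⁻ (ps ++ [ s ]) links)))
        p₁ = proj₁ (splitV ps (subst (Pth (Adj G) u u′) eq p))
        p₂ : Pth (Adj G) t u′ (t ∷ qs)
        p₂ = proj₂ (splitV (s ∷ μ) (proj₂ (splitV ps (subst (Pth (Adj G) u u′) eq p))))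

      -- On the path, neighbours of `u` occur only up to `c` and those of `u′` only from `c` on.
      -- With `m` the last neighbour of `u`, `approach` from both ends supplies what `grow` asks
      -- for: the vertices before `m` are the first region, and the two degrees are `δ` and `δ′`.
      nested-degrees : ∀ α c β → us ≡ α ++ c ∷ β → Adj G u′ c → None (Adj G u′) α → None (Adj G u) β →
        deg u + deg u′ ≤ h + h ⊎ CutVertex G V
      nested-degrees α c β refl u′c n′ n with last-such (adj? G u) (α ++ [ c ])
      ... | inj₂ none = let z , z∈ , uz = first-step (proj₁ (splitV α p)) (λ { refl → nonadjacent-ends (path H) (big H) u′c })
                        in ⊥-elim (none z∈ uz)
      ... | inj₁ (ρ , m , σ , eq , um , nσ) with extract (uniq (path H)) (sub (path H))
      ... | O , permO = grow G uV good (1≤β β refl) right _ ≤-refl (record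
          { perm = ↭-trans permO (↭-trans (Perm.↭-reflexive (cong (_++ O) whole)) (↭-trans (Perm.↭-reflexive (++-assoc ρ (m ∷ σ ++ β) O))
                     (↭-trans (Perm.shift m ρ ((σ ++ β) ++ O)) (prep m (Perm.++⁺ˡ ρ (Perm.↭-reflexive (++-assoc σ β O)))))))
          ; 1≤S  = 1≤ρ ρ eq
          ; seg  = proj₂ (splitV ρ (subst (Pth (Adj G) u c) eq (proj₁ (splitV α p))))
          ; left = approach H ρ m (σ ++ β) whole um (None-++ σ nσ n)
          })
        where
        whole : α ++ c ∷ β ≡ ρ ++ m ∷ (σ ++ β)
        whole = trans (sym (++-assoc α [ c ] β)) (trans (cong (_++ β) eq) (++-assoc ρ (m ∷ σ) β))
        right : ∀ {t} → t ∈ β → ∃ λ ys → Path G (c ∷ β) t c ys × deg u′ ≤ pw W ys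
        right t∈ with approach H′ (reverse β) c (reverse α) (reverse-∷∷ α) u′c (λ z∈ → n′ (Perm.∈-resp-↭ (Perm.↭-reverse α) z∈)) (Perm.∈-resp-↭ (↭-sym (Perm.↭-reverse β)) t∈)
        ... | ys , P , le = ys , Path-⊆ (λ { (here refl) → here refl ; (there z∈) → there (Perm.∈-resp-↭ (Perm.↭-reverse β) z∈) }) P , le
        1≤β : ∀ β′ → β ≡ β′ → 1 ≤ length β
        1≤β [] refl with last∈ (proj₂ (splitV α p))
        ... | here refl = ⊥-elim (adj-irr G u′c)
        1≤β (_ ∷ _) refl = s≤s z≤n
        1≤ρ : ∀ ρ → α ++ [ c ] ≡ ρ ++ m ∷ σ → 1 ≤ length ρ
        1≤ρ [] e with refl ← head≡ (subst (Pth (Adj G) u c) e (proj₁ (splitV α p))) = ⊥-elim (adj-irr G um)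
        1≤ρ (_ ∷ _) _ = s≤s z≤n

      degrees : deg u + deg u′ ≤ h + h ⊎ CutVertex G V
      degrees with crossing (adj? G u′) (adj? G u) us
      ... | inj₁ (ps , s , μ , t , qs , eq , u′s , ut , n′ , n) = inj₁ (crossing-degrees ps s μ t qs eq u′s ut n′ n)
      ... | inj₂ (inj₂ (α , c , β , eq , u′c , n′ , n)) = nested-degrees α c β eq u′c n′ n
      ... | inj₂ (inj₁ none) = let z , z∈ , zu′ = penultimate p (distinct-ends (path H) (big H)) in ⊥-elim (none z∈ (adj-sym G zu′))

-- The induction on the number of vertices

Pth-ends : ∀ {A : Set} {R Q : A → A → Set} {a b a′ b′ xs} → Pth R a b xs → Pth Q a′ b′ xs → a ≡ a′ × b ≡ b′
Pth-ends one     one     = refl , refl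
Pth-ends (_ ∷ p) (_ ∷ q) = refl , proj₂ (Pth-ends p q)

module Theorem {A : Set} (_≟_ : ∀ (u v : A) → Dec (u ≡ v)) (h : ℕ)
  (enum : List (List A)) (enum-complete : ∀ {xs} → Unique xs → xs ∈ enum) where

  open WGraph
  open Splitting _≟_ h
  open Reduction _≟_ h
  open Growth _≟_ h
  open HeavyPath _≟_ h
  open Complete _≟_ h enum enum-complete
  open import Data.List.Relation.Unary.Unique.DecPropositional _≟_ using (unique?)

  HeaviestPath : WGraph {A} → List A → Set
  HeaviestPath G V = ∃₂ λ a b → ∃ λ xs → Path G V a b xs × (∀ {a b ys} → Path G V a b ys → pw (w G) ys ≤ pw (w G) xs)

  heaviest-path : ∀ G {V v} → v ∈ V → HeaviestPath G V
  heaviest-path G {V} {v} v∈ = extend (argmax (pw (w G)) path? enum (enum-complete {v ∷ []} ([] ∷ [])) ([] ∷ [] , v∈ ∷ [] , v , v , one))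
    where
    IsPath : List A → Set
    IsPath xs = Unique xs × All (_∈ V) xs × ∃₂ λ a b → Pth (Adj G) a b xs
    linked? : ∀ xs → Dec (∃₂ λ a b → Pth (Adj G) a b xs)
    linked? [] = no λ ()
    linked? (x ∷ xs) with Pth-any x xs
    ... | b , p with pth? _≟_ (adj? G) x b (x ∷ xs)
    ... | yes q = yes (x , b , q)
    ... | no ¬q = no λ (a′ , b′ , q) → ¬q (subst₂ (λ a b → Pth (Adj G) a b (x ∷ xs)) (proj₁ (Pth-ends q p)) (proj₂ (Pth-ends q p)) q)
    path? : Decidable IsPath
    path? xs = unique? xs ×-dec All.all? (λ x → Any.any? (x ≟_) V) xs ×-dec linked? xs
    extend : (∃ λ xs → IsPath xs × (∀ {ys} → ys ∈ enum → IsPath ys → pw (w G) ys ≤ pw (w G) xs)) → HeaviestPath G V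
    extend (xs , (u , s , a , b , p) , best) = a , b , xs , mkPath p u (λ z∈ → All.lookup s z∈)
      , λ P → best (enum-complete (uniq P)) (uniq P , All.tabulate (sub P) , _ , _ , pth P)

  SameWeights : WGraph {A} → WGraph {A} → Set
  SameWeights G G′ = ∀ u v → w G′ u v ≡ w G u v

  Saturated : WGraph {A} → List A → List (A × A) → Set₁
  Saturated G V L =
    (∃ λ G′ → SameWeights G G′ × Good G′ V × (∀ {a b} → (a , b) ∈ L → a ≢ b → Adj G′ a b)) ⊎
    (∃ λ G′ → SameWeights G G′ × Good G′ V × ∃ λ (P : HeaviestPath G′ V) → h + h < pw (w G′) (proj₁ (proj₂ (proj₂ P))))

  -- A weightless edge between nonadjacent `a` and `b` creates cycles as heavy as the paths from `a`
  -- to `b`. These stay within 2h unless some path is heavier, and then the second alternative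
  -- holds.
  saturate : ∀ {G V v} → v ∈ V → Good G V → ∀ L → Saturated G V L
  saturate {G} v∈ good [] = inj₁ (G , (λ _ _ → refl) , good , λ ())
  saturate {V = V} v∈ good ((a , b) ∷ L) with saturate v∈ good L
  ... | inj₂ r = inj₂ r
  ... | inj₁ (G , eq , good′ , all) with a ≟ b | adj? G a b
  ... | yes a≡b | _ = inj₁ (G , eq , good′ , λ { (here refl) a≢b → ⊥-elim (a≢b a≡b) ; (there ab∈) → all ab∈ })
  ... | no _ | yes ab = inj₁ (G , eq , good′ , λ { (here refl) _ → ab ; (there ab∈) → all ab∈ })
  ... | no a≢b | no ¬ab with heaviest-path G v∈
  ... | u , u′ , us , P , max with h + h <? pw (w G) us
  ... | yes big = inj₂ (G , eq , good′ , (u , u′ , us , P , max) , big)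
  ... | no ¬big = inj₁ (setEdge , (λ u v → trans (same-w u v) (eq u v)) , record
      { cyc = setEdge-cycles (cyc good′) (λ {xs} Q _ → ≤-trans (≤-reflexive (+-identityʳ (pw (w G) xs))) (≤-trans (max Q) (≮⇒≥ ¬big)))
      ; hvy = λ {c} {d} c∈ d∈ h<w → let xs , mkPath q u s , 3≤ = hvy good′ c∈ d∈ (subst (h <_) (same-w c d) h<w)
                                    in xs , mkPath (Pth-map (λ _ _ → inj₂) q) u s , 3≤
      } , λ { (here refl) _ → inj₁ (inj₁ (refl , refl)) ; (there ab∈) c≢d → inj₂ (all ab∈ c≢d) })
    where
    open SetEdge _≟_ G a≢b 0
    same-w : SameWeights G setEdge
    same-w u v with same? u v
    ... | yes (inj₁ (refl , refl)) = sym (w-off G ¬ab)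
    ... | yes (inj₂ (refl , refl)) = sym (w-off G (¬ab ∘ adj-sym G))
    ... | no _ = refl

  halve : ∀ {x y} → x + y ≤ h + h → x ≤ h ⊎ y ≤ h
  halve {x} {y} le with x ≤? h | y ≤? h
  ... | yes p | _     = inj₁ p
  ... | no _  | yes q = inj₂ q
  ... | no p  | no q  = ⊥-elim (<⇒≱ (+-mono-< (≰⇒> p) (≰⇒> q)) le)

  low-degree : ∀ {G V v} → IH (length V) → 2 ≤ length V → Unique V → Good G V → v ∈ V → ∑ (w G v) V ≤ h → Bound G V
  low-degree {G} {v = v} ih 2≤ u good v∈ le with ∈-∃++ v∈
  ... | V₁ , V₂ , refl = Bound-↭ {G} (↭-sym perm) (delete-step v (V₁ ++ V₂) (subst IH (Perm.↭-length perm) ih)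
        (s≤s⁻¹ (subst (2 ≤_) (Perm.↭-length perm) 2≤)) (Unique-↭ perm u) (Good-↭ perm good)
        (≤-trans (m≤n+m _ (w G v v)) (≤-trans (≤-reflexive (sym (∑-↭ (w G v) perm))) le)))
    where perm = Perm.shift v V₁ V₂

  bound : ∀ N {G V} → length V < N → 1 ≤ length V → Unique V → Good G V → Bound G V
  bound (suc N) {G} {v ∷ []} lt _ u good = ≤-reflexive (cong (λ s → s + (h + h)) (cong (λ s → s + 0 + 0) (w-loop G v)) ⟨ trans ⟩ sym (+-identityʳ (h + h)))
  -- On two vertices no edge is heavy, as its cycle would need a third.
  bound (suc N) {G} {a ∷ b ∷ []} lt _ u good = delete-step a [ b ] (λ lt′ → bound N (≤-trans lt′ (s≤s⁻¹ lt))) (s≤s z≤n) u good light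
    where
    light : w G a b + 0 ≤ h
    light with w G a b ≤? h
    ... | yes le = ≤-trans (≤-reflexive (+-identityʳ (w G a b))) le
    ... | no nle with hvy good (here refl) (there (here refl)) (≰⇒> nle)
    ... | xs , P , 3≤ with s≤s (s≤s ()) ← ≤-trans 3≤ (length-⊆ (uniq P) (sub P))
  bound (suc N) {G} {V@(v ∷ _ ∷ _ ∷ _)} lt 1≤ u good = conclude (saturate {G} (here refl) good (cartesianProduct V V))
    where
    ih : IH (length V)
    ih lt′ = bound N (≤-trans lt′ (s≤s⁻¹ lt))
    transfer : ∀ {G′} → SameWeights G G′ → Bound G′ V → Bound G V
    transfer eq = subst (λ s → s + (h + h) ≤ length V * (h + h)) (T-cong V (λ {u} {v} _ _ → eq u v))
    conclude : Saturated G V (cartesianProduct V V) → Bound G V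
    conclude (inj₁ (G′ , eq , good′ , all)) = transfer {G′} eq
      (complete-bound G′ (s≤s (s≤s (s≤s z≤n))) u good′ (λ a∈ b∈ → all (∈-cartesianProduct⁺ a∈ b∈)))
    conclude (inj₂ (G′ , eq , good′ , (a , b , us , P , max) , big)) with degrees G′ u good′ (record { path = P ; max = max ; big = big })
    ... | inj₂ (m , S , U , p , 1≤S , 1≤U , cross) = transfer {G′} eq (Bound-↭ {G′} (↭-sym p)
          (cut-step m S U (subst IH (Perm.↭-length p) ih) 1≤S 1≤U (Unique-↭ p u) (Good-↭ p good′) cross))
    ... | inj₁ le with halve le
    ...   | inj₁ a≤ = transfer {G′} eq (low-degree ih (s≤s (s≤s z≤n)) u good′ (sub P (first∈ (pth P))) a≤)
    ...   | inj₂ b≤ = transfer {G′} eq (low-degree ih (s≤s (s≤s z≤n)) u good′ (sub P (last∈ (pth P))) b≤)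

-- Natural edge weights

∑-map : ∀ {A B : Set} (f : B → ℕ) (g : A → B) xs → ∑ f (map g xs) ≡ ∑ (f ∘ g) xs
∑-map f g []       = refl
∑-map f g (x ∷ xs) = cong (f (g x) +_) (∑-map f g xs)

∑-cartesianProduct : ∀ {A B : Set} (f : A × B → ℕ) xs ys → ∑ f (cartesianProduct xs ys) ≡ ∑ (λ x → ∑ (λ y → f (x , y)) ys) xs
∑-cartesianProduct f []       ys = refl
∑-cartesianProduct f (x ∷ xs) ys = trans (∑-++ f (map (x ,_) ys)) (cong₂ _+_ (∑-map f (x ,_) ys) (∑-cartesianProduct f xs ys))

∑-mapMaybe : ∀ {A B : Set} (f : B → ℕ) (g : A → Maybe B) xs → ∑ f (mapMaybe g xs) ≡ ∑ (maybe f 0 ∘ g) xs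
∑-mapMaybe f g [] = refl
∑-mapMaybe f g (x ∷ xs) with g x
... | just y  = cong (f y +_) (∑-mapMaybe f g xs)
... | nothing = ∑-mapMaybe f g xs

module _ {A : Set} where

  -- `cyclicPairs` with the closing vertex `z` left free, so that it stays fixed while the list is
  -- taken apart; the two agree when `z` is the first vertex.
  closePairs : List A → A → List (A × A)
  closePairs xs z = zip xs (drop 1 xs ∷ʳ z)

  closePairs⁺ : ∀ {R : A → A → Set} {a b xs z} → Pth R a b xs → R b z → All (λ (u , v) → R u v) (closePairs xs z)
  closePairs⁺ one r = r ∷ []
  closePairs⁺ (s ∷ p) r with Pth-∷ p
  ... | _ , refl = s ∷ closePairs⁺ p r

  closePairs⁻ : ∀ {R Q : A → A → Set} {a b xs z} → Pth Q a b xs → All (λ (u , v) → R u v) (closePairs xs z) → Pth R a b xs × R b z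
  closePairs⁻ one (r ∷ []) = one , r
  closePairs⁻ (s ∷ p) rs with Pth-∷ p
  closePairs⁻ (s ∷ p) (r ∷ rs) | _ , refl with closePairs⁻ p rs
  ... | q , t = r ∷ q , t

  closePairs-Any : ∀ {R : A → A → Set} {J : A × A → Set} {a b xs z} → Pth R a b xs → Any J (closePairs xs z) →
    J (b , z) ⊎ ∃₂ λ ps s → ∃₂ λ t qs → xs ≡ ps ++ s ∷ t ∷ qs × J (s , t)
  closePairs-Any one (here j) = inj₁ j
  closePairs-Any (s ∷ p) js with Pth-∷ p
  closePairs-Any (s ∷ p) (here j) | _ , refl = inj₂ ([] , _ , _ , _ , refl , j)
  closePairs-Any {a = a} (s ∷ p) (there js) | _ , refl with closePairs-Any p js
  ... | inj₁ j = inj₁ j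
  ... | inj₂ (ps , x , y , qs , eq , j) = inj₂ (a ∷ ps , x , y , qs , cong (a ∷_) eq , j)

module Transfer {n : ℕ} (G : Graph n) (h : ℕ) (wt : Edge G → ℕ)
  (cycles : ∀ {vs} → IsCycle G vs → ∑ wt (filter (λ e → _∈E?_ G e vs) (edges G)) ≤ h + h)
  (heavy  : ∀ {e} → h < wt e → OnCycle G e) where

  open Graph G using (adj; Adj; adj-sym; adj-irrefl)

  private
    val : Fin n × Fin n → ℕ
    val p = maybe wt 0 (edge? G p)

    -- `edge?` accepts only increasing pairs, so at most one summand differs from 0 and the weight
    -- of an edge is read off in either direction.
    W : Fin n → Fin n → ℕ
    W u v = val (u , v) + val (v , u)

    val-nonadj : ∀ u v → ¬ Adj u v → val (u , v) ≡ 0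
    val-nonadj u v ¬uv with u Fin.<? v | T? (adj u v)
    ... | yes _ | yes uv = ⊥-elim (¬uv uv)
    ... | yes _ | no _   = refl
    ... | no _  | yes _  = refl
    ... | no _  | no _   = refl

    val-≥ : ∀ u v → ¬ u Fin.< v → val (u , v) ≡ 0
    val-≥ u v u≮v with u Fin.<? v | T? (adj u v)
    ... | yes u<v | _     = ⊥-elim (u≮v u<v)
    ... | no _    | yes _ = refl
    ... | no _    | no _  = refl

    val-edge : ∀ u v → u Fin.< v → Adj u v → ∃ λ e → src e ≡ u × tgt e ≡ v × val (u , v) ≡ wt e
    val-edge u v u<v uv with u Fin.<? v | T? (adj u v)
    ... | yes p | yes q = edge u v p q , refl , refl , refl
    ... | no ¬p | _     = ⊥-elim (¬p u<v)
    ... | yes _ | no ¬q = ⊥-elim (¬q uv)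

    H : WGraph {Fin n}
    H = record
      { Adj = Adj ; adj? = λ u v → T? (adj u v) ; adj-sym = λ {u} {v} → adj-sym {u} {v} ; adj-irr = λ {u} → adj-irrefl {u}
      ; w = W ; w-sym = λ u v → +-comm (val (u , v)) (val (v , u))
      ; w-off = λ {u} {v} ¬uv → cong₂ _+_ (val-nonadj u v ¬uv) (val-nonadj v u (¬uv ∘ adj-sym {v} {u})) }

    edge-of : ∀ u v → Adj u v → ∃ λ e → Joins G e (u , v) × wt e ≡ W u v
    edge-of u v uv with Fin.<-cmp u v
    ... | tri< u<v _ v≮u = let e , p , q , r = val-edge u v u<v uv
                           in e , inj₁ (p , q) , trans (sym r) (trans (sym (+-identityʳ _)) (cong (val (u , v) +_) (sym (val-≥ v u v≮u))))
    ... | tri≈ _ refl _  = ⊥-elim (adj-irrefl {u} uv)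
    ... | tri> u≮v _ v<u = let e , p , q , r = val-edge v u v<u (adj-sym {u} {v} uv)
                           in e , inj₂ (p , q) , trans (sym r) (cong (_+ val (v , u)) (sym (val-≥ u v u≮v)))

    Within : List (Fin n) → Edge G → Set
    Within xs e = src e ∈ xs × tgt e ∈ xs

    Joins⇒Within : ∀ e {u v xs} → Joins G e (u , v) → u ∈ xs → v ∈ xs → Within xs e
    Joins⇒Within e (inj₁ (refl , refl)) u∈ v∈ = u∈ , v∈
    Joins⇒Within e (inj₂ (refl , refl)) u∈ v∈ = v∈ , u∈

    Joins-endˡ : ∀ e {u v xs} → Joins G e (u , v) → Within xs e → u ∈ xs
    Joins-endˡ e (inj₁ (refl , refl)) (s , t) = s
    Joins-endˡ e (inj₂ (refl , refl)) (s , t) = t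

    -- The first vertex is an end of the first edge and of no later one, which keeps the edges
    -- distinct. The closing vertex `z` is arbitrary, because the recursion changes where the walk
    -- begins.
    path-edges : ∀ {a b xs} → Pth Adj a b xs → Unique xs → ∃ λ es → Unique es × ∑ wt es ≡ pw W xs ×
      (∀ {e} → e ∈ es → Within xs e × ∀ z → Any (Joins G e) (closePairs xs z))
    path-edges one u = [] , [] , refl , λ ()
    path-edges {a} (_∷_ {b = c} r p) u@(_ ∷ u′) with edge-of a c r | path-edges p u′ | Pth-∷ p
    ... | e , j , we | es , ues , sum , inn | ys , refl = e ∷ es
      , All.tabulate (λ f∈ → λ { refl → Unique-∉ u (Joins-endˡ e j (proj₁ (inn f∈))) }) ∷ ues
      , cong₂ _+_ we sum
      , λ { (here refl) → Joins⇒Within e j (here refl) (there (here refl)) , λ z → here j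
          ; (there f∈) → let (s , t) , k = inn f∈ in (there s , there t) , λ z → there (k z) }

    -- The closing edge and the first edge both contain `a`; they could coincide only on a cycle of
    -- two vertices.
    cycle-edges : ∀ {a b xs} → Pth Adj a b xs → Unique xs → 3 ≤ length xs → Adj b a → ∃ λ es → Unique es × ∑ wt es ≡ pw W xs + W b a ×
      (∀ {e} → e ∈ es → Any (Joins G e) (closePairs xs a))
    cycle-edges one u (s≤s ()) _
    cycle-edges {a} {b} (_∷_ {b = c} r p) u@(_ ∷ u′) 3≤ ba with edge-of a c r | edge-of b a ba | path-edges p u′ | Pth-∷ p
    ... | e , j , we | f , k , wf | es , ues , sum , inn | ys , refl = f ∷ e ∷ es
      , (f≢e ∷ All.tabulate (λ g∈ → λ { refl → Unique-∉ u (Joins-endʳ f k (proj₁ (inn g∈))) }))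
        ∷ All.tabulate (λ g∈ → λ { refl → Unique-∉ u (Joins-endˡ e j (proj₁ (inn g∈))) }) ∷ ues
      , trans (cong₂ _+_ wf (cong₂ _+_ we sum)) (+-comm (W b a) _)
      , λ { (here refl) → there (closing p k) ; (there (here refl)) → here j ; (there (there g∈)) → there (proj₂ (inn g∈) a) }
      where
      closing : ∀ {a b xs z} → Pth Adj a b xs → Joins G f (b , z) → Any (Joins G f) (closePairs xs z)
      closing one k = here k
      closing (r ∷ p) k with Pth-∷ p
      ... | _ , refl = there (closing p k)
      Joins-endʳ : ∀ e {u v xs} → Joins G e (u , v) → Within xs e → v ∈ xs
      Joins-endʳ e (inj₁ (refl , refl)) (s , t) = t
      Joins-endʳ e (inj₂ (refl , refl)) (s , t) = s
      c≢b : c ≢ b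
      c≢b refl with s≤s (s≤s ()) ← subst (λ l → 3 ≤ suc (length l)) (Pth-loop u′ p) 3≤
      clash : Joins G e (b , a) → Joins G e (a , c) → ⊥
      clash (inj₁ (refl , refl)) (inj₁ (p , _)) = adj-irrefl {a} (subst (λ x → Adj x a) p ba)
      clash (inj₁ (refl , refl)) (inj₂ (p , _)) = c≢b (sym p)
      clash (inj₂ (refl , refl)) (inj₁ (_ , p)) = c≢b (sym p)
      clash (inj₂ (refl , refl)) (inj₂ (_ , p)) = adj-irrefl {a} (subst (λ x → Adj x a) p ba)
      f≢e : f ≢ e
      f≢e refl = clash k j

    open Splitting {Fin n} Fin._≟_ h

    orient : ∀ e {u v s t xs} → Joins G e (u , v) → Joins G e (s , t) → Path H (allFin n) t s xs → 3 ≤ length xs →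
      ∃ λ xs → Path H (allFin n) u v xs × 3 ≤ length xs
    orient e {xs = xs} (inj₁ (refl , refl)) (inj₁ (refl , refl)) P 3≤ = _ , Path-reverse P , length-reverse-≤ xs 3≤
    orient e (inj₁ (refl , refl)) (inj₂ (refl , refl)) P 3≤ = _ , P , 3≤
    orient e (inj₂ (refl , refl)) (inj₁ (refl , refl)) P 3≤ = _ , P , 3≤
    orient e {xs = xs} (inj₂ (refl , refl)) (inj₂ (refl , refl)) P 3≤ = _ , Path-reverse P , length-reverse-≤ xs 3≤

    -- If `e` joins an inner pair of the cyclic list, the list is rotated until that pair closes it;
    -- what remains is a path between the ends of `e`.
    to-path : ∀ e {u v} → Joins G e (u , v) → OnCycle G e → ∃ λ xs → Path H (allFin n) u v xs × 3 ≤ length xs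
    to-path e j (x ∷ xs , (3≤ , u , all) , on) with Pth-any x xs
    ... | b , q with closePairs⁻ q all
    ... | p , bx with closePairs-Any p on
    ... | inj₁ k = orient e j k (mkPath p u (λ _ → ∈-allFin _)) 3≤
    ... | inj₂ (ps , s , t , qs , eq , k) with splitE ps (subst (Pth Adj x b) eq p)
    ... | p₁ , _ , p₂ = orient e j k (mkPath (joinE p₂ bx p₁) (Unique-↭ perm u) (λ _ → ∈-allFin _)) (subst (3 ≤_) (Perm.↭-length perm) 3≤)
      where
      perm : x ∷ xs ↭ (t ∷ qs) ++ (ps ++ [ s ])
      perm = ↭-trans (Perm.↭-reflexive (trans eq (sym (++-assoc ps [ s ] (t ∷ qs))))) (Perm.++-comm (ps ++ [ s ]) (t ∷ qs))

    good : Good H (allFin n)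
    good = record
      { cyc = λ {a} {b} {xs} P 3≤ ba → let es , ues , sum , on = cycle-edges (pth P) (uniq P) 3≤ ba in
          ≤-trans (≤-reflexive (sym sum)) (≤-trans
            (∑-⊆ wt es (filter (λ e → _∈E?_ G e xs) (edges G)) ues (λ {e} e∈ → inj₂ (∈-filter⁺ (λ e → _∈E?_ G e xs) (edges-complete G e) (cyclic (pth P) (on e∈)))))
            (cycles (is-cycle P 3≤ ba)))
      ; hvy = λ {a} {b} _ _ h<w → let e , j , we = edge-of a b (0<w⇒adj H {h} {a} {b} h<w) in to-path e j (heavy {e} (subst (h <_) (sym we) h<w)) }
      where
      open WGraph using (0<w⇒adj)
      cyclic : ∀ {a b xs} {J : Fin n × Fin n → Set} → Pth Adj a b xs → Any J (closePairs xs a) → Any J (cyclicPairs xs)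
      cyclic p j with Pth-∷ p
      ... | _ , refl = j
      is-cycle : ∀ {a b xs} → Path H (allFin n) a b xs → 3 ≤ length xs → Adj b a → IsCycle G xs
      is-cycle P 3≤ ba with Pth-∷ (pth P)
      ... | _ , refl = 3≤ , uniq P , closePairs⁺ (pth P) ba

    total : T W (allFin n) ≡ 2 * ∑ wt (edges G)
    total = begin
      ∑ (λ u → ∑ (λ v → val (u , v) + val (v , u)) V) V
        ≡⟨ ∑-cong V (λ {u} _ → ∑-+ (λ v → val (u , v)) (λ v → val (v , u)) V) ⟩
      ∑ (λ u → ∑ (λ v → val (u , v)) V + ∑ (λ v → val (v , u)) V) V
        ≡⟨ ∑-+ _ _ V ⟩
      S + ∑ (λ u → ∑ (λ v → val (v , u)) V) V
        ≡⟨ cong (S +_) (∑-comm (λ u v → val (v , u)) V V) ⟩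
      S + S
        ≡⟨ cong (S +_) (+-identityʳ S) ⟨
      2 * S
        ≡⟨ cong (2 *_) (trans (∑-mapMaybe wt (edge? G) (cartesianProduct V V)) (∑-cartesianProduct val V V)) ⟨
      2 * ∑ wt (edges G) ∎
      where
      open ≡-Reasoning
      V = allFin n
      S = ∑ (λ u → ∑ (λ v → val (u , v)) V) V

  edge-bound : 1 ≤ n → 2 * ∑ wt (edges G) + (h + h) ≤ n * (h + h)
  edge-bound 1≤n = subst₂ (λ s l → s + (h + h) ≤ l * (h + h)) total len
    (Theorem.bound {Fin n} Fin._≟_ h (candidates G) (∈-candidates G) _ ≤-refl (subst (1 ≤_) (sym len) 1≤n) (UniqueP.allFin⁺ n) good)
    where
    len : length (allFin n) ≡ n
    len = length-tabulate id

open import Algebra.Bundles using (CommutativeRing)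
open import Data.Integer as ℤ using (+_; -[1+_]; _-_)
import Data.Integer.Properties as ℤ
open import Data.List using (foldr)
open import Data.List.Membership.Propositional.Properties using (∈-map⁺)
open import Data.Nat using (_⊔_)
open import Data.Rational as ℚ using (ℚ; 0ℚ; 1ℚ; ½; mkℚ; _/_)
import Data.Rational.Properties as ℚ
open import Data.Rational.Unnormalised using (mkℚᵘ; *≡*)
import Data.Rational.Unnormalised.Properties as ℚᵘ

open CommutativeRing ℚ.+-*-commutativeRing using () renaming (semiring to ℚ-semiring)
open import Algebra.Properties.Semiring.Mult ℚ-semiring using () renaming (_×_ to _·_; ×-homo-+ to ·-homo-+; ×-assocˡ to ·-assocˡ; ×-assoc-* to ·-assoc-*; ×-comm-* to ·-comm-*)

-- Rational and real weights

*-pos : ∀ {p q} → 0ℚ ℚ.< p → 0ℚ ℚ.< q → 0ℚ ℚ.< p ℚ.* q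
*-pos {p} {q} 0<p 0<q = ℚ.positive⁻¹ (p ℚ.* q) {{ℚ.pos*pos⇒pos p {{ℚ.positive 0<p}} q {{ℚ.positive 0<q}}}}

·-≥0 : ∀ k {u} → 0ℚ ℚ.≤ u → 0ℚ ℚ.≤ k · u
·-≥0 zero    0≤u = ℚ.≤-refl
·-≥0 (suc k) {u} 0≤u = ℚ.+-mono-≤ {0ℚ} {u} {0ℚ} {k · u} 0≤u (·-≥0 k 0≤u)

·-mono : ∀ {u m n} → 0ℚ ℚ.≤ u → m ≤ n → m · u ℚ.≤ n · u
·-mono {n = n} 0≤u z≤n       = ·-≥0 n 0≤u
·-mono {u}     0≤u (s≤s m≤n) = ℚ.+-monoʳ-≤ u (·-mono 0≤u m≤n)

·-cancel-≤ : ∀ {u} m n → 0ℚ ℚ.< u → m · u ℚ.≤ n · u → m ≤ n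
·-cancel-≤ {u} m n 0<u le with m ≤? n
... | yes m≤n = m≤n
... | no  m≰n = ⊥-elim (ℚ.<-irrefl refl (ℚ.<-≤-trans strict (ℚ.≤-trans (·-mono (ℚ.<⇒≤ 0<u) (≰⇒> m≰n)) le)))
  where
  strict : n · u ℚ.< u ℚ.+ n · u
  strict = subst (ℚ._< u ℚ.+ n · u) (ℚ.+-identityˡ (n · u)) (ℚ.+-monoˡ-< (n · u) 0<u)

/-· : ∀ s d → (+ s) / suc d ≡ s · ((+ 1) / suc d)
/-· zero    d = ℚ.fromℚᵘ-cong {mkℚᵘ (+ 0) d} {mkℚᵘ (+ 0) 0} (*≡* refl)
/-· (suc s) d = trans (ℚ.toℚᵘ-injective (ℚᵘ.≃-trans (ℚ.toℚᵘ-fromℚᵘ (mkℚᵘ (+ suc s) d)) (ℚᵘ.≃-trans (*≡* split)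
    (ℚᵘ.≃-sym (ℚᵘ.≃-trans (ℚ.toℚᵘ-homo-+ ((+ 1) / suc d) ((+ s) / suc d)) (ℚᵘ.+-cong (ℚ.toℚᵘ-fromℚᵘ (mkℚᵘ (+ 1) d)) (ℚ.toℚᵘ-fromℚᵘ (mkℚᵘ (+ s) d))))))))
  (cong ((+ 1) / suc d ℚ.+_) (/-· s d))
  where
  split : + suc s ℤ.* (+ suc d ℤ.* + suc d) ≡ (+ 1 ℤ.* + suc d ℤ.+ + s ℤ.* + suc d) ℤ.* + suc d
  split = trans (sym (ℤ.*-assoc (+ suc s) (+ suc d) (+ suc d))) (cong (ℤ._* + suc d) (ℤ.*-distribʳ-+ (+ suc d) (+ 1) (+ s)))

n/n : ∀ d → (+ suc d) / suc d ≡ 1ℚ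
n/n d = ℚ.fromℚᵘ-cong {mkℚᵘ (+ suc d) d} {mkℚᵘ (+ 1) 0} (*≡* (ℤ.*-comm (+ suc d) (+ 1)))

fraction : ∀ q → 0ℚ ℚ.≤ q → ∃₂ λ s t → ∃ λ v → 0ℚ ℚ.< v × t · v ≡ 1ℚ × q ≡ s · v
fraction q@(mkℚ (+ s) d _) 0≤q = s , suc d , (+ 1) / suc d , ℚ.positive⁻¹ ((+ 1) / suc d) {{ℚ.normalize-pos 1 (suc d)}}
  , trans (sym (/-· (suc d) d)) (n/n d) , trans (sym (ℚ.↥p/↧p≡p q)) (/-· s d)
fraction q@(mkℚ (-[1+ _ ]) d _) 0≤q with () ← ℚ.nonNegative {q} 0≤q

-- `N · u ≡ 1ℚ` is carried along because 1, the bound for cycles, must become a whole number of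
-- units too. A new denominator `t` multiplies `N` and divides the unit.
common-denominator : ∀ {A : Set} (q : A → ℚ) → (∀ x → 0ℚ ℚ.≤ q x) → ∀ xs →
  ∃₂ λ N u → 0ℚ ℚ.< u × N · u ≡ 1ℚ × (∀ {x} → x ∈ xs → ∃ λ a → q x ≡ a · u)
common-denominator q q≥0 [] = 1 , 1ℚ , ℚ.positive⁻¹ 1ℚ , ℚ.+-identityʳ 1ℚ , λ ()
common-denominator q q≥0 (x ∷ xs) with common-denominator q q≥0 xs | fraction (q x) (q≥0 x)
... | N , u , u>0 , Nu , all | s , t , v , v>0 , tv , qx = N * t , u ℚ.* v , *-pos u>0 v>0
  , trans (sym (·-assocˡ (u ℚ.* v) N t)) (trans (cong (N ·_) coarse) Nu)
  , λ { (here refl) → s * N , trans qx (trans (cong (s ·_) fine) (·-assocˡ (u ℚ.* v) s N))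
      ; (there y∈)  → let a , eq = all y∈ in a * t , trans eq (trans (cong (a ·_) (sym coarse)) (·-assocˡ (u ℚ.* v) a t)) }
  where
  coarse : t · (u ℚ.* v) ≡ u
  coarse = trans (sym (·-comm-* t u v)) (trans (cong (u ℚ.*_) tv) (ℚ.*-identityʳ u))
  fine : v ≡ N · (u ℚ.* v)
  fine = trans (sym (ℚ.*-identityˡ v)) (trans (cong (ℚ._* v) (sym Nu)) (·-assoc-* N u v))

*-inv : ∀ {p} → 0ℚ ℚ.< p → inv p ℚ.* p ≡ 1ℚ
*-inv {p} p>0 with p ℚ.≟ 0ℚ
... | yes p≡0 = ⊥-elim (ℚ.<-irrefl (sym p≡0) p>0)
... | no p≢0  = ℚ.*-inverseˡ p {{ℚ.≢-nonZero p≢0}}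

∑ℚ : ∀ {A : Set} → (A → ℚ) → List A → ℚ
∑ℚ f []       = 0ℚ
∑ℚ f (x ∷ xs) = f x ℚ.+ ∑ℚ f xs

module _ {A : Set} where

  seq-sum : ∀ (g : A → ℝ) m xs → seq (sumℝ (map g xs)) m ≡ ∑ℚ (λ x → seq (g x) m) xs
  seq-sum g m []       = refl
  seq-sum g m (x ∷ xs) = cong (seq (g x) m ℚ.+_) (seq-sum g m xs)

  ∑ℚ-· : ∀ {u} (f : A → ℚ) (a : A → ℕ) → (∀ x → f x ≡ a x · u) → ∀ xs → ∑ℚ f xs ≡ ∑ a xs · u
  ∑ℚ-· f a h [] = refl
  ∑ℚ-· {u} f a h (x ∷ xs) = trans (cong₂ ℚ._+_ (h x) (∑ℚ-· f a h xs)) (sym (·-homo-+ u (a x) (∑ a xs)))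

  ∑ℚ-≥0 : ∀ (f : A → ℚ) → (∀ x → 0ℚ ℚ.≤ f x) → ∀ xs → 0ℚ ℚ.≤ ∑ℚ f xs
  ∑ℚ-≥0 f h []       = ℚ.≤-refl
  ∑ℚ-≥0 f h (x ∷ xs) = ℚ.+-mono-≤ {0ℚ} {f x} {0ℚ} {∑ℚ f xs} (h x) (∑ℚ-≥0 f h xs)

  ∑ℚ-*-≤ : ∀ {f g : A → ℚ} {c} xs → (∀ {x} → x ∈ xs → f x ℚ.* c ℚ.≤ g x) → ∑ℚ f xs ℚ.* c ℚ.≤ ∑ℚ g xs
  ∑ℚ-*-≤ {c = c} [] h = ℚ.≤-reflexive (ℚ.*-zeroˡ c)
  ∑ℚ-*-≤ {f} {g} {c} (x ∷ xs) h = ℚ.≤-trans (ℚ.≤-reflexive (ℚ.*-distribʳ-+ c (f x) (∑ℚ f xs)))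
    (ℚ.+-mono-≤ {f x ℚ.* c} {g x} {∑ℚ f xs ℚ.* c} {∑ℚ g xs} (h (here refl)) (∑ℚ-*-≤ xs (h ∘ there)))

  eventually : ∀ {P : A → ℕ → Set} → (∀ x → ∃ λ N → ∀ m → N ≤ m → P x m) → ∀ xs → ∃ λ N → ∀ m → N ≤ m → ∀ {x} → x ∈ xs → P x m
  eventually h [] = 0 , λ _ _ ()
  eventually h (x ∷ xs) with h x | eventually h xs
  ... | M , p | N , r = M ⊔ N , λ m le → λ
    { (here refl) → p m (m⊔n≤o⇒m≤o M N le)
    ; (there x∈)  → r m (m⊔n≤o⇒n≤o M N le) x∈ }

foldr-⊔-≥ : ∀ m z ys {y} → y ∈ ys → seq y m ℚ.≤ seq (foldr _⊔ℝ_ z ys) m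
foldr-⊔-≥ m z (y ∷ ys) (here refl) = ℚ.p≤p⊔q (seq y m) (seq (foldr _⊔ℝ_ z ys) m)
foldr-⊔-≥ m z (y ∷ ys) (there y∈)  = ℚ.≤-trans (foldr-⊔-≥ m z ys y∈) (ℚ.p≤q⊔p (seq y m) (seq (foldr _⊔ℝ_ z ys) m))

foldr-⊔-base : ∀ m z ys → seq z m ℚ.≤ seq (foldr _⊔ℝ_ z ys) m
foldr-⊔-base m z []       = ℚ.≤-refl
foldr-⊔-base m z (y ∷ ys) = ℚ.≤-trans (foldr-⊔-base m z ys) (ℚ.p≤q⊔p (seq y m) (seq (foldr _⊔ℝ_ z ys) m))

-- Rational weights: one index of the Cauchy sequences

module AtIndex {k : ℕ} (G : Graph (suc k)) (w : Edge G → ℝ) (m : ℕ) (w>0 : ∀ e → 0ℚ ℚ.< seq (w e) m) where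

  private
    x : Edge G → ℚ
    x e = seq (w e) m

    c : Edge G → ℚ
    c e = seq (C G w e) m

    q : Edge G → ℚ
    q e = x e ℚ.* inv (c e)

    on : List (Fin (suc k)) → List (Edge G)
    on vs = filter (λ e → _∈E?_ G e vs) (edges G)

    weight-seq : ∀ vs → seq (weight G w vs) m ≡ ∑ℚ x (on vs)
    weight-seq vs = seq-sum w m (on vs)

    weight>0 : ∀ e es → 0ℚ ℚ.< ∑ℚ x (e ∷ es)
    weight>0 e es = ℚ.+-mono-<-≤ {0ℚ} {x e} {0ℚ} {∑ℚ x es} (w>0 e) (∑ℚ-≥0 x (λ e → ℚ.<⇒≤ (w>0 e)) es)

    cycle≤c : ∀ e vs → CycleThrough G e vs → ∑ℚ x (on vs) ℚ.≤ c e
    cycle≤c e vs t = go (onCycle? G e)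
      where
      go : ∀ d → ∑ℚ x (on vs) ℚ.≤ seq (maxCycle G w e d) m
      go (yes (vs₀ , _)) = ℚ.≤-trans (ℚ.≤-reflexive (sym (weight-seq vs))) (foldr-⊔-≥ m (weight G w vs₀) (map (weight G w) (cyclesThrough G e)) (∈-map⁺ (weight G w) (∈-cyclesThrough G {e} {vs} t)))
      go (no ¬t) = ⊥-elim (¬t (vs , t))

    double : ∀ p → (1ℚ ℚ.+ 1ℚ) ℚ.* p ≡ p ℚ.+ p
    double p = trans (ℚ.*-distribʳ-+ p 1ℚ 1ℚ) (cong₂ ℚ._+_ (ℚ.*-identityˡ p) (ℚ.*-identityˡ p))

    bridge-c : ∀ e → ¬ OnCycle G e → c e ≡ x e ℚ.+ x e
    bridge-c e ¬t = go (onCycle? G e)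
      where
      go : ∀ d → seq (maxCycle G w e d) m ≡ x e ℚ.+ x e
      go (yes t) = ⊥-elim (¬t t)
      go (no _)  = double (x e)

    c>0 : ∀ e → 0ℚ ℚ.< c e
    c>0 e with onCycle? G e in eq
    ... | no _ = subst (0ℚ ℚ.<_) (sym (double (x e))) (ℚ.+-mono-< {0ℚ} {x e} {0ℚ} {x e} (w>0 e) (w>0 e))
    ... | yes (vs , t) = ℚ.<-≤-trans (positive vs t)
          (subst (ℚ._≤ seq (foldr _⊔ℝ_ (weight G w vs) (map (weight G w) (cyclesThrough G e))) m) (weight-seq vs)
            (foldr-⊔-base m (weight G w vs) (map (weight G w) (cyclesThrough G e))))
      where
      positive : ∀ vs → CycleThrough G e vs → 0ℚ ℚ.< ∑ℚ x (on vs)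
      positive vs (_ , e∈) with on vs | ∈-filter⁺ (λ e → _∈E?_ G e vs) (edges-complete G e) e∈
      ... | f ∷ es | _ = weight>0 f es

    q*c : ∀ e → q e ℚ.* c e ≡ x e
    q*c e = trans (ℚ.*-assoc (x e) (inv (c e)) (c e)) (trans (cong (x e ℚ.*_) (*-inv (c>0 e))) (ℚ.*-identityʳ (x e)))

    q≥0 : ∀ e → 0ℚ ℚ.≤ q e
    q≥0 e = ℚ.*-cancelʳ-≤-pos {0ℚ} {q e} (c e) {{ℚ.positive (c>0 e)}}
      (subst₂ ℚ._≤_ (sym (ℚ.*-zeroˡ (c e))) (sym (q*c e)) (ℚ.<⇒≤ (w>0 e)))

    -- For each edge `f` of the cycle, `c f` is at least the weight `W` of the cycle, so `q f` times
    -- `W` is at most `x f`. Summed over the cycle, this leaves `W` on both sides to cancel.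
    cycle-q : ∀ vs → IsCycle G vs → ∑ℚ q (on vs) ℚ.≤ 1ℚ
    cycle-q vs cyc with on vs in eq
    ... | [] = ℚ.nonNegative⁻¹ 1ℚ
    ... | e ∷ es = ℚ.*-cancelʳ-≤-pos {∑ℚ q (e ∷ es)} {1ℚ} W {{ℚ.positive (weight>0 e es)}}
          (ℚ.≤-trans (∑ℚ-*-≤ {f = q} {x} {W} (e ∷ es) below) (ℚ.≤-reflexive (sym (ℚ.*-identityˡ W))))
      where
      W = ∑ℚ x (e ∷ es)
      below : ∀ {f} → f ∈ e ∷ es → q f ℚ.* W ℚ.≤ x f
      below {f} f∈ = ℚ.≤-trans
        (ℚ.*-monoˡ-≤-nonNeg (q f) {{ℚ.nonNegative (q≥0 f)}}
          (subst (λ l → ∑ℚ x l ℚ.≤ c f) eq (cycle≤c f vs (cyc , proj₂ (∈-filter⁻ (λ e → _∈E?_ G e vs) {xs = edges G} (subst (f ∈_) (sym eq) f∈))))))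
        (ℚ.≤-reflexive (q*c f))

    bridge-q : ∀ e → ¬ OnCycle G e → q e ℚ.+ q e ℚ.≤ 1ℚ
    bridge-q e ¬t = ℚ.*-cancelʳ-≤-pos {q e ℚ.+ q e} {1ℚ} (x e) {{ℚ.positive (w>0 e)}} (ℚ.≤-reflexive (begin
      (q e ℚ.+ q e) ℚ.* x e           ≡⟨ ℚ.*-distribʳ-+ (x e) (q e) (q e) ⟩
      q e ℚ.* x e ℚ.+ q e ℚ.* x e     ≡⟨ ℚ.*-distribˡ-+ (q e) (x e) (x e) ⟨
      q e ℚ.* (x e ℚ.+ x e)           ≡⟨ cong (q e ℚ.*_) (bridge-c e ¬t) ⟨
      q e ℚ.* c e                     ≡⟨ q*c e ⟩
      x e                             ≡⟨ ℚ.*-identityˡ (x e) ⟨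
      1ℚ ℚ.* x e                      ∎))
      where open ≡-Reasoning

  -- Sums, maxima and quotients in `ℝ` are formed termwise, so this is the inequality of the theorem
  -- at index `m`.
  rational-bound : ∑ℚ q (edges G) ℚ.≤ (+ k) / 2
  rational-bound with common-denominator q q≥0 (edges G)
  ... | N , v , v>0 , Nv , all = ℚ.*-cancelˡ-≤-pos {∑ℚ q (edges G)} {(+ k) / 2} (1ℚ ℚ.+ 1ℚ)
      (subst₂ ℚ._≤_ (sym (double (∑ℚ q (edges G)))) (sym (double ((+ k) / 2))) (begin
        ∑ℚ q (edges G) ℚ.+ ∑ℚ q (edges G)       ≡⟨ cong₂ ℚ._+_ (∑ℚ-· q wt q-wt (edges G)) (∑ℚ-· q wt q-wt (edges G)) ⟩
        ∑ wt (edges G) · u ℚ.+ ∑ wt (edges G) · u ≡⟨ ·-homo-+ u (∑ wt (edges G)) (∑ wt (edges G)) ⟨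
        (∑ wt (edges G) + ∑ wt (edges G)) · u   ≤⟨ ·-mono (ℚ.<⇒≤ u>0) twice ⟩
        (k * (N + N)) · u                       ≡⟨ ·-assocˡ u k (N + N) ⟨
        k · ((N + N) · u)                       ≡⟨ cong (k ·_) 2N ⟩
        k · (½ ℚ.+ ½)                           ≡⟨ ·-distrib k ⟩
        k · ½ ℚ.+ k · ½                         ≡⟨ cong₂ ℚ._+_ (/-· k 1) (/-· k 1) ⟨
        (+ k) / 2 ℚ.+ (+ k) / 2                 ∎))
    where
    open ℚ.≤-Reasoning
    -- Half the unit of the common denominator: `N` of these make 1/2 and `N + N` make 1, so that
    -- `N` takes the part of `h`.
    u : ℚ
    u = v ℚ.* ½
    u>0 : 0ℚ ℚ.< u
    u>0 = *-pos v>0 (ℚ.positive⁻¹ ½)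
    halves : ∀ p → p ℚ.* ½ ℚ.+ p ℚ.* ½ ≡ p
    halves p = trans (sym (ℚ.*-distribˡ-+ p ½ ½)) (ℚ.*-identityʳ p)
    wt : Edge G → ℕ
    wt e = let a = proj₁ (all (edges-complete G e)) in a + a
    q-wt : ∀ e → q e ≡ wt e · u
    q-wt e = let a , eq = all (edges-complete G e) in
      trans eq (trans (sym (halves (a · v))) (trans (cong₂ ℚ._+_ (·-assoc-* a v ½) (·-assoc-* a v ½)) (sym (·-homo-+ u a a))))
    2N : (N + N) · u ≡ 1ℚ
    2N = trans (·-homo-+ u N N) (trans (cong₂ ℚ._+_ (sym (·-assoc-* N v ½)) (sym (·-assoc-* N v ½))) (trans (halves (N · v)) Nv))
    ·-distrib : ∀ k → k · (½ ℚ.+ ½) ≡ k · ½ ℚ.+ k · ½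
    ·-distrib k = trans (·-assocˡ ½ k 2) (trans (cong (_· ½) (trans (*-comm k 2) (cong (λ j → k + j) (+-identityʳ k)))) (·-homo-+ ½ k k))
    cycles : ∀ {vs} → IsCycle G vs → ∑ wt (on vs) ≤ N + N
    cycles {vs} cyc = ·-cancel-≤ (∑ wt (on vs)) (N + N) u>0 (subst₂ ℚ._≤_ (∑ℚ-· q wt q-wt (on vs)) (sym 2N) (cycle-q vs cyc))
    heavy : ∀ {e} → N < wt e → OnCycle G e
    heavy {e} N<wt with onCycle? G e
    ... | yes t = t
    ... | no ¬t = ⊥-elim (<⇒≱ (+-mono-< N<wt N<wt) (·-cancel-≤ (wt e + wt e) (N + N) u>0
          (subst₂ ℚ._≤_ (trans (cong₂ ℚ._+_ (q-wt e) (q-wt e)) (sym (·-homo-+ u (wt e) (wt e)))) (sym 2N) (bridge-q e ¬t))))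
    twice : ∑ wt (edges G) + ∑ wt (edges G) ≤ k * (N + N)
    twice = +-cancelʳ-≤ (N + N) _ _ (≤-trans (≤-reflexive (cong (λ s → ∑ wt (edges G) + s + (N + N)) (sym (+-identityʳ (∑ wt (edges G))))))
      (≤-trans (Transfer.edge-bound G N wt cycles heavy (s≤s z≤n)) (≤-reflexive (+-comm (N + N) (k * (N + N))))))

eventually-positive : ∀ {y} → 0ℝ <ℝ y → ∃ λ N → ∀ m → N ≤ m → 0ℚ ℚ.< seq y m
eventually-positive {y} (η , η>0 , N , h) = N , λ m le → ℚ.<-≤-trans η>0 (subst (ℚ._≤ seq y m) (ℚ.+-identityˡ η) (h m le))

theorem2p1 : (n : ℕ) (G : Graph n) → Connected G →
    (w : Edge G → ℝ) (w>0 : ∀ e → 0ℝ <ℝ w e) →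
    sumℝ (map (λ e → w e /ℝ C G w e [ C-pos G w w>0 e ]) (edges G)) ≤ℝ fromℚ ((+ n - + 1) / 2)
theorem2p1 zero G conn w w>0 with () ← Connected.nonEmpty conn
theorem2p1 (suc k) G _ w w>0 ε ε>0 =
  -- From `N` on all weights are positive at index `m`, and the inequality holds there between
  -- rationals; `ε` is added at the end.
  let N , pos = eventually {P = λ e m → 0ℚ ℚ.< seq (w e) m} (λ e → eventually-positive {w e} (w>0 e)) (edges G)
  in N , λ m le → ℚ.≤-trans
    (ℚ.≤-reflexive (seq-sum (λ e → w e /ℝ C G w e [ C-pos G w w>0 e ]) m (edges G)))
    (ℚ.≤-trans (AtIndex.rational-bound G w m (λ e → pos m le (edges-complete G e)))
      (ℚ.≤-trans (ℚ.≤-reflexive (sym (ℚ.+-identityʳ ((+ k) / 2)))) (ℚ.+-monoʳ-≤ ((+ k) / 2) (ℚ.<⇒≤ ε>0))))
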